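{- For every $\mathrm{C}^2$ sentence $\varphi$, the sets $\mathrm{spec}(\varphi)$ and $\Pi\text{ - }\mathrm{spec}(\varphi)$ are semilinear. Furthermore, each of these spectra can be represented by an existential Presburger arithmetic formula of size doubly exponential in (the length of) $\varphi$.
   Context: Fix a vocabulary $\sigma$ of unary predicates $U_1,\dots,U_n$ and binary predicates $R_1,\dots,R_m$. $\mathrm{C}^2$ is two-variable first-order logic (variables $x,y$) over $\sigma$ extended with counting quantifiers $\exists^{\ge k}y\,\phi$ ("at least $k$ elements $y$ satisfy $\phi$"). A 1-type is a maximal consistent subset of $\{U_i(x),\neg U_i(x): i\le n\}\cup\{R_i(x,x),\neg R_i(x,x): i\le m\}$; fix an enumeration $\pi_1,\dots,\pi_{2^{n+m}}$ of all 1-types. The 1-type cardinality vector of a finite $\sigma$-structure $\mathcal{G}$ is the vector in $\mathbb{N}^{2^{n+m}}$ whose $i$-th entry is the number of elements of $\mathcal{G}$ with 1-type $\pi_i$. $\mathrm{spec}(\varphi)\subseteq\mathbb{N}$ is the set of sizes of finite models of $\varphi$; $\Pi\text{ - }\mathrm{spec}(\varphi)$ is the set of 1-type cardinality vectors of finite models of $\varphi$. A set of vectors of natural numbers is semilinear if it is definable in Presburger arithmetic (equivalently, a finite union of linear sets $\{b+\sum_j \lambda_j p_j:\lambda_j\in\mathbb{N}\}$). -}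

module Defs where

open import Data.Nat using (ℕ; zero; suc; _+_; _*_; _^_; _≤_; _%_; _≡ᵇ_; _≤ᵇ_; ⌊_/2⌋)
open import Data.Nat.Logarithm using (⌊log₂_⌋)
open import Data.Bool using (Bool; true; false; _∧_; _∨_; not; _xor_; if_then_else_)
open import Data.Fin using (Fin; zero; suc; toℕ)
open import Data.Product using (Σ; _×_; _,_; ∃)
open import Data.Vec.Functional using (_++_)
open import Relation.Binary.PropositionalEquality using (_≡_)
open import Function.Bundles using (_⇔_)

countᶠ : {N : ℕ} → (Fin N → Bool) → ℕ
countᶠ {zero}  p = 0
countᶠ {suc N} p = (if p zero then 1 else 0) + countᶠ (λ i → p (suc i))

allᶠ : {N : ℕ} → (Fin N → Bool) → Bool
allᶠ {zero}  p = true
allᶠ {suc N} p = p zero ∧ allᶠ (λ i → p (suc i))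

sumᶠ : {N : ℕ} → (Fin N → ℕ) → ℕ
sumᶠ {zero}  f = 0
sumᶠ {suc N} f = f zero + sumᶠ (λ i → f (suc i))

beq : Bool → Bool → Bool
beq a b = not (a xor b)

bitlen : ℕ → ℕ
bitlen k = suc ⌊log₂ k ⌋

data Var : Set where
  vx vy : Var

var≡ : Var → Var → Bool
var≡ vx vx = true
var≡ vy vy = true
var≡ vx vy = false
var≡ vy vx = false

data C2 (n m : ℕ) : Set where
  U    : Fin n → Var → C2 n m
  R    : Fin m → Var → Var → C2 n m
  Eq   : Var → Var → C2 n m
  Not  : C2 n m → C2 n m
  And  : C2 n m → C2 n m → C2 n m
  Or   : C2 n m → C2 n m → C2 n m
  ExGe : ℕ → Var → C2 n m → C2 n m

size : {n m : ℕ} → C2 n m → ℕ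
size (U i v)      = 2
size (R j v w)    = 3
size (Eq v w)     = 3
size (Not φ)      = suc (size φ)
size (And φ ψ)    = suc (size φ + size ψ)
size (Or φ ψ)     = suc (size φ + size ψ)
size (ExGe k v φ) = 2 + bitlen k + size φ

free : {n m : ℕ} → C2 n m → Var → Bool
free (U i v)      w = var≡ v w
free (R j v v')   w = var≡ v w ∨ var≡ v' w
free (Eq v v')    w = var≡ v w ∨ var≡ v' w
free (Not φ)      w = free φ w
free (And φ ψ)    w = free φ w ∨ free ψ w
free (Or φ ψ)     w = free φ w ∨ free ψ w
free (ExGe k v φ) w = not (var≡ v w) ∧ free φ w

Sentence : {n m : ℕ} → C2 n m → Set
Sentence φ = (free φ vx ≡ false) × (free φ vy ≡ false)

record Structure (n m N : ℕ) : Set where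
  field
    Uᴳ : Fin n → Fin N → Bool
    Rᴳ : Fin m → Fin N → Fin N → Bool
open Structure public

_≟ᶠ_ : {N : ℕ} → Fin N → Fin N → Bool
a ≟ᶠ b = toℕ a ≡ᵇ toℕ b

update : {N : ℕ} → (Var → Fin N) → Var → Fin N → (Var → Fin N)
update a v e w = if var≡ v w then e else a w

eval : {n m N : ℕ} → Structure n m N → (Var → Fin N) → C2 n m → Bool
eval G a (U i v)      = Uᴳ G i (a v)
eval G a (R j v w)    = Rᴳ G j (a v) (a w)
eval G a (Eq v w)     = a v ≟ᶠ a w
eval G a (Not φ)      = not (eval G a φ)
eval G a (And φ ψ)    = eval G a φ ∧ eval G a ψ
eval G a (Or φ ψ)     = eval G a φ ∨ eval G a ψ
eval G a (ExGe k v φ) = k ≤ᵇ countᶠ (λ e → eval G (update a v e) φ)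

_⊨_ : {n m N : ℕ} → Structure n m N → C2 n m → Set
G ⊨ φ = ∀ a → eval G a φ ≡ true

-- 1-types and the 1-type cardinality vector.
-- Enumeration: the 1-type with index t ∈ Fin (2^(n+m)) is the one where
-- U_i(x) holds iff bit i of t is 1 (i < n), and R_j(x,x) holds iff
-- bit (n+j) of t is 1 (j < m).

bit : ℕ → ℕ → Bool
bit t zero    = t % 2 ≡ᵇ 1
bit t (suc j) = bit ⌊ t /2⌋ j

hasType : {n m N : ℕ} → Structure n m N → Fin N → ℕ → Bool
hasType {n} G e t =
  allᶠ (λ i → beq (Uᴳ G i e) (bit t (toℕ i))) ∧
  allᶠ (λ j → beq (Rᴳ G j e e) (bit t (n + toℕ j)))

typeVec : {n m N : ℕ} → Structure n m N → Fin (2 ^ (n + m)) → ℕ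
typeVec G t = countᶠ (λ e → hasType G e (toℕ t))

spec : {n m : ℕ} → C2 n m → ℕ → Set
spec {n} {m} φ N = (1 ≤ N) × Σ (Structure n m N) (λ G → G ⊨ φ)

Πspec : {n m : ℕ} → C2 n m → (Fin (2 ^ (n + m)) → ℕ) → Set
Πspec {n} {m} φ v =
  Σ ℕ λ N → (1 ≤ N) × Σ (Structure n m N) (λ G → (G ⊨ φ) × (∀ t → typeVec G t ≡ v t))

spec¹ : {n m : ℕ} → C2 n m → (Fin 1 → ℕ) → Set
spec¹ φ v = spec φ (v zero)

record LinearSet (d : ℕ) : Set where
  field
    base    : Fin d → ℕ
    nper    : ℕ
    periods : Fin nper → Fin d → ℕ
open LinearSet public

_∈L_ : {d : ℕ} → (Fin d → ℕ) → LinearSet d → Set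
v ∈L L = Σ (Fin (nper L) → ℕ) λ λs →
  ∀ i → v i ≡ base L i + sumᶠ (λ j → λs j * periods L j i)

Semilinear : (d : ℕ) → ((Fin d → ℕ) → Set) → Set
Semilinear d S = Σ ℕ λ q → Σ (Fin q → LinearSet d) λ Ls →
  ∀ v → S v ⇔ (Σ (Fin q) λ j → v ∈L Ls j)

data PTerm (k : ℕ) : Set where
  pvar   : Fin k → PTerm k
  pconst : ℕ → PTerm k
  _⊕_    : PTerm k → PTerm k → PTerm k

data QF (k : ℕ) : Set where
  _≐_  : PTerm k → PTerm k → QF k
  _≼_  : PTerm k → PTerm k → QF k
  qnot : QF k → QF k
  qand : QF k → QF k → QF k
  qor  : QF k → QF k → QF k

tsize : {k : ℕ} → PTerm k → ℕ
tsize (pvar i)   = 1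
tsize (pconst c) = bitlen c
tsize (s ⊕ t)    = suc (tsize s + tsize t)

qsize : {k : ℕ} → QF k → ℕ
qsize (s ≐ t)    = suc (tsize s + tsize t)
qsize (s ≼ t)    = suc (tsize s + tsize t)
qsize (qnot φ)   = suc (qsize φ)
qsize (qand φ ψ) = suc (qsize φ + qsize ψ)
qsize (qor φ ψ)  = suc (qsize φ + qsize ψ)

⟦_⟧ₜ : {k : ℕ} → PTerm k → (Fin k → ℕ) → ℕ
⟦ pvar i ⟧ₜ ρ   = ρ i
⟦ pconst c ⟧ₜ ρ = c
⟦ s ⊕ t ⟧ₜ ρ    = ⟦ s ⟧ₜ ρ + ⟦ t ⟧ₜ ρ

⟦_⟧q : {k : ℕ} → QF k → (Fin k → ℕ) → Bool
⟦ s ≐ t ⟧q ρ    = ⟦ s ⟧ₜ ρ ≡ᵇ ⟦ t ⟧ₜ ρ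
⟦ s ≼ t ⟧q ρ    = ⟦ s ⟧ₜ ρ ≤ᵇ ⟦ t ⟧ₜ ρ
⟦ qnot φ ⟧q ρ   = not (⟦ φ ⟧q ρ)
⟦ qand φ ψ ⟧q ρ = ⟦ φ ⟧q ρ ∧ ⟦ ψ ⟧q ρ
⟦ qor φ ψ ⟧q ρ  = ⟦ φ ⟧q ρ ∨ ⟦ ψ ⟧q ρ

-- existential Presburger formula ∃ z_1..z_nb. matrix(x_1..x_d, z_1..z_nb)
-- with d free variables
record EPA (d : ℕ) : Set where
  field
    nb     : ℕ
    matrix : QF (d + nb)
open EPA public

epaSize : {d : ℕ} → EPA d → ℕ
epaSize ψ = nb ψ + qsize (matrix ψ)

Defines : {d : ℕ} → EPA d → ((Fin d → ℕ) → Set) → Set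
Defines {d} ψ S = ∀ v → S v ⇔ (Σ (Fin (nb ψ) → ℕ) λ w → ⟦ matrix ψ ⟧q (v ++ w) ≡ true)

{-# OPTIONS --safe #-}
module Submission where

-- The truth values of the counting subformulas refine the 1-types.  Let every element rely on the
-- first k witnesses of each subformula ∃^{≥k}; if the subformula fails, these are all its witnesses.
-- So a pair of elements neither of which relies on the other may be recoloured by any colour that
-- creates no witness of a failing subformula.  Refine the types further so that every type has no
-- element, one element (a king) or many, and so that two elements that rely on each other, or that
-- both do so with a third one, have different types.  A model is then described by the number of
-- elements with each profile (type, colours towards kings and partners, colours of the other
-- elements relied upon), and the linear conditions on these numbers are also sufficient: mutual
-- links between two types are realised by any bijection, one-sided ones by sending them cyclically
-- between three parts of each large type, and the remaining pairs by a harmless colour.  There are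
-- doubly exponentially many profiles, which bounds the existential Presburger formula.
--
-- An existential Presburger formula defines a semilinear set because the solutions of one linear
-- equation do: the large ones contain a period that exchanges two variables.

open import Defs
open import Data.Bool using (Bool; true; false; _∧_; _∨_; not; if_then_else_)
import Data.Bool as B
import Data.Bool.Properties as BP
open import Data.Empty using (⊥; ⊥-elim)
open import Data.Fin using (Fin; zero; suc; toℕ; _↑ˡ_; _↑ʳ_; splitAt; finToFun; funToFin; remQuot; combine; fromℕ<)
import Data.Fin as F
import Data.Fin.Properties as FP
open import Data.List using (List; map; filter; concatMap; allFin; length; lookup) renaming (_++_ to _++ˡ_)
open import Data.List.Membership.Propositional using (find; lose)
open import Data.List.Membership.Propositional.Properties using (∈-map⁺; ∈-filter⁺; ∈-filter⁻; ∈-allFin; ∈-lookup)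
open import Data.List.Relation.Unary.Any using (Any; index)
import Data.List.Relation.Unary.Any as Any
import Data.List.Relation.Unary.Any.Properties as AnyP
open import Data.Nat
open import Data.Nat.Induction using (<-rec)
open import Data.Nat.Logarithm using (⌊log₂_⌋; ⌊log₂⌋-mono-≤; ⌊log₂[2^n]⌋≡n; ⌊log₂⌊n/2⌋⌋≡⌊log₂n⌋∸1)
open import Data.Nat.Properties
open import Data.Nat.Solver using (module +-*-Solver)
open import Data.Product using (Σ; _×_; _,_; proj₁; proj₂)
open import Data.Sum using (_⊎_; inj₁; inj₂; [_,_]′)
open import Data.Vec.Functional using (_++_)
open import Data.Vec.Functional.Properties using (lookup-++ˡ; lookup-++ʳ)
open import Function using (_∘_; id; case_of_; mk⇔; Equivalence; _⇔_)
open import Relation.Binary.Definitions using (tri<; tri≈; tri>)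
open import Relation.Binary.PropositionalEquality
open import Relation.Nullary using (¬_; Dec; yes; no; does)
open import Relation.Nullary.Decidable using (dec-true; dec-false; _×-dec_; ¬?)

-- Finite sums, counts and ranks

-- Tests say "at least `k θ`", so surplus witnesses hurt only where a test fails. Hence an element
-- needs to record at most `D` colours, the sum of the thresholds, although its degree is unbounded,
-- and a colour sent one-sidedly needs no entry at its receiver: it only has to be harmless there.
-- Two-sided colours must be matched exactly, and inside a single type such a matching could fail by
-- parity; this is why partners get different types, and why one link entry per type is enough.
-- Elements at distance at most two in the graph of mutual reliance number at most `D + D * D`,
-- whence the `X` colours of the refinement. A king is linked with everybody, so its tests exceed
-- what a profile can hold; they become linear inequalities between numbers of profiles. All other
-- elements are called common. `Z = 3 * suc D` leaves, in each of three parts of a large type, `D`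
-- receivers and a spare place for the partner; it also leaves between two large types a pair that
-- does not rely on each other, whose colour is the harmless one. Binary thresholds already make the
-- number of types exponential, and a profile is a table indexed by types: this is the second
-- exponential.

ι : Bool → ℕ
ι b = if b then 1 else 0

true≢false : ∀ {b} → b ≡ true → b ≡ false → ⊥
true≢false refl ()

¬true : ∀ {b} → ¬ (b ≡ true) → b ≡ false
¬true {true}  h = ⊥-elim (h refl)
¬true {false} h = refl

∧-trueˡ : ∀ {a b} → a ∧ b ≡ true → a ≡ true
∧-trueˡ {true} h = refl

∧-trueʳ : ∀ {a b} → a ∧ b ≡ true → b ≡ true
∧-trueʳ {true} h = h

∧-true : ∀ {a b} → a ≡ true → b ≡ true → a ∧ b ≡ true
∧-true refl refl = refl

not-true : ∀ {a} → not a ≡ true → a ≡ false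
not-true {false} h = refl

bool-ext : ∀ {a b} → (a ≡ true → b ≡ true) → (b ≡ true → a ≡ true) → a ≡ b
bool-ext {true}  {true}  f g = refl
bool-ext {false} {false} f g = refl
bool-ext {true}  {false} f g = sym (f refl)
bool-ext {false} {true}  f g = g refl

ι≤1 : ∀ b → ι b ≤ 1
ι≤1 true  = ≤-refl
ι≤1 false = z≤n

beq-true : ∀ {a b} → beq a b ≡ true → a ≡ b
beq-true {true}  {true}  h = refl
beq-true {false} {false} h = refl

beq-refl : ∀ {a b} → a ≡ b → beq a b ≡ true
beq-refl {true}  refl = refl
beq-refl {false} refl = refl

∧-identity : ∀ x → ι (x ∧ true) ≡ ι x
∧-identity true  = refl
∧-identity false = refl

≡-dec : (b : Bool) → (b ≡ true) ⊎ (b ≡ false)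
≡-dec true  = inj₁ refl
≡-dec false = inj₂ refl

abstract
  _==_ : ∀ {k} → Fin k → Fin k → Bool
  i == j = does (i F.≟ j)

  ==-refl : ∀ {k} (i : Fin k) → (i == i) ≡ true
  ==-refl i = dec-true (i F.≟ i) refl

  ==⇒≡ : ∀ {k} {i j : Fin k} → (i == j) ≡ true → i ≡ j
  ==⇒≡ {i = i} {j} h with i F.≟ j
  ... | yes p = p
  ... | no  _ = case h of λ ()

  ≢⇒== : ∀ {k} {i j : Fin k} → i ≢ j → (i == j) ≡ false
  ≢⇒== {i = i} {j} h = dec-false (i F.≟ j) h

≡⇒== : ∀ {k} {i j : Fin k} → i ≡ j → (i == j) ≡ true
≡⇒== {i = i} refl = ==-refl i

==⇒≢ : ∀ {k} {i j : Fin k} → (i == j) ≡ false → i ≢ j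
==⇒≢ h refl = true≢false (==-refl _) h

==-sym : ∀ {k} (i j : Fin k) → (i == j) ≡ (j == i)
==-sym i j = bool-ext (λ h → ≡⇒== (sym (==⇒≡ h))) (λ h → ≡⇒== (sym (==⇒≡ h)))

≤ᵇ-true : ∀ {a b} → a ≤ b → (a ≤ᵇ b) ≡ true
≤ᵇ-true {a} {b} h = dec-true (a ≤? b) h

≤ᵇ-true⁻¹ : ∀ {a b} → (a ≤ᵇ b) ≡ true → a ≤ b
≤ᵇ-true⁻¹ {a} {b} h with a ≤? b
... | yes p = p
... | no ¬p = ⊥-elim (true≢false h (dec-false (a ≤? b) ¬p))

≤ᵇ-false : ∀ {a b} → b < a → (a ≤ᵇ b) ≡ false
≤ᵇ-false {a} {b} h = dec-false (a ≤? b) (<⇒≱ h)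

≤ᵇ-false⁻¹ : ∀ {a b} → (a ≤ᵇ b) ≡ false → b < a
≤ᵇ-false⁻¹ h = ≰⇒> (λ q → true≢false (≤ᵇ-true q) h)

≡ᵇ-true : ∀ {a b : ℕ} → a ≡ b → (a ≡ᵇ b) ≡ true
≡ᵇ-true {a} {b} h = dec-true (a ≟ b) h

≡ᵇ-true⁻¹ : ∀ {a b : ℕ} → (a ≡ᵇ b) ≡ true → a ≡ b
≡ᵇ-true⁻¹ {a} {b} h with a ≟ b
... | yes p = p
... | no ¬p = ⊥-elim (true≢false h (dec-false (a ≟ b) ¬p))

sum-cong : ∀ {N} {f g : Fin N → ℕ} → (∀ i → f i ≡ g i) → sumᶠ f ≡ sumᶠ g
sum-cong {zero}  h = refl
sum-cong {suc N} h = cong₂ _+_ (h zero) (sum-cong (h ∘ suc))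

sum-mono : ∀ {N} {f g : Fin N → ℕ} → (∀ i → f i ≤ g i) → sumᶠ f ≤ sumᶠ g
sum-mono {zero}  h = z≤n
sum-mono {suc N} h = +-mono-≤ (h zero) (sum-mono (h ∘ suc))

+-interchange : ∀ a b c d → (a + b) + (c + d) ≡ (a + c) + (b + d)
+-interchange a b c d = begin
  (a + b) + (c + d) ≡⟨ +-assoc a b (c + d) ⟩
  a + (b + (c + d)) ≡⟨ cong (a +_) (sym (+-assoc b c d)) ⟩
  a + ((b + c) + d) ≡⟨ cong (λ z → a + (z + d)) (+-comm b c) ⟩
  a + ((c + b) + d) ≡⟨ cong (a +_) (+-assoc c b d) ⟩
  a + (c + (b + d)) ≡⟨ sym (+-assoc a c (b + d)) ⟩
  (a + c) + (b + d) ∎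
  where open ≡-Reasoning

+-swap : ∀ a b c → a + b + c ≡ a + c + b
+-swap a b c = trans (+-assoc a b c) (trans (cong (a +_) (+-comm b c)) (sym (+-assoc a c b)))

sum-+ : ∀ {N} (f g : Fin N → ℕ) → sumᶠ (λ i → f i + g i) ≡ sumᶠ f + sumᶠ g
sum-+ {zero}  f g = refl
sum-+ {suc N} f g = trans (cong (f zero + g zero +_) (sum-+ (f ∘ suc) (g ∘ suc)))
                          (+-interchange (f zero) (g zero) _ _)

sum-* : ∀ {N} c (f : Fin N → ℕ) → sumᶠ (λ i → c * f i) ≡ c * sumᶠ f
sum-* {zero}  c f = sym (*-zeroʳ c)
sum-* {suc N} c f = trans (cong (c * f zero +_) (sum-* c (f ∘ suc))) (sym (*-distribˡ-+ c _ _))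

sum-const : ∀ {N} c → sumᶠ {N} (λ _ → c) ≡ N * c
sum-const {zero}  c = refl
sum-const {suc N} c = cong (c +_) (sum-const {N} c)

sum-0 : ∀ {N} {f : Fin N → ℕ} → (∀ i → f i ≡ 0) → sumᶠ f ≡ 0
sum-0 {N} h = trans (sum-cong h) (trans (sum-const {N} 0) (*-zeroʳ N))

sum-swap : ∀ {N M} (f : Fin N → Fin M → ℕ) →
           sumᶠ (λ i → sumᶠ (f i)) ≡ sumᶠ (λ j → sumᶠ (λ i → f i j))
sum-swap {zero}  {M} f = sym (sum-0 {M} (λ _ → refl))
sum-swap {suc N} f = trans (cong (sumᶠ (f zero) +_) (sum-swap (f ∘ suc)))
                           (sym (sum-+ (f zero) (λ j → sumᶠ (λ i → f (suc i) j))))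

sum-++ : ∀ a {b} (f : Fin (a + b) → ℕ) → sumᶠ f ≡ sumᶠ (λ i → f (i ↑ˡ b)) + sumᶠ (λ j → f (a ↑ʳ j))
sum-++ zero    f = refl
sum-++ (suc a) f = trans (cong (f zero +_) (sum-++ a (f ∘ suc))) (sym (+-assoc (f zero) _ _))

sum-≥ : ∀ {N} (f : Fin N → ℕ) i → f i ≤ sumᶠ f
sum-≥ f zero    = m≤m+n _ _
sum-≥ f (suc i) = ≤-trans (sum-≥ (f ∘ suc) i) (m≤n+m _ (f zero))

sum-single : ∀ {N} (f : Fin N → ℕ) i → (∀ j → i ≢ j → f j ≡ 0) → sumᶠ f ≡ f i
sum-single {suc N} f zero h = trans (cong (f zero +_) (sum-0 {N} (λ j → h (suc j) (λ ())))) (+-identityʳ _)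
sum-single (f) (suc i) h = trans (cong₂ _+_ (h zero (λ ())) refl)
  (sum-single (f ∘ suc) i (λ j ne → h (suc j) (ne ∘ FP.suc-injective)))

sum-δ : ∀ {N} (i : Fin N) (f : Fin N → ℕ) → sumᶠ (λ j → if i == j then f j else 0) ≡ f i
sum-δ i f = trans (sum-single _ i (λ j ne → cong (λ b → if b then f j else 0) (≢⇒== ne)))
                  (cong (λ b → if b then f i else 0) (==-refl i))

count-sum : ∀ {N} (p : Fin N → Bool) → countᶠ p ≡ sumᶠ (λ i → ι (p i))
count-sum {zero}  p = refl
count-sum {suc N} p = cong (ι (p zero) +_) (count-sum (p ∘ suc))

count-cong : ∀ {N} {p q : Fin N → Bool} → (∀ i → p i ≡ q i) → countᶠ p ≡ countᶠ q
count-cong {zero}  h = refl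
count-cong {suc N} h = cong₂ _+_ (cong ι (h zero)) (count-cong (h ∘ suc))

ι-mono : ∀ {a b} → (a ≡ true → b ≡ true) → ι a ≤ ι b
ι-mono {true}  h rewrite h refl = ≤-refl
ι-mono {false} h = z≤n

count-mono : ∀ {N} {p q : Fin N → Bool} → (∀ i → p i ≡ true → q i ≡ true) → countᶠ p ≤ countᶠ q
count-mono {zero}  h = z≤n
count-mono {suc N} h = +-mono-≤ (ι-mono (h zero)) (count-mono (λ i → h (suc i)))

count-true : ∀ {N} → countᶠ {N} (λ _ → true) ≡ N
count-true {zero}  = refl
count-true {suc N} = cong suc (count-true {N})

count-0 : ∀ {N} {p : Fin N → Bool} → (∀ i → p i ≡ false) → countᶠ p ≡ 0
count-0 {zero}  h = refl
count-0 {suc N} h = cong₂ _+_ (cong ι (h zero)) (count-0 (h ∘ suc))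

count-≥1 : ∀ {N} {p : Fin N → Bool} i → p i ≡ true → 1 ≤ countᶠ p
count-≥1 {p = p} i h = subst (1 ≤_) (sym (count-sum p)) (≤-trans (≤-reflexive (cong ι (sym h))) (sum-≥ (ι ∘ p) i))

count≡0 : ∀ {N} {p : Fin N → Bool} → countᶠ p ≡ 0 → ∀ i → p i ≡ false
count≡0 {p = p} h i = ¬true (λ q → case subst (1 ≤_) h (count-≥1 {p = p} i q) of λ ())

count-witness : ∀ {N} {p : Fin N → Bool} → 1 ≤ countᶠ p → Σ (Fin N) λ i → p i ≡ true
count-witness {suc N} {p} h with p zero in eq
... | true  = zero , eq
... | false with count-witness {N} {p ∘ suc} h
... | i , q = suc i , q

count-fibres : ∀ {N K} (τ : Fin N → Fin K) (f : Fin N → ℕ) →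
               sumᶠ f ≡ sumᶠ (λ t → sumᶠ (λ u → if τ u == t then f u else 0))
count-fibres {N} {K} τ f = trans (sum-cong (λ u → sym (sum-δ (τ u) (λ _ → f u)))) (sum-swap {N} {K} _)

count-unique : ∀ {N} {p : Fin N → Bool} → countᶠ p ≤ 1 → ∀ {i j} → p i ≡ true → p j ≡ true → i ≡ j
count-unique {p = p} h {zero}  {zero}  a b = refl
count-unique {p = p} h {suc i} {suc j} a b =
  cong suc (count-unique {p = p ∘ suc} (≤-trans (m≤n+m _ (ι (p zero))) h) a b)
count-unique {p = p} h {zero} {suc j} a b rewrite a =
  ⊥-elim (<⇒≱ (count-≥1 {p = p ∘ suc} j b) (≤-pred h))
count-unique {p = p} h {suc i} {zero} a b rewrite b =
  ⊥-elim (<⇒≱ (count-≥1 {p = p ∘ suc} i a) (≤-pred h))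

count-≤1 : ∀ {N} {p : Fin N → Bool} → (∀ {i j} → p i ≡ true → p j ≡ true → i ≡ j) → countᶠ p ≤ 1
count-≤1 {zero}  u = z≤n
count-≤1 {suc N} {p} u with p zero in eq
... | false = count-≤1 {p = p ∘ suc} (λ a b → FP.suc-injective (u a b))
... | true  = s≤s (≤-reflexive (count-0 {p = p ∘ suc} (λ i → ¬true (λ q → case u eq q of λ ()))))

ι-∧ : ∀ a b → ι (a ∧ b) ≡ (if a then ι b else 0)
ι-∧ true  b = refl
ι-∧ false b = refl

ι-split : ∀ a b → ι a ≡ ι (a ∧ b) + ι (a ∧ not b)
ι-split false b = refl
ι-split true false = refl
ι-split true true = refl

count-split : ∀ {N} (p q : Fin N → Bool) → countᶠ p ≡ countᶠ (λ i → p i ∧ q i) + countᶠ (λ i → p i ∧ not (q i))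
count-split {zero}  p q = refl
count-split {suc N} p q = trans (cong₂ _+_ (ι-split (p zero) (q zero)) (count-split (p ∘ suc) (q ∘ suc)))
  (+-interchange (ι (p zero ∧ q zero)) _ _ _)

rank : ∀ {N} → (Fin N → Bool) → Fin N → ℕ
rank p zero    = 0
rank p (suc v) = ι (p zero) + rank (p ∘ suc) v

-- Every value below the count is the rank of exactly one element of p.
sum-rank : ∀ {N} (p : Fin N → Bool) (g : ℕ → ℕ) →
           sumᶠ (λ v → if p v then g (rank p v) else 0) ≡ sumᶠ {countᶠ p} (λ j → g (toℕ j))
sum-rank {zero}  p g = refl
sum-rank {suc N} p g with p zero
... | true  = cong (g 0 +_) (sum-rank (p ∘ suc) (g ∘ suc))
... | false = sum-rank (p ∘ suc) g

rank-< : ∀ {N} (p : Fin N → Bool) {v} → p v ≡ true → rank p v < countᶠ p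
rank-< {suc N} p {zero}  h rewrite h = s≤s z≤n
rank-< {suc N} p {suc v} h = +-monoʳ-< (ι (p zero)) (rank-< (p ∘ suc) h)

rank-injective : ∀ {N} (p : Fin N → Bool) {u v} → p u ≡ true → p v ≡ true → rank p u ≡ rank p v → u ≡ v
rank-injective {suc N} p {zero} {zero} a b e = refl
rank-injective {suc N} p {suc u} {suc v} a b e =
  cong suc (rank-injective (p ∘ suc) a b (+-cancelˡ-≡ (ι (p zero)) _ _ e))
rank-injective {suc N} p {zero} {suc v} a b e rewrite a = case e of λ ()
rank-injective {suc N} p {suc u} {zero} a b e rewrite b = case e of λ ()

countBelow : ∀ n j → sumᶠ {n} (λ i → ι (toℕ i ≡ᵇ j)) ≡ ι (j <ᵇ n)
countBelow zero    j       = refl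
countBelow (suc n) zero    = cong suc (sum-0 {n} (λ _ → refl))
countBelow (suc n) (suc j) = countBelow n j

-- By `sum-rank` the count becomes one of the numbers below both `countᶠ p` and `k`. The lower bound
-- keeps satisfied tests satisfied when only the first witnesses are retained; the upper bound
-- limits how many are retained.
count-first : ∀ {N} (p : Fin N → Bool) k →
  (k ≤ countᶠ p → k ≤ countᶠ (λ v → p v ∧ (rank p v <ᵇ k))) × (countᶠ (λ v → p v ∧ (rank p v <ᵇ k)) ≤ k)
count-first p k = lower , upper
  where
  below : ∀ n k → sumᶠ {n} (λ i → ι (toℕ i <ᵇ k)) ≤ k
  below zero    k       = z≤n
  below (suc n) zero    = ≤-reflexive (sum-0 {n} (λ _ → refl))
  below (suc n) (suc k) = s≤s (below n k)
  below≥ : ∀ n k → k ≤ n → k ≤ sumᶠ {n} (λ i → ι (toℕ i <ᵇ k))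
  below≥ n       zero    h = z≤n
  below≥ (suc n) (suc k) (s≤s h) = s≤s (below≥ n k h)
  eq : countᶠ (λ v → p v ∧ (rank p v <ᵇ k)) ≡ sumᶠ {countᶠ p} (λ j → ι (toℕ j <ᵇ k))
  eq = trans (count-sum (λ v → p v ∧ (rank p v <ᵇ k))) (trans (sum-cong (λ v → ι-∧ (p v) _)) (sum-rank p (λ r → ι (r <ᵇ k))))
  lower : k ≤ countᶠ p → k ≤ countᶠ (λ v → p v ∧ (rank p v <ᵇ k))
  lower h = subst (k ≤_) (sym eq) (below≥ (countᶠ p) k h)
  upper : countᶠ (λ v → p v ∧ (rank p v <ᵇ k)) ≤ k
  upper = subst (_≤ k) (sym eq) (below (countᶠ p) k)

-- Optional values are encoded in Fin (suc C), with zero for none.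
opt : ∀ {C} → (Fin C → ℕ) → Fin (suc C) → ℕ
opt g zero    = 0
opt g (suc c) = g c

pick : ∀ {N C} → (Fin N → Bool) → (Fin N → Fin C) → Fin (suc C)
pick {zero}  q f = zero
pick {suc N} q f = if q zero then suc (f zero) else pick (q ∘ suc) (f ∘ suc)

sum-pick : ∀ {N C} (q : Fin N → Bool) (f : Fin N → Fin C) (g : Fin C → ℕ) → countᶠ q ≤ 1 →
           opt g (pick q f) ≡ sumᶠ (λ v → if q v then g (f v) else 0)
sum-pick {zero}  q f g h = refl
sum-pick {suc N} q f g h with q zero
... | true  = sym (trans (cong (g (f zero) +_)
                (sum-0 (λ v → cong (λ b → if b then g (f (suc v)) else 0)
                  (count≡0 {p = q ∘ suc} (n≤0⇒n≡0 (≤-pred h)) v)))) (+-identityʳ _))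
... | false = sum-pick (q ∘ suc) (f ∘ suc) g h

pick-suc : ∀ {N C} (q : Fin N → Bool) (f : Fin N → Fin C) {c} → pick q f ≡ suc c →
           Σ (Fin N) λ v → (q v ≡ true) × (f v ≡ c)
pick-suc {suc N} q f h with q zero in eq
... | true  = zero , eq , FP.suc-injective h
... | false with pick-suc (q ∘ suc) (f ∘ suc) h
... | v , a , b = suc v , a , b

pick-hit : ∀ {N C} (q : Fin N → Bool) (f : Fin N → Fin C) → countᶠ q ≤ 1 → ∀ {v} → q v ≡ true → pick q f ≡ suc (f v)
pick-hit {suc N} q f h {zero} e rewrite e = refl
pick-hit {suc N} q f h {suc v} e with q zero in eq
... | true  = ⊥-elim (<⇒≱ (count-≥1 {p = q ∘ suc} v e) (≤-pred h))
... | false = pick-hit (q ∘ suc) (f ∘ suc) h e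

-- Presburger-definable sets are semilinear

dot : ∀ {k} → (Fin k → ℕ) → (Fin k → ℕ) → ℕ
dot a x = sumᶠ (λ j → a j * x j)

dot-cong : ∀ {k} (a : Fin k → ℕ) {x y : Fin k → ℕ} → (∀ j → x j ≡ y j) → dot a x ≡ dot a y
dot-cong a h = sum-cong (λ j → cong (a j *_) (h j))

dot-+ : ∀ {k} (a x y : Fin k → ℕ) → dot a (λ j → x j + y j) ≡ dot a x + dot a y
dot-+ a x y = trans (sum-cong (λ j → *-distribˡ-+ (a j) (x j) (y j))) (sum-+ (λ j → a j * x j) (λ j → a j * y j))

dot-comb : ∀ {k r} (a : Fin k → ℕ) (μ : Fin r → ℕ) (Q : Fin r → Fin k → ℕ) →
           dot a (λ j → sumᶠ (λ q → μ q * Q q j)) ≡ dot μ (λ q → dot a (Q q))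
dot-comb {k} {r} a μ Q = begin
  dot a (λ j → sumᶠ (λ q → μ q * Q q j)) ≡⟨ sum-cong (λ j → sym (sum-* (a j) (λ q → μ q * Q q j))) ⟩
  sumᶠ (λ j → sumᶠ (λ q → a j * (μ q * Q q j))) ≡⟨ sum-swap {k} {r} _ ⟩
  sumᶠ (λ q → sumᶠ (λ j → a j * (μ q * Q q j))) ≡⟨ sum-cong (λ q → sum-cong (λ j → comm (a j) (μ q) (Q q j))) ⟩
  sumᶠ (λ q → sumᶠ (λ j → μ q * (a j * Q q j))) ≡⟨ sum-cong (λ q → sum-* (μ q) (λ j → a j * Q q j)) ⟩
  dot μ (λ q → dot a (Q q)) ∎
  where
  open ≡-Reasoning
  comm : ∀ x y z → x * (y * z) ≡ y * (x * z)
  comm x y z = trans (sym (*-assoc x y z)) (trans (cong (_* z) (*-comm x y)) (*-assoc y x z))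

δ : ∀ {k} → Fin k → Fin k → ℕ
δ i j = ι (i == j)

dot-δ : ∀ {k} (a : Fin k → ℕ) i → dot a (δ i) ≡ a i
dot-δ a i = trans (sum-cong (λ j → eq (i == j) (a j))) (sum-δ i a)
  where
  eq : ∀ b x → x * ι b ≡ (if b then x else 0)
  eq true  x = *-identityʳ x
  eq false x = *-zeroʳ x

dot-* : ∀ {k} (a : Fin k → ℕ) c x → dot a (λ j → c * x j) ≡ c * dot a x
dot-* a c x = trans (sum-cong (λ j → trans (sym (*-assoc (a j) c (x j)))
  (trans (cong (_* x j) (*-comm (a j) c)) (*-assoc c (a j) (x j))))) (sum-* c (λ j → a j * x j))

-- Coefficient vectors with disjoint supports.  The periods exchange one variable of the
-- left-hand side against one of the right-hand side (or are unit vectors of variables that do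
-- not occur); a solution with a large entry always contains such a period.
module Equation {k : ℕ} (a b : Fin k → ℕ) (γ γ' : ℕ) (disj : ∀ i → (a i ≡ 0) ⊎ (b i ≡ 0)) where

  Solves : (Fin k → ℕ) → Set
  Solves x = dot a x + γ ≡ dot b x + γ'

  unit : ℕ → ℕ → ℕ
  unit zero    y = 1
  unit (suc _) y = y

  -- For positive `a i` the period consists of `b j` units of variable `i` and `a i` units of
  -- variable `j`, and adds `a i * b j` to both sides. Pairs that fail the guard give the zero
  -- vector, so all `k * k` indices may be kept.
  cu cv : Fin k → Fin k → ℕ
  cu i j = if (b i ≡ᵇ 0) ∧ (a j ≡ᵇ 0) then unit (a i) (b j) else 0
  cv i j = if (b i ≡ᵇ 0) ∧ (a j ≡ᵇ 0) then a i else 0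

  pair : Fin k → Fin k → Fin k → ℕ
  pair i j l = cu i j * δ i l + cv i j * δ j l

  Q : Fin (k * k) → Fin k → ℕ
  Q q = pair (proj₁ (remQuot {k} k q)) (proj₂ (remQuot {k} k q))

  dot-pair : ∀ c i j → dot c (pair i j) ≡ cu i j * c i + cv i j * c j
  dot-pair c i j = trans (dot-+ c (λ l → cu i j * δ i l) (λ l → cv i j * δ j l))
    (cong₂ _+_ (trans (dot-* c (cu i j) (δ i)) (cong (cu i j *_) (dot-δ c i)))
               (trans (dot-* c (cv i j) (δ j)) (cong (cv i j *_) (dot-δ c j))))

  balance : ∀ i j → cu i j * a i + cv i j * a j ≡ cu i j * b i + cv i j * b j
  balance i j with b i in bi | a j in aj | a i in ai
  ... | suc _ | _     | _     = refl
  ... | zero  | suc _ | _     = refl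
  ... | zero  | zero  | zero  = refl
  ... | zero  | zero  | suc x = begin
    b j * suc x + suc x * 0 ≡⟨ cong (b j * suc x +_) (*-zeroʳ (suc x)) ⟩
    b j * suc x + 0 ≡⟨ +-identityʳ _ ⟩
    b j * suc x ≡⟨ *-comm (b j) (suc x) ⟩
    suc x * b j ≡⟨ cong (_+ suc x * b j) (sym (*-zeroʳ (b j))) ⟩
    b j * 0 + suc x * b j ∎
    where open ≡-Reasoning

  homogeneous : ∀ i j → dot a (pair i j) ≡ dot b (pair i j)
  homogeneous i j = trans (dot-pair a i j) (trans (balance i j) (sym (dot-pair b i j)))

  -- The product and the constants make an entry beyond it force a large entry on the other side;
  -- the sum in the middle lets the entry itself pay its share of the period.
  bound : ℕ
  bound = sumᶠ a * sumᶠ b + (sumᶠ a + sumᶠ b) + (γ + γ')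

  solves? : ∀ x → Dec (Solves x)
  solves? x = dot a x + γ ≟ dot b x + γ'

  box : Fin (suc bound ^ k) → Fin k → ℕ
  box c i = toℕ (finToFun c i)

  bases : List (Fin k → ℕ)
  bases = filter solves? (map box (allFin _))

  Span : (Fin k → ℕ) → (Fin k → ℕ) → Set
  Span x b₀ = Σ (Fin (k * k) → ℕ) λ μ → ∀ i → x i ≡ b₀ i + sumᶠ (λ q → μ q * Q q i)

  solves-cong : ∀ {x y} → (∀ i → x i ≡ y i) → Solves x → Solves y
  solves-cong h e = trans (cong (_+ γ) (dot-cong a (sym ∘ h))) (trans e (cong (_+ γ') (dot-cong b h)))

  span-solves : ∀ {x} → Any (Span x) bases → Solves x
  span-solves {x} p with find p
  ... | b₀ , m , μ , h = solves-cong (sym ∘ h) (begin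
      dot a (λ i → b₀ i + comb i) + γ ≡⟨ cong (_+ γ) (dot-+ a b₀ comb) ⟩
      dot a b₀ + dot a comb + γ ≡⟨ +-swap (dot a b₀) (dot a comb) γ ⟩
      dot a b₀ + γ + dot a comb ≡⟨ cong₂ _+_ (proj₂ (∈-filter⁻ solves? {xs = map box (allFin _)} m)) hom ⟩
      dot b b₀ + γ' + dot b comb ≡⟨ sym (+-swap (dot b b₀) (dot b comb) γ') ⟩
      dot b b₀ + dot b comb + γ' ≡⟨ cong (_+ γ') (sym (dot-+ b b₀ comb)) ⟩
      dot b (λ i → b₀ i + comb i) + γ' ∎)
    where
    open ≡-Reasoning
    comb : Fin k → ℕ
    comb i = sumᶠ (λ q → μ q * Q q i)
    hom : dot a comb ≡ dot b comb
    hom = trans (dot-comb a μ Q) (trans (dot-cong μ (λ q → homogeneous _ _)) (sym (dot-comb b μ Q)))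

  pair-at : ∀ i j l {s t} → δ i l ≡ s → δ j l ≡ t → pair i j l ≡ cu i j * s + cv i j * t
  pair-at i j l p q = cong₂ (λ s t → cu i j * s + cv i j * t) p q

  -- For `i = j` both summands would fall on the same entry; the premise admits this only if the
  -- second one vanishes.
  contained : ∀ (x : Fin k → ℕ) (i j : Fin k) → i ≢ j ⊎ cv i j ≡ 0 → cu i j ≤ x i → cv i j ≤ x j → ∀ l → pair i j l ≤ x l
  contained x i j ne u v l with i F.≟ l | j F.≟ l
  contained x i j (inj₁ ne) u v l | yes p | yes q = ⊥-elim (ne (trans p (sym q)))
  contained x i .i (inj₂ z) u v i | yes refl | yes refl = ≤-trans (≤-reflexive eq) u
    where
    eq : pair i i i ≡ cu i i
    eq = trans (pair-at i i i (cong ι (==-refl i)) (cong ι (==-refl i)))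
           (trans (cong₂ _+_ (*-identityʳ (cu i i)) (cong (_* 1) z)) (+-identityʳ (cu i i)))
  contained x i j _ u v i | yes refl | no q = ≤-trans (≤-reflexive eq) u
    where
    eq : pair i j i ≡ cu i j
    eq = trans (pair-at i j i (cong ι (==-refl i)) (cong ι (≢⇒== q)))
           (trans (cong₂ _+_ (*-identityʳ (cu i j)) (*-zeroʳ (cv i j))) (+-identityʳ (cu i j)))
  contained x i j _ u v j | no p | yes refl = ≤-trans (≤-reflexive eq) v
    where
    eq : pair i j j ≡ cv i j
    eq = trans (pair-at i j j (cong ι (≢⇒== p)) (cong ι (==-refl j)))
           (cong₂ _+_ (*-zeroʳ (cu i j)) (*-identityʳ (cv i j)))
  contained x i j _ u v l | no p | no q = ≤-trans (≤-reflexive eq) z≤n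
    where
    eq : pair i j l ≡ 0
    eq = trans (pair-at i j l (cong ι (≢⇒== p)) (cong ι (≢⇒== q)))
           (cong₂ _+_ (*-zeroʳ (cu i j)) (*-zeroʳ (cv i j)))

  Reducible : (Fin k → ℕ) → Set
  Reducible x = Σ (Fin k) λ i → Σ (Fin k) λ j → (∀ l → pair i j l ≤ x l) × (1 ≤ cu i j)

  -- Pigeonhole: if all variables with positive coefficient stayed below `w`, the product would be
  -- at most `sumᶠ d * w`.
  find-large : ∀ (c d : Fin k → ℕ) x w → sumᶠ d * w < dot d x →
               Σ (Fin k) λ j → (1 ≤ d j) × (w ≤ x j)
  find-large c d x w h with FP.any? (λ j → (1 ≤? d j) ×-dec (w ≤? x j))
  ... | yes p = p
  ... | no np = ⊥-elim (<⇒≱ h (subst (dot d x ≤_) (trans (sum-cong (λ j → *-comm (d j) w))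
                  (trans (sum-* w d) (*-comm w (sumᶠ d)))) (sum-mono small)))
    where
    small : ∀ j → d j * x j ≤ d j * w
    small j with d j in dj
    ... | zero  = z≤n
    ... | suc y = *-monoʳ-≤ (suc y) (<⇒≤ (≰⇒> (λ q → np (j , subst (1 ≤_) (sym dj) (s≤s z≤n) , q))))

  -- If `a i` is positive, `a i * x i` alone exceeds `sumᶠ b * a i + γ'`, so some `x j` on the other
  -- side is at least `a i`. If `b i` is positive the roles are exchanged, and a variable that
  -- occurs nowhere can simply lose one unit.
  reduce : ∀ x → Solves x → ∀ i → bound < x i → Reducible x
  reduce x e i large with a i in ai | b i in bi
  ... | suc y | suc z = ⊥-elim ([ (λ p → case trans (sym ai) p of λ ()) , (λ p → case trans (sym bi) p of λ ()) ]′ (disj i))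
  ... | zero | zero = i , i , contained x i i (inj₂ cv0) (≤-trans (≤-reflexive cu1) (≤-trans (s≤s z≤n) large)) (≤-trans (≤-reflexive cv0) z≤n)
                        , ≤-reflexive (sym cu1)
    where
    cu1 : cu i i ≡ 1
    cu1 rewrite bi | ai = refl
    cv0 : cv i i ≡ 0
    cv0 rewrite bi | ai = refl
  ... | suc y | zero with find-large a b x (a i) bigdot
    where
    bigdot : sumᶠ b * a i < dot b x
    bigdot = +-cancelʳ-< γ' (sumᶠ b * a i) (dot b x) (begin-strict
      sumᶠ b * a i + γ' ≤⟨ +-mono-≤ (*-monoʳ-≤ (sumᶠ b) (sum-≥ a i)) ≤-refl ⟩
      sumᶠ b * sumᶠ a + γ' ≡⟨ cong (_+ γ') (*-comm (sumᶠ b) (sumᶠ a)) ⟩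
      sumᶠ a * sumᶠ b + γ' ≤⟨ +-mono-≤ (m≤m+n (sumᶠ a * sumᶠ b) (sumᶠ a + sumᶠ b)) (m≤n+m γ' γ) ⟩
      bound <⟨ large ⟩
      x i ≤⟨ m≤m+n (x i) (y * x i) ⟩
      suc y * x i ≡⟨ cong (_* x i) (sym ai) ⟩
      a i * x i ≤⟨ sum-≥ (λ j → a j * x j) i ⟩
      dot a x ≤⟨ m≤m+n _ γ ⟩
      dot a x + γ ≡⟨ e ⟩
      dot b x + γ' ∎)
      where open ≤-Reasoning
  ... | j , bj , xj = i , j , contained x i j (inj₁ i≢j) (≤-trans (≤-reflexive cu≡) bj≤) (≤-trans (≤-reflexive cv≡) xj) , ≤-trans bj (≤-reflexive (sym cu≡))
    where
    aj : a j ≡ 0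
    aj = [ id , (λ q → case subst (1 ≤_) q bj of λ ()) ]′ (disj j)
    i≢j : i ≢ j
    i≢j refl = case subst (1 ≤_) bi bj of λ ()
    cu≡ : cu i j ≡ b j
    cu≡ rewrite bi | aj | ai = refl
    cv≡ : cv i j ≡ a i
    cv≡ rewrite bi | aj = refl
    bj≤ : b j ≤ x i
    bj≤ = ≤-trans (sum-≥ b j) (≤-trans (≤-trans (m≤n+m (sumᶠ b) (sumᶠ a)) (≤-trans (m≤n+m _ (sumᶠ a * sumᶠ b)) (m≤m+n _ (γ + γ')))) (<⇒≤ large))
  reduce x e i large | zero | suc y with find-large b a x (b i) bigdot
    where
    bigdot : sumᶠ a * b i < dot a x
    bigdot = +-cancelʳ-< γ (sumᶠ a * b i) (dot a x) (begin-strict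
      sumᶠ a * b i + γ ≤⟨ +-mono-≤ (*-monoʳ-≤ (sumᶠ a) (sum-≥ b i)) ≤-refl ⟩
      sumᶠ a * sumᶠ b + γ ≤⟨ +-mono-≤ (m≤m+n (sumᶠ a * sumᶠ b) (sumᶠ a + sumᶠ b)) (m≤m+n γ γ') ⟩
      bound <⟨ large ⟩
      x i ≤⟨ m≤m+n (x i) (y * x i) ⟩
      suc y * x i ≡⟨ cong (_* x i) (sym bi) ⟩
      b i * x i ≤⟨ sum-≥ (λ j → b j * x j) i ⟩
      dot b x ≤⟨ m≤m+n _ γ' ⟩
      dot b x + γ' ≡⟨ sym e ⟩
      dot a x + γ ∎)
      where open ≤-Reasoning
  ... | j , aj , xj = j , i , contained x j i (inj₁ j≢i) (≤-trans (≤-reflexive cu≡) xj) (≤-trans (≤-reflexive cv≡) aj≤)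
                    , ≤-trans (≤-trans (s≤s z≤n) (≤-reflexive (sym bi))) (≤-reflexive (sym cu≡))
    where
    bj : b j ≡ 0
    bj = [ (λ q → case subst (1 ≤_) q aj of λ ()) , id ]′ (disj j)
    j≢i : j ≢ i
    j≢i refl = case subst (1 ≤_) ai aj of λ ()
    unit-suc : ∀ {x y} → 1 ≤ x → unit x y ≡ y
    unit-suc (s≤s _) = refl
    cu≡ : cu j i ≡ b i
    cu≡ rewrite bj | ai = unit-suc aj
    cv≡ : cv j i ≡ a j
    cv≡ rewrite bj | ai = refl
    aj≤ : a j ≤ x i
    aj≤ = ≤-trans (sum-≥ a j) (≤-trans (≤-trans (m≤m+n (sumᶠ a) (sumᶠ b)) (≤-trans (m≤n+m _ (sumᶠ a * sumᶠ b)) (m≤m+n _ (γ + γ')))) (<⇒≤ large))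

  -- Strong induction on the sum of the entries: a positive `cu` makes the solution left after
  -- subtracting a period strictly smaller, and solutions without a large entry are bases.
  solves-span : ∀ n x → sumᶠ x ≡ n → Solves x → Any (Span x) bases
  solves-span = <-rec _ step
    where
    step : ∀ n → (∀ {m} → m < n → ∀ x → sumᶠ x ≡ m → Solves x → Any (Span x) bases) →
           ∀ x → sumᶠ x ≡ n → Solves x → Any (Span x) bases
    step n rec x sx e with FP.any? (λ i → bound <? x i)
    ... | no none = lose (∈-filter⁺ solves? (∈-map⁺ box (∈-allFin (funToFin f))) (solves-cong x≡ e))
                      ((λ _ → 0) , λ i → trans (x≡ i) (sym (trans (cong (box (funToFin f) i +_) (sum-0 {k * k} (λ _ → refl))) (+-identityʳ _))))
      where
      f : Fin k → Fin (suc bound)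
      f i = fromℕ< (s≤s (≮⇒≥ (λ h → none (i , h))))
      x≡ : ∀ i → x i ≡ box (funToFin f) i
      x≡ i = sym (trans (cong toℕ (FP.finToFun-funToFin f i)) (FP.toℕ-fromℕ< _))
    ... | yes (i , large) with reduce x e i large
    ... | u , v , below , pos = Any.map extend (rec smaller y refl ySolves)
      where
      y : Fin k → ℕ
      y l = x l ∸ pair u v l
      x≡ : ∀ l → y l + pair u v l ≡ x l
      x≡ l = m∸n+n≡m (below l)
      sx≡ : sumᶠ y + sumᶠ (pair u v) ≡ n
      sx≡ = trans (sym (sum-+ y (pair u v))) (trans (sum-cong x≡) sx)
      pairpos : 1 ≤ sumᶠ (pair u v)
      pairpos = ≤-trans (≤-trans pos (≤-trans (≤-reflexive (sym (trans (cong (cu u v *_) (cong ι (==-refl u))) (*-identityʳ _))))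
                  (m≤m+n _ _))) (sum-≥ (pair u v) u)
      smaller : sumᶠ y < n
      smaller = subst (sumᶠ y <_) sx≡ (subst (_≤ sumᶠ y + sumᶠ (pair u v)) (+-comm (sumᶠ y) 1) (+-monoʳ-≤ (sumᶠ y) pairpos))
      ySolves : Solves y
      ySolves = +-cancelʳ-≡ (dot a (pair u v)) _ _ (begin
        dot a y + γ + dot a (pair u v) ≡⟨ +-swap (dot a y) γ _ ⟩
        dot a y + dot a (pair u v) + γ ≡⟨ cong (_+ γ) (trans (sym (dot-+ a y (pair u v))) (dot-cong a x≡)) ⟩
        dot a x + γ ≡⟨ e ⟩
        dot b x + γ' ≡⟨ cong (_+ γ') (trans (dot-cong b (sym ∘ x≡)) (dot-+ b y (pair u v))) ⟩
        dot b y + dot b (pair u v) + γ' ≡⟨ +-swap (dot b y) _ γ' ⟩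
        dot b y + γ' + dot b (pair u v) ≡⟨ cong (dot b y + γ' +_) (sym (homogeneous u v)) ⟩
        dot b y + γ' + dot a (pair u v) ∎)
        where open ≡-Reasoning
      extend : ∀ {b₀} → Span y b₀ → Span x b₀
      extend {b₀} (μ , h) = (λ q → μ q + δ w q) , λ l → begin
          x l ≡⟨ sym (x≡ l) ⟩
          y l + pair u v l ≡⟨ cong₂ _+_ (h l) (sym (last l)) ⟩
          b₀ l + sumᶠ (λ q → μ q * Q q l) + sumᶠ (λ q → δ w q * Q q l) ≡⟨ +-assoc (b₀ l) _ _ ⟩
          b₀ l + (sumᶠ (λ q → μ q * Q q l) + sumᶠ (λ q → δ w q * Q q l))
            ≡⟨ cong (b₀ l +_) (trans (sym (sum-+ (λ q → μ q * Q q l) (λ q → δ w q * Q q l))) (sum-cong (λ q → sym (*-distribʳ-+ (Q q l) (μ q) (δ w q))))) ⟩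
          b₀ l + sumᶠ (λ q → (μ q + δ w q) * Q q l) ∎
        where
        open ≡-Reasoning
        w : Fin (k * k)
        w = combine u v
        last : ∀ l → sumᶠ (λ q → δ w q * Q q l) ≡ pair u v l
        last l = trans (sum-cong (λ q → *-comm (δ w q) (Q q l))) (trans (dot-δ (λ q → Q q l) w)
          (cong (λ z → pair (proj₁ z) (proj₂ z) l) (FP.remQuot-combine {k} {k} u v)))

abstract
  -- Cancelling the common part `α i ⊓ β i` of the coefficients from both sides leaves disjoint
  -- supports.
  solve-equation : ∀ {k} (α β : Fin k → ℕ) (γ γ' : ℕ) →
    Σ (List (Fin k → ℕ)) λ bases → Σ ℕ λ r → Σ (Fin r → Fin k → ℕ) λ Q → ∀ x →
      (dot α x + γ ≡ dot β x + γ') ⇔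
      Any (λ b₀ → Σ (Fin r → ℕ) λ μ → ∀ i → x i ≡ b₀ i + sumᶠ (λ q → μ q * Q q i)) bases
  solve-equation {k} α β γ γ' = E.bases , k * k , E.Q , λ x →
      mk⇔ (λ e → E.solves-span _ x refl (down x e)) (λ p → up x (E.span-solves p))
    where
    disj : ∀ i → (α i ∸ β i ≡ 0) ⊎ (β i ∸ α i ≡ 0)
    disj i with ≤-total (α i) (β i)
    ... | inj₁ h = inj₁ (m≤n⇒m∸n≡0 h)
    ... | inj₂ h = inj₂ (m≤n⇒m∸n≡0 h)
    module E = Equation (λ i → α i ∸ β i) (λ i → β i ∸ α i) γ γ' disj
    c : Fin k → ℕ
    c i = α i ⊓ β i
    part : ∀ m n → m ∸ n + m ⊓ n ≡ m
    part m n = trans (+-comm (m ∸ n) (m ⊓ n)) (trans (cong (_+ (m ∸ n)) (⊓-comm m n)) (m⊓n+n∸m≡n n m))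
    split : ∀ (f g : Fin k → ℕ) x ξ → dot f x + ξ ≡ dot (λ i → f i ∸ g i) x + ξ + dot (λ i → f i ⊓ g i) x
    split f g x ξ = trans (cong (_+ ξ) (trans
        (sum-cong (λ i → trans (cong (_* x i) (sym (part (f i) (g i)))) (*-distribʳ-+ (x i) (f i ∸ g i) (f i ⊓ g i))))
        (sum-+ (λ i → (f i ∸ g i) * x i) (λ i → (f i ⊓ g i) * x i))))
      (+-swap (dot (λ i → f i ∸ g i) x) (dot (λ i → f i ⊓ g i) x) ξ)
    splitβ : ∀ x → dot β x + γ' ≡ dot (λ i → β i ∸ α i) x + γ' + dot c x
    splitβ x = trans (split β α x γ') (cong (dot (λ i → β i ∸ α i) x + γ' +_) (sum-cong (λ i → cong (_* x i) (⊓-comm (β i) (α i)))))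
    down : ∀ x → dot α x + γ ≡ dot β x + γ' → E.Solves x
    down x e = +-cancelʳ-≡ (dot c x) _ _ (trans (sym (split α β x γ)) (trans e (splitβ x)))
    up : ∀ x → E.Solves x → dot α x + γ ≡ dot β x + γ'
    up x e = trans (split α β x γ) (trans (cong (_+ dot c x) e) (sym (splitβ x)))

abstract
  -- The equation constrains the multiplicities of the periods of `L`. Substituting its solutions
  -- into the parametrisation of `L` is linear: bases of solutions shift the base, and periods of
  -- solutions become periods.
  refine : ∀ {d} (L : LinearSet d) (α β : Fin (nper L) → ℕ) (γ γ' : ℕ) →
    Σ (List (LinearSet d)) λ Ls → ∀ v →
      (Σ (Fin (nper L) → ℕ) λ x → (∀ i → v i ≡ base L i + sumᶠ (λ j → x j * periods L j i)) × (dot α x + γ ≡ dot β x + γ'))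
      ⇔ Any (v ∈L_) Ls
  refine {d} L α β γ γ' with solve-equation α β γ γ'
  ... | bases , r , Q , eqv = map shifted bases , λ v → mk⇔ (to v) (from v)
    where
    p : Fin (nper L) → Fin d → ℕ
    p = periods L
    shifted : (Fin (nper L) → ℕ) → LinearSet d
    shifted b₀ = record { base = λ i → base L i + sumᶠ (λ j → b₀ j * p j i) ; nper = r
                        ; periods = λ q i → sumᶠ (λ j → Q q j * p j i) }
    span : (Fin r → ℕ) → Fin (nper L) → ℕ
    span μ j = sumᶠ (λ q → μ q * Q q j)
    expand : ∀ (b₀ : Fin (nper L) → ℕ) (μ : Fin r → ℕ) (i : Fin d) → sumᶠ (λ j → (b₀ j + span μ j) * p j i) ≡
             sumᶠ (λ j → b₀ j * p j i) + sumᶠ (λ q → μ q * sumᶠ (λ j → Q q j * p j i))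
    expand b₀ μ i = begin
      sumᶠ (λ j → (b₀ j + span μ j) * p j i)
        ≡⟨ sum-cong (λ j → *-distribʳ-+ (p j i) (b₀ j) (span μ j)) ⟩
      sumᶠ (λ j → b₀ j * p j i + span μ j * p j i)
        ≡⟨ sum-+ (λ j → b₀ j * p j i) (λ j → span μ j * p j i) ⟩
      sumᶠ (λ j → b₀ j * p j i) + sumᶠ (λ j → span μ j * p j i)
        ≡⟨ cong (sumᶠ (λ j → b₀ j * p j i) +_) (sum-cong (λ j → *-comm (span μ j) (p j i))) ⟩
      sumᶠ (λ j → b₀ j * p j i) + dot (λ j → p j i) (span μ)
        ≡⟨ cong (sumᶠ (λ j → b₀ j * p j i) +_) (trans (dot-comb (λ j → p j i) μ Q)
             (dot-cong μ (λ q → sum-cong (λ j → *-comm (p j i) (Q q j))))) ⟩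
      sumᶠ (λ j → b₀ j * p j i) + sumᶠ (λ q → μ q * sumᶠ (λ j → Q q j * p j i)) ∎
      where open ≡-Reasoning
    Sol : (Fin d → ℕ) → Set
    Sol v = Σ (Fin (nper L) → ℕ) λ x → (∀ i → v i ≡ base L i + sumᶠ (λ j → x j * p j i)) × (dot α x + γ ≡ dot β x + γ')
    to : ∀ v → Sol v → Any (v ∈L_) (map shifted bases)
    to v (x , h , e) = AnyP.map⁺ (Any.map to' (Equivalence.to (eqv x) e))
      where
      to' : ∀ {b₀} → (Σ (Fin r → ℕ) λ μ → ∀ i → x i ≡ b₀ i + span μ i) → v ∈L shifted b₀
      to' {b₀} (μ , g) = μ , λ i → begin
        v i ≡⟨ h i ⟩
        base L i + sumᶠ (λ j → x j * p j i) ≡⟨ cong (base L i +_) (sum-cong (λ j → cong (_* p j i) (g j))) ⟩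
        base L i + sumᶠ (λ j → (b₀ j + span μ j) * p j i) ≡⟨ cong (base L i +_) (expand b₀ μ i) ⟩
        base L i + (sumᶠ (λ j → b₀ j * p j i) + sumᶠ (λ q → μ q * sumᶠ (λ j → Q q j * p j i)))
          ≡⟨ sym (+-assoc (base L i) (sumᶠ (λ j → b₀ j * p j i)) (sumᶠ (λ q → μ q * sumᶠ (λ j → Q q j * p j i)))) ⟩
        base L i + sumᶠ (λ j → b₀ j * p j i) + sumᶠ (λ q → μ q * sumᶠ (λ j → Q q j * p j i)) ∎
        where open ≡-Reasoning
    from : ∀ v → Any (v ∈L_) (map shifted bases) → Sol v
    from v q with find (AnyP.map⁻ q)
    ... | b₀ , m , μ , h = (λ j → b₀ j + span μ j)
        , (λ i → trans (h i) (trans (+-assoc (base L i) (sumᶠ (λ j → b₀ j * p j i)) (sumᶠ (λ q → μ q * sumᶠ (λ j → Q q j * p j i))))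
             (cong (base L i +_) (sym (expand b₀ μ i)))))
        , Equivalence.from (eqv (λ j → b₀ j + span μ j)) (lose m (μ , λ _ → refl))

-- Cutting linear sets by quantifier-free formulas

slope : ∀ {k} → PTerm k → (Fin k → ℕ) → ℕ
slope (pvar i)   x = x i
slope (pconst _) x = 0
slope (s ⊕ t)    x = slope s x + slope t x

term-affine : ∀ {k r} (t : PTerm k) (v b : Fin k → ℕ) (x : Fin r → ℕ) (p : Fin r → Fin k → ℕ) →
  (∀ i → v i ≡ b i + sumᶠ (λ j → x j * p j i)) → ⟦ t ⟧ₜ v ≡ dot (λ j → slope t (p j)) x + ⟦ t ⟧ₜ b
term-affine (pvar i) v b x p h = trans (h i) (trans (+-comm (b i) _) (cong (_+ b i) (sum-cong (λ j → *-comm (x j) (p j i)))))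
term-affine {r = r} (pconst c) v b x p h = cong (_+ c) (sym (sum-0 {r} (λ _ → refl)))
term-affine (s ⊕ t) v b x p h = trans (cong₂ _+_ (term-affine s v b x p h) (term-affine t v b x p h))
  (trans (+-interchange (dot (λ j → slope s (p j)) x) _ _ _) (cong (_+ (⟦ s ⟧ₜ b + ⟦ t ⟧ₜ b))
    (trans (sym (sum-+ (λ j → slope s (p j) * x j) (λ j → slope t (p j) * x j)))
           (sum-cong (λ j → sym (*-distribʳ-+ (x j) (slope s (p j)) (slope t (p j))))))))

Restriction : ∀ {d} → LinearSet d → ((Fin d → ℕ) → Set) → Set
Restriction {d} L P = Σ (List (LinearSet d)) λ Ls → ∀ v → ((v ∈L L) × P v) ⇔ Any (v ∈L_) Ls

abstract
  restrict-≐ : ∀ {d} (L : LinearSet d) (s t : PTerm d) → Restriction L (λ v → ⟦ s ⟧ₜ v ≡ ⟦ t ⟧ₜ v)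
  restrict-≐ {d} L s t = proj₁ r , λ v → mk⇔ (to v) (from v)
    where
    p : Fin (nper L) → Fin d → ℕ
    p = periods L
    α β : Fin (nper L) → ℕ
    α j = slope s (p j)
    β j = slope t (p j)
    r : Σ (List (LinearSet d)) λ Ls → ∀ v →
        (Σ (Fin (nper L) → ℕ) λ x → (∀ i → v i ≡ base L i + sumᶠ (λ j → x j * p j i)) × (dot α x + ⟦ s ⟧ₜ (base L) ≡ dot β x + ⟦ t ⟧ₜ (base L)))
        ⇔ Any (v ∈L_) Ls
    r = refine L α β (⟦ s ⟧ₜ (base L)) (⟦ t ⟧ₜ (base L))
    to : ∀ v → (v ∈L L) × (⟦ s ⟧ₜ v ≡ ⟦ t ⟧ₜ v) → Any (v ∈L_) (proj₁ r)
    to v ((x , h) , e) = Equivalence.to (proj₂ r v)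
      (x , h , trans (sym (term-affine s v (base L) x p h)) (trans e (term-affine t v (base L) x p h)))
    from : ∀ v → Any (v ∈L_) (proj₁ r) → (v ∈L L) × (⟦ s ⟧ₜ v ≡ ⟦ t ⟧ₜ v)
    from v q = let (x , h , e) = Equivalence.from (proj₂ r v) q in
      (x , h) , trans (term-affine s v (base L) x p h) (trans e (sym (term-affine t v (base L) x p h)))

  -- The inequality becomes an equation after adding a zero period, whose multiplicity is the slack.
  restrict-≼ : ∀ {d} (L : LinearSet d) (s t : PTerm d) → Restriction L (λ v → ⟦ s ⟧ₜ v ≤ ⟦ t ⟧ₜ v)
  restrict-≼ {d} L s t = proj₁ r , λ v → mk⇔ (to v) (from v)
    where
    p : Fin (nper L) → Fin d → ℕ
    p = periods L
    p⁺ : Fin (suc (nper L)) → Fin d → ℕ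
    p⁺ zero    i = 0
    p⁺ (suc j) i = p j i
    L⁺ : LinearSet d
    L⁺ = record { base = base L ; nper = suc (nper L) ; periods = p⁺ }
    α β : Fin (suc (nper L)) → ℕ
    α zero    = 1
    α (suc j) = slope s (p j)
    β zero    = 0
    β (suc j) = slope t (p j)
    S T : (Fin d → ℕ) → ℕ
    S v = ⟦ s ⟧ₜ v
    T v = ⟦ t ⟧ₜ v
    r : Σ (List (LinearSet d)) λ Ls → ∀ v →
        (Σ (Fin (suc (nper L)) → ℕ) λ x → (∀ i → v i ≡ base L i + sumᶠ (λ j → x j * p⁺ j i)) × (dot α x + S (base L) ≡ dot β x + T (base L)))
        ⇔ Any (v ∈L_) Ls
    r = refine L⁺ α β (S (base L)) (T (base L))
    comb : (Fin (nper L) → ℕ) → Fin d → ℕ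
    comb x i = sumᶠ (λ j → x j * p j i)
    α' : Fin (nper L) → ℕ
    α' j = slope s (p j)
    drop0 : ∀ z y → z * 0 + y ≡ y
    drop0 z y = cong (_+ y) (*-zeroʳ z)
    slack : ∀ z y a → 1 * z + y + a ≡ z + (y + a)
    slack z y a = trans (cong (λ w → w + y + a) (*-identityˡ z)) (+-assoc z y a)
    to : ∀ v → (v ∈L L) × (S v ≤ T v) → Any (v ∈L_) (proj₁ r)
    to v ((x , h) , le) = Equivalence.to (proj₂ r v) (x⁺ , (λ i → trans (h i) (cong (base L i +_) (sym (drop0 z (comb x i))))) ,
        trans (slack z (dot α' x) (S (base L)))
          (trans (cong (z +_) (sym (term-affine s v (base L) x p h))) (trans (m∸n+n≡m le) (term-affine t v (base L) x p h))))
      where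
      z : ℕ
      z = T v ∸ S v
      x⁺ : Fin (suc (nper L)) → ℕ
      x⁺ zero    = z
      x⁺ (suc j) = x j
    from : ∀ v → Any (v ∈L_) (proj₁ r) → (v ∈L L) × (S v ≤ T v)
    from v q = (x ∘ suc , h') , subst (S v ≤_) total (m≤n+m (S v) (x zero))
      where
      sol : Σ (Fin (suc (nper L)) → ℕ) λ x → (∀ i → v i ≡ base L i + sumᶠ (λ j → x j * p⁺ j i)) × (dot α x + S (base L) ≡ dot β x + T (base L))
      sol = Equivalence.from (proj₂ r v) q
      x : Fin (suc (nper L)) → ℕ
      x = proj₁ sol
      h' : ∀ i → v i ≡ base L i + comb (x ∘ suc) i
      h' i = trans (proj₁ (proj₂ sol) i) (cong (base L i +_) (drop0 (x zero) (comb (x ∘ suc) i)))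
      total : x zero + S v ≡ T v
      total = trans (cong (x zero +_) (term-affine s v (base L) (x ∘ suc) p h'))
        (trans (sym (slack (x zero) (dot α' (x ∘ suc)) (S (base L))))
          (trans (proj₂ (proj₂ sol)) (sym (term-affine t v (base L) (x ∘ suc) p h'))))

restrict-⊎ : ∀ {d} {L : LinearSet d} {P Q R : (Fin d → ℕ) → Set} → (∀ v → R v → P v ⊎ Q v) → (∀ v → P v → R v) → (∀ v → Q v → R v) →
  Restriction L P → Restriction L Q → Restriction L R
restrict-⊎ f g h (Ls , e) (Ms , e') = Ls ++ˡ Ms , λ v → mk⇔
  (λ (m , r) → case f v r of λ { (inj₁ p) → AnyP.++⁺ˡ (Equivalence.to (e v) (m , p)) ; (inj₂ q) → AnyP.++⁺ʳ Ls (Equivalence.to (e' v) (m , q)) })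
  (λ q → case AnyP.++⁻ Ls q of λ { (inj₁ l) → let (m , p) = Equivalence.from (e v) l in m , g v p
                                 ; (inj₂ l) → let (m , p) = Equivalence.from (e' v) l in m , h v p })

-- The second restriction has to be available on every linear set, since it is applied to the pieces
-- that the first one leaves.
restrict-× : ∀ {d} {L : LinearSet d} {P Q R : (Fin d → ℕ) → Set} → (∀ v → R v → P v) → (∀ v → R v → Q v) → (∀ v → P v → Q v → R v) →
  Restriction L P → (∀ M → Restriction M Q) → Restriction L R
restrict-× f g h (Ls , e) r = concatMap (λ M → proj₁ (r M)) Ls , λ v → mk⇔
  (λ (m , s) → AnyP.concatMap⁺ _ (Any.map (λ {M} l → Equivalence.to (proj₂ (r M) v) (l , g v s)) (Equivalence.to (e v) (m , f v s))))
  (λ q → case find (AnyP.concatMap⁻ (λ M → proj₁ (r M)) q) of λ { (M , M∈ , l) →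
     let (m , qv) = Equivalence.from (proj₂ (r M) v) l
         (m' , pv) = Equivalence.from (e v) (lose M∈ m)
     in m' , h v pv qv })

restrict-cong : ∀ {d} {L : LinearSet d} {P Q : (Fin d → ℕ) → Set} → (∀ v → P v → Q v) → (∀ v → Q v → P v) → Restriction L P → Restriction L Q
restrict-cong f g (Ls , e) = Ls , λ v → mk⇔ (λ (m , q) → Equivalence.to (e v) (m , g v q))
                                           (λ l → let (m , p) = Equivalence.from (e v) l in m , f v p)

∧-false : ∀ {a b} → a ∧ b ≡ false → (a ≡ false) ⊎ (b ≡ false)
∧-false {false} h = inj₁ refl
∧-false {true}  h = inj₂ h

∧-falseˡ : ∀ {a} b → a ≡ false → a ∧ b ≡ false
∧-falseˡ b refl = refl

∧-falseʳ : ∀ a {b} → b ≡ false → a ∧ b ≡ false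
∧-falseʳ true  h = h
∧-falseʳ false h = refl

∨-true : ∀ {a b} → a ∨ b ≡ true → (a ≡ true) ⊎ (b ≡ true)
∨-true {true}  h = inj₁ refl
∨-true {false} h = inj₂ h

∨-trueˡ : ∀ {a} b → a ≡ true → a ∨ b ≡ true
∨-trueˡ b refl = refl

∨-trueʳ : ∀ a {b} → b ≡ true → a ∨ b ≡ true
∨-trueʳ true  h = refl
∨-trueʳ false h = h

∨-falseˡ : ∀ {a b} → a ∨ b ≡ false → a ≡ false
∨-falseˡ {false} h = refl

∨-falseʳ : ∀ {a b} → a ∨ b ≡ false → b ≡ false
∨-falseʳ {false} h = h

abstract
  -- Carrying the wanted truth value pushes negations down to the atoms, where they turn into strict
  -- inequalities; no complement of a semilinear set has to be formed.
  restrict : ∀ {d} (val : Bool) (q : QF d) (L : LinearSet d) → Restriction L (λ v → ⟦ q ⟧q v ≡ val)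
  restrict true (s ≐ t) L = restrict-cong (λ v → ≡ᵇ-true) (λ v → ≡ᵇ-true⁻¹) (restrict-≐ L s t)
  restrict true (s ≼ t) L = restrict-cong (λ v → ≤ᵇ-true) (λ v → ≤ᵇ-true⁻¹) (restrict-≼ L s t)
  restrict false (s ≼ t) L = restrict-cong (λ v → ≤ᵇ-false) (λ v → ≤ᵇ-false⁻¹) (restrict-≼ L (pconst 1 ⊕ t) s)
  restrict {d} false (s ≐ t) L = restrict-⊎ {R = λ v → (⟦ s ⟧ₜ v ≡ᵇ ⟦ t ⟧ₜ v) ≡ false} cases
      (λ v h → ¬true (λ e → <⇒≢ h (≡ᵇ-true⁻¹ e))) (λ v h → ¬true (λ e → <⇒≢ h (sym (≡ᵇ-true⁻¹ e))))
      (restrict-≼ L (pconst 1 ⊕ s) t) (restrict-≼ L (pconst 1 ⊕ t) s)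
    where
    cases : ∀ v → (⟦ s ⟧ₜ v ≡ᵇ ⟦ t ⟧ₜ v) ≡ false → (⟦ s ⟧ₜ v < ⟦ t ⟧ₜ v) ⊎ (⟦ t ⟧ₜ v < ⟦ s ⟧ₜ v)
    cases v h with <-cmp (⟦ s ⟧ₜ v) (⟦ t ⟧ₜ v)
    ... | tri< l _ _ = inj₁ l
    ... | tri≈ _ e _ = ⊥-elim (true≢false (≡ᵇ-true e) h)
    ... | tri> _ _ g = inj₂ g
  restrict true (qnot φ) L = restrict-cong (λ v h → cong not h) (λ v → not-true) (restrict false φ L)
  restrict false (qnot φ) L = restrict-cong (λ v h → cong not h) (λ v → not-false) (restrict true φ L)
    where
    not-false : ∀ {a} → not a ≡ false → a ≡ true
    not-false {true} h = refl
  restrict true (qand φ ψ) L = restrict-× (λ v → ∧-trueˡ) (λ v → ∧-trueʳ) (λ v → ∧-true) (restrict true φ L) (restrict true ψ)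
  restrict false (qand φ ψ) L = restrict-⊎ (λ v → ∧-false) (λ v → ∧-falseˡ _) (λ v → ∧-falseʳ (⟦ φ ⟧q v)) (restrict false φ L) (restrict false ψ L)
  restrict true (qor φ ψ) L = restrict-⊎ (λ v → ∨-true) (λ v → ∨-trueˡ _) (λ v → ∨-trueʳ (⟦ φ ⟧q v)) (restrict true φ L) (restrict true ψ L)
  restrict false (qor φ ψ) L = restrict-× (λ v → ∨-falseˡ) (λ v → ∨-falseʳ) (λ v p q → cong₂ _∨_ p q) (restrict false φ L) (restrict false ψ)

term-cong : ∀ {k} (t : PTerm k) {v w : Fin k → ℕ} → (∀ i → v i ≡ w i) → ⟦ t ⟧ₜ v ≡ ⟦ t ⟧ₜ w
term-cong (pvar i)   h = h i
term-cong (pconst c) h = refl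
term-cong (s ⊕ t)    h = cong₂ _+_ (term-cong s h) (term-cong t h)

qf-cong : ∀ {k} (q : QF k) {v w : Fin k → ℕ} → (∀ i → v i ≡ w i) → ⟦ q ⟧q v ≡ ⟦ q ⟧q w
qf-cong (s ≐ t)    h = cong₂ _≡ᵇ_ (term-cong s h) (term-cong t h)
qf-cong (s ≼ t)    h = cong₂ _≤ᵇ_ (term-cong s h) (term-cong t h)
qf-cong (qnot φ)   h = cong not (qf-cong φ h)
qf-cong (qand φ ψ) h = cong₂ _∧_ (qf-cong φ h) (qf-cong ψ h)
qf-cong (qor φ ψ)  h = cong₂ _∨_ (qf-cong φ h) (qf-cong ψ h)

universe : ∀ d → LinearSet d
universe d = record { base = λ _ → 0 ; nper = d ; periods = δ }

∈-universe : ∀ {d} v → v ∈L universe d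
∈-universe v = v , λ i → sym (trans (sum-cong (λ j → cong (λ b → v j * ι b) (==-sym j i))) (dot-δ v i))

project : ∀ d {e} → LinearSet (d + e) → LinearSet d
project d {e} L = record { base = λ i → base L (i ↑ˡ e) ; nper = nper L ; periods = λ j i → periods L j (i ↑ˡ e) }

-- Existential quantifiers are projections, and a linear set is projected by dropping coordinates of
-- its base and its periods.
semilinear-EPA : ∀ {d} (ψ : EPA d) (S : (Fin d → ℕ) → Set) → Defines ψ S → Semilinear d S
semilinear-EPA {d} ψ S def with restrict true (matrix ψ) (universe (d + nb ψ))
... | Ls , eqv = length Ms , lookup Ms , λ v → mk⇔ (to v) (from v)
  where
  Ms : List (LinearSet d)
  Ms = map (project d) Ls
  to : ∀ v → S v → Σ (Fin (length Ms)) λ j → v ∈L lookup Ms j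
  to v s with Equivalence.to (def v) s
  ... | w , h = index any , AnyP.lookup-index any
    where
    any : Any (v ∈L_) Ms
    any = AnyP.map⁺ (Any.map (λ (x , e) → x , λ i → trans (sym (lookup-++ˡ v w i)) (e (i ↑ˡ nb ψ)))
            (Equivalence.to (eqv (v ++ w)) (∈-universe (v ++ w) , h)))
  from : ∀ v → (Σ (Fin (length Ms)) λ j → v ∈L lookup Ms j) → S v
  from v (j , m) with find (AnyP.map⁻ {f = project d} {P = v ∈L_} {xs = Ls} (lose (∈-lookup {xs = Ms} j) m))
  ... | L , L∈ , (x , e) = Equivalence.from (def v) (w , trans (qf-cong (matrix ψ) agree) (proj₂ (Equivalence.from (eqv u) (lose L∈ (x , λ _ → refl)))))
    where
    u : Fin (d + nb ψ) → ℕ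
    u i = base L i + sumᶠ (λ j → x j * periods L j i)
    w : Fin (nb ψ) → ℕ
    w i = u (d ↑ʳ i)
    agree : ∀ i → (v ++ w) i ≡ u i
    agree i with splitAt d i in eq
    ... | inj₁ a = trans (e a) (cong u (FP.splitAt⁻¹-↑ˡ eq))
    ... | inj₂ b = cong u (FP.splitAt⁻¹-↑ʳ eq)

-- Reflected formulas of bounded size

n<2^n : ∀ n → n < 2 ^ n
n<2^n zero    = s≤s z≤n
n<2^n (suc n) = ≤-trans (+-mono-≤ (m^n>0 2 n) (n<2^n n)) (≤-reflexive (cong (2 ^ n +_) (sym (+-identityʳ (2 ^ n)))))

bitlen≤ : ∀ c → bitlen c ≤ suc c
bitlen≤ c = s≤s (subst (⌊log₂ c ⌋ ≤_) (⌊log₂[2^n]⌋≡n c) (⌊log₂⌋-mono-≤ (<⇒≤ (n<2^n c))))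

-- Quantifier-free formulas together with the property they express; sizes are tracked as
-- exponents of a common base Y, so that they do not depend on the C² sentence.
module Reflected (V Y : ℕ) (4≤Y : 4 ≤ Y) where

  Env : Set
  Env = Fin V → ℕ

  record Term (i : ℕ) (f : Env → ℕ) : Set where
    field
      term   : PTerm V
      value  : ∀ ρ → ⟦ term ⟧ₜ ρ ≡ f ρ
      tbound : tsize term ≤ Y ^ i
  open Term public

  record Form (i : ℕ) (S : Env → Set) : Set where
    field
      form  : QF V
      sound : ∀ ρ → ⟦ form ⟧q ρ ≡ true → S ρ
      compl : ∀ ρ → S ρ → ⟦ form ⟧q ρ ≡ true
      bound : qsize form ≤ Y ^ i
  open Form public

  instance
    Y≢0 : NonZero Y
    Y≢0 = >-nonZero (≤-trans (s≤s z≤n) 4≤Y)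

  Y^>0 : ∀ i → 1 ≤ Y ^ i
  Y^>0 i = m^n>0 Y i

  step : ∀ {a} i → a ≤ 4 * Y ^ i → a ≤ Y ^ suc i
  step i h = ≤-trans h (*-monoˡ-≤ (Y ^ i) 4≤Y)

  -- As `Y` is at least 4, one further exponent absorbs the new node and the addition. Exponents
  -- therefore depend only on how a formula is put together.
  binary : ∀ {a b} i j → a ≤ Y ^ i → b ≤ Y ^ j → suc (a + b) ≤ Y ^ suc (i + j)
  binary {a} {b} i j p q = step (i + j) (begin
    1 + (a + b) ≤⟨ +-mono-≤ (Y^>0 (i + j)) (+-mono-≤ (≤-trans p (^-monoʳ-≤ Y (m≤m+n i j))) (≤-trans q (^-monoʳ-≤ Y (m≤n+m j i)))) ⟩
    z + (z + z) ≤⟨ +-monoʳ-≤ z (+-monoʳ-≤ z (m≤m+n z (z + 0))) ⟩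
    4 * z ∎)
    where
    open ≤-Reasoning
    z = Y ^ (i + j)

  constant : ∀ c → suc c ≤ Y → Term 1 (λ _ → c)
  constant c h = record { term = pconst c ; value = λ _ → refl ; tbound = ≤-trans (bitlen≤ c) (≤-trans h (≤-reflexive (sym (*-identityʳ Y)))) }

  _⊞_ : ∀ {i j f g} → Term i f → Term j g → Term (suc (i + j)) (λ ρ → f ρ + g ρ)
  _⊞_ {i} {j} s t = record { term = term s ⊕ term t ; value = λ ρ → cong₂ _+_ (value s ρ) (value t ρ) ; tbound = binary i j (tbound s) (tbound t) }

  weighted : ∀ {P} → (Fin P → Fin V) → (Fin P → Bool) → Env → ℕ
  weighted e f ρ = sumᶠ (λ p → if f p then ρ (e p) else 0)

  weightedT : ∀ {P} → (Fin P → Fin V) → (Fin P → Bool) → PTerm V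
  weightedT {zero}  e f = pconst 0
  weightedT {suc P} e f = (if f zero then pvar (e zero) else pconst 0) ⊕ weightedT (e ∘ suc) (f ∘ suc)

  weighted-term : ∀ {P} (e : Fin P → Fin V) (f : Fin P → Bool) → P ≤ Y → Term 2 (weighted e f)
  weighted-term {P} e f P≤Y = record { term = weightedT e f ; value = val e f ; tbound =
      ≤-trans (size≤ e f) (≤-trans (s≤s (+-mono-≤ P≤Y P≤Y)) (step 1 (begin
        1 + (Y + Y) ≤⟨ +-monoˡ-≤ (Y + Y) (≤-trans (s≤s z≤n) 4≤Y) ⟩
        Y + (Y + Y) ≤⟨ +-monoʳ-≤ Y (+-monoʳ-≤ Y (m≤m+n Y (Y + 0))) ⟩
        4 * Y ≡⟨ cong (4 *_) (sym (*-identityʳ Y)) ⟩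
        4 * Y ^ 1 ∎))) }
    where
    open ≤-Reasoning
    val : ∀ {P} (e : Fin P → Fin V) (f : Fin P → Bool) ρ → ⟦ weightedT e f ⟧ₜ ρ ≡ weighted e f ρ
    val {zero}  e f ρ = refl
    val {suc P} e f ρ = cong₂ _+_ (val₀ (f zero)) (val (e ∘ suc) (f ∘ suc) ρ)
      where
      val₀ : ∀ b → ⟦ (if b then pvar (e zero) else pconst 0) ⟧ₜ ρ ≡ (if b then ρ (e zero) else 0)
      val₀ true  = refl
      val₀ false = refl
    size≤ : ∀ {P} (e : Fin P → Fin V) (f : Fin P → Bool) → tsize (weightedT e f) ≤ suc (P + P)
    size≤ {zero}  e f = ≤-refl
    size≤ {suc P} e f = s≤s (≤-trans (+-mono-≤ (size₀ (f zero)) (size≤ (e ∘ suc) (f ∘ suc))) (s≤s (≤-reflexive (sym (+-suc P P)))))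
      where
      size₀ : ∀ b → tsize (if b then pvar (e zero) else pconst 0) ≤ 1
      size₀ true  = ≤-refl
      size₀ false = ≤-refl

  _≐ᶠ_ : ∀ {i j f g} → Term i f → Term j g → Form (suc (i + j)) (λ ρ → f ρ ≡ g ρ)
  _≐ᶠ_ {i} {j} s t = record { form = term s ≐ term t
    ; sound = λ ρ h → trans (sym (value s ρ)) (trans (≡ᵇ-true⁻¹ h) (value t ρ))
    ; compl = λ ρ h → ≡ᵇ-true (trans (value s ρ) (trans h (sym (value t ρ))))
    ; bound = binary i j (tbound s) (tbound t) }

  _≼ᶠ_ : ∀ {i j f g} → Term i f → Term j g → Form (suc (i + j)) (λ ρ → f ρ ≤ g ρ)
  _≼ᶠ_ {i} {j} s t = record { form = term s ≼ term t
    ; sound = λ ρ h → subst₂ _≤_ (value s ρ) (value t ρ) (≤ᵇ-true⁻¹ h)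
    ; compl = λ ρ h → ≤ᵇ-true (subst₂ _≤_ (sym (value s ρ)) (sym (value t ρ)) h)
    ; bound = binary i j (tbound s) (tbound t) }

  _×ᶠ_ : ∀ {i j S T} → Form i S → Form j T → Form (suc (i + j)) (λ ρ → S ρ × T ρ)
  _×ᶠ_ {i} {j} φ ψ = record { form = qand (form φ) (form ψ)
    ; sound = λ ρ h → sound φ ρ (∧-trueˡ h) , sound ψ ρ (∧-trueʳ h)
    ; compl = λ ρ (s , t) → ∧-true (compl φ ρ s) (compl ψ ρ t)
    ; bound = binary i j (bound φ) (bound ψ) }

  _⊎ᶠ_ : ∀ {i j S T} → Form i S → Form j T → Form (suc (i + j)) (λ ρ → S ρ ⊎ T ρ)
  _⊎ᶠ_ {i} {j} φ ψ = record { form = qor (form φ) (form ψ)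
    ; sound = λ ρ h → [ inj₁ ∘ sound φ ρ , inj₂ ∘ sound ψ ρ ]′ (∨-true h)
    ; compl = λ ρ → [ (λ s → ∨-trueˡ _ (compl φ ρ s)) , (λ t → ∨-trueʳ (⟦ form φ ⟧q ρ) (compl ψ ρ t)) ]′
    ; bound = binary i j (bound φ) (bound ψ) }

  ¬ᶠ_ : ∀ {i S} → Form i S → Form (suc (i + 0)) (λ ρ → ¬ S ρ)
  ¬ᶠ_ {i} φ = record { form = qnot (form φ)
    ; sound = λ ρ h s → true≢false (compl φ ρ s) (not-true h)
    ; compl = λ ρ h → cong not (¬true (h ∘ sound φ ρ))
    ; bound = ≤-trans (s≤s (m≤m+n (qsize (form φ)) 0)) (binary i 0 (bound φ) z≤n) }

  decided : ∀ {S : Set} → Dec S → Form 1 (λ _ → S)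
  decided (yes s) = record { form = pconst 0 ≐ pconst 0 ; sound = λ _ _ → s ; compl = λ _ _ → refl
                           ; bound = ≤-trans (s≤s (s≤s (s≤s z≤n))) (≤-trans 4≤Y (≤-reflexive (sym (*-identityʳ Y)))) }
  decided (no ¬s) = record { form = pconst 0 ≐ pconst 1 ; sound = λ _ () ; compl = λ _ s → ⊥-elim (¬s s)
                           ; bound = ≤-trans (s≤s (s≤s (s≤s z≤n))) (≤-trans 4≤Y (≤-reflexive (sym (*-identityʳ Y)))) }

  every : ∀ {k} → (Fin k → QF V) → QF V
  every {zero}  φ = pconst 0 ≐ pconst 0
  every {suc k} φ = qand (φ zero) (every (φ ∘ suc))

  -- One exponent pays for the number of conjuncts, which is at most `Y`, the other for the
  -- connectives.
  all : ∀ {k i} {S : Fin k → Env → Set} → k ≤ Y → (∀ j → Form i (S j)) → Form (2 + i) (λ ρ → ∀ j → S j ρ)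
  all {k} {i} {S} k≤Y φ = record { form = every (λ j → form (φ j)) ; sound = s φ ; compl = c φ
    ; bound = ≤-trans (size≤ φ) (step (suc i) (begin
        3 + k * (1 + Y ^ i) ≤⟨ +-mono-≤ (≤-trans (n≤1+n 3) (≤-trans 4≤Y Y≤)) (≤-trans (*-monoˡ-≤ (1 + Y ^ i) k≤Y) (≤-reflexive (*-distribˡ-+ Y 1 (Y ^ i)))) ⟩
        z + (Y * 1 + z) ≤⟨ +-monoʳ-≤ z (+-mono-≤ (≤-trans (≤-reflexive (*-identityʳ Y)) Y≤) (m≤m+n z (z + 0))) ⟩
        4 * z ∎)) }
    where
    open ≤-Reasoning
    z = Y ^ suc i
    Y≤ : Y ≤ z
    Y≤ = ≤-trans (≤-reflexive (sym (*-identityʳ Y))) (*-monoʳ-≤ Y (Y^>0 i))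
    s : ∀ {k} {S : Fin k → Env → Set} (φ : ∀ j → Form i (S j)) ρ → ⟦ every (λ j → form (φ j)) ⟧q ρ ≡ true → ∀ j → S j ρ
    s φ ρ h zero    = sound (φ zero) ρ (∧-trueˡ h)
    s φ ρ h (suc j) = s (φ ∘ suc) ρ (∧-trueʳ {⟦ form (φ zero) ⟧q ρ} h) j
    c : ∀ {k} {S : Fin k → Env → Set} (φ : ∀ j → Form i (S j)) ρ → (∀ j → S j ρ) → ⟦ every (λ j → form (φ j)) ⟧q ρ ≡ true
    c {zero}  φ ρ h = refl
    c {suc k} φ ρ h = ∧-true (compl (φ zero) ρ (h zero)) (c (φ ∘ suc) ρ (h ∘ suc))
    size≤ : ∀ {k} {S : Fin k → Env → Set} (φ : ∀ j → Form i (S j)) → qsize (every (λ j → form (φ j))) ≤ 3 + k * (1 + Y ^ i)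
    size≤ {zero}  φ = ≤-refl
    size≤ {suc k} φ = ≤-trans (s≤s (+-mono-≤ (bound (φ zero)) (size≤ (φ ∘ suc))))
      (≤-reflexive (trans (sym (+-assoc (suc (Y ^ i)) 3 _)) (trans (cong (_+ k * (1 + Y ^ i)) (+-comm (suc (Y ^ i)) 3)) (+-assoc 3 (suc (Y ^ i)) _))))

  recast : ∀ {i S T} → Form i S → (∀ ρ → S ρ → T ρ) → (∀ ρ → T ρ → S ρ) → Form i T
  recast φ f g = record { form = form φ ; sound = λ ρ → f ρ ∘ sound φ ρ ; compl = λ ρ → compl φ ρ ∘ g ρ ; bound = bound φ }

-- Typed and coloured structures

record Signature : Set where
  field
    A C h   : ℕ
    c₀      : Fin C
    inv     : Fin C → Fin C
    inv-inv : ∀ c → inv (inv c) ≡ c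
    k       : Fin h → ℕ
    Ψ       : Fin h → Fin A → Fin A → Fin C → Bool
    self    : Fin h → Fin A → Bool
    β       : Fin A → Fin h → Bool
    acc     : Fin A → Bool

optb : ∀ {C} → (Fin C → Bool) → Fin (suc C) → Bool
optb g zero    = false
optb g (suc c) = g c

optAll : ∀ {C} → (Fin C → Bool) → Fin (suc C) → Bool
optAll g zero    = true
optAll g (suc c) = g c

allᶠ-true : ∀ {N} {p : Fin N → Bool} → allᶠ p ≡ true → ∀ i → p i ≡ true
allᶠ-true {suc N} h zero = ∧-trueˡ h
allᶠ-true {suc N} {p} h (suc i) = allᶠ-true (∧-trueʳ {p zero} h) i

allᶠ-intro : ∀ {N} {p : Fin N → Bool} → (∀ i → p i ≡ true) → allᶠ p ≡ true
allᶠ-intro {zero}  h = refl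
allᶠ-intro {suc N} h = ∧-true (h zero) (allᶠ-intro (h ∘ suc))

-- Elements carry a type in Fin A, ordered pairs of distinct elements a colour in Fin C.  Test θ
-- holds at u iff at least k θ elements v satisfy Ψ θ (or self θ, for v = u); the type of an
-- element records in β the outcome of all tests.
module Abstract (Sg : Signature) where
  open Signature Sg public

  record Model (N : ℕ) : Set where
    field
      ty      : Fin N → Fin A
      col     : Fin N → Fin N → Fin C
      col-inv : ∀ {u v} → u ≢ v → col v u ≡ inv (col u v)
    tst : Fin h → Fin N → Fin N → Bool
    tst θ u v = if u == v then self θ (ty u) else Ψ θ (ty u) (ty v) (col u v)
    field
      cnt      : ∀ u θ → β (ty u) θ ≡ (k θ ≤ᵇ countᶠ (tst θ u))
      accepted : ∀ u → acc (ty u) ≡ true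

  -- Bounds the number of elements relied upon by one element: `k θ` witnesses for each test.
  D : ℕ
  D = sumᶠ k

  abstract
    X Z : ℕ
    X = suc (D + D * D)
    Z = 3 * suc D

    X≡ : X ≡ suc (D + D * D)
    X≡ = refl

    Z≡ : Z ≡ 3 * suc D
    Z≡ = refl

  -- A refined type adds to a type one of the `X` colours that separate partners and one of `Z`
  -- labels that isolate kings. A profile adds to a refined type a table with `suc D` optional
  -- colours for every refined type.
  T P : ℕ
  T = A * (X * Z)
  P = T * suc C ^ (T * suc D)

  abstract
    kind : Fin T → Fin A
    kind t = proj₁ (remQuot {A} (X * Z) t)

    mkType : Fin A → Fin X → Fin Z → Fin T
    mkType a χ l = combine a (combine χ l)

    kind-mkType : ∀ a χ l → kind (mkType a χ l) ≡ a
    kind-mkType a χ l = cong proj₁ (FP.remQuot-combine {A} {X * Z} a (combine χ l))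

    mkType-injective : ∀ {a a' χ χ' l l'} → mkType a χ l ≡ mkType a' χ' l' → (a ≡ a') × (χ ≡ χ') × (l ≡ l')
    mkType-injective {a} {a'} {χ} {χ'} {l} {l'} e with FP.combine-injective a (combine χ l) a' (combine χ' l') e
    ... | p , q = p , FP.combine-injective χ l χ' l' q

    tyP : Fin P → Fin T
    tyP p = proj₁ (remQuot {T} (suc C ^ (T * suc D)) p)

    slot : Fin P → Fin T → Fin (suc D) → Fin (suc C)
    slot p t j = finToFun {suc C} {T * suc D} (proj₂ (remQuot {T} (suc C ^ (T * suc D)) p)) (combine t j)

    profile : Fin T → (Fin T → Fin (suc D) → Fin (suc C)) → Fin P
    profile t e = combine t (funToFin (λ q → e (proj₁ (remQuot {T} (suc D) q)) (proj₂ (remQuot {T} (suc D) q))))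

    tyP-profile : ∀ t e → tyP (profile t e) ≡ t
    tyP-profile t e = cong proj₁ (FP.remQuot-combine {T} {suc C ^ (T * suc D)} t _)

    slot-profile : ∀ t e t' j → slot (profile t e) t' j ≡ e t' j
    slot-profile t e t' j = trans (cong (λ z → finToFun {suc C} {T * suc D} (proj₂ z) (combine t' j)) (FP.remQuot-combine {T} {suc C ^ (T * suc D)} t _))
      (trans (FP.finToFun-funToFin {T * suc D} {suc C} _ (combine t' j)) (cong (λ z → e (proj₁ z) (proj₂ z)) (FP.remQuot-combine {T} {suc D} t' j)))

  -- Entry zero is the colour of the link to the king or partner of the given type, the others are
  -- the colours of further elements of that type relied upon.
  lk : Fin P → Fin T → Fin (suc C)
  lk p t = slot p t zero

  so : Fin P → Fin T → Fin D → Fin (suc C)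
  so p t j = slot p t (suc j)

  -- Safety: a pair of colour `c` gives an element of type `t` no witness of a test that it must
  -- fail.
  sf : Fin T → Fin T → Fin C → Bool
  sf t t' c = allᶠ (λ θ → β (kind t) θ ∨ not (Ψ θ (kind t) (kind t') c))

  sf-elim : ∀ t t' c → sf t t' c ≡ true → ∀ θ → β (kind t) θ ≡ false → Ψ θ (kind t) (kind t') c ≡ false
  sf-elim t t' c s θ b = [ (λ e → ⊥-elim (true≢false e b)) , not-true ]′ (∨-true (allᶠ-true s θ))

  Sil : Fin T → Fin T → Fin C → Set
  Sil t t' c = (sf t t' c ≡ true) × (sf t' t (inv c) ≡ true)

  Sil? : ∀ t t' → Dec (Σ (Fin C) (Sil t t'))
  Sil? t t' = FP.any? (λ c → (sf t t' c B.≟ true) ×-dec (sf t' t (inv c) B.≟ true))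

  is : Fin T → Fin P → Bool
  is t p = tyP p == t

  sel : Fin T → Fin T → Fin C → Fin P → Bool
  sel t t' c p = is t p ∧ (lk p t' == suc c)

  -- The tests of a king are counted from the profiles of the others: each of them records its
  -- colour towards the king, which is read backwards here.
  kf : Fin h → Fin T → Fin P → Bool
  kf θ t p = not (is t p) ∧ optb (λ c → Ψ θ (kind t) (kind (tyP p)) (inv c)) (lk p t)

  val : Fin h → Fin T → Fin T → Fin (suc C) → ℕ
  val θ t t' = opt (λ c → ι (Ψ θ (kind t) (kind t') c))

  localSum : Fin h → Fin P → ℕ
  localSum θ p = ι (self θ (kind (tyP p))) + sumᶠ (λ t' → sumᶠ (λ j → val θ (tyP p) t' (slot p t' j)))

  -- The conditions on the numbers of elements with each profile, expressed through the number
  -- μ f of elements whose profile satisfies f.  A type with a single element is a king.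
  module Conditions (μ : (Fin P → Bool) → ℕ) where
    Absent : Fin P → Set
    Absent p = μ (λ q → q == p) ≡ 0
    n : Fin T → ℕ
    n t = μ (is t)
    Q0 Q1 Q2 Q3 Q4 Q5 Q6 Q7 Q8 Q9 : Set
    Q0 = ∀ t → (n t ≡ 0) ⊎ (n t ≡ 1) ⊎ (Z ≤ n t)
    Q1 = ∀ p → Absent p ⊎ acc (kind (tyP p)) ≡ true
    Q2 = ∀ p → Absent p ⊎ lk p (tyP p) ≡ zero
    -- Receivers keep no record of incoming colours, so their safety is demanded from the table of
    -- the sender.
    Q3 = ∀ p t j → Absent p ⊎ optAll (λ c → sf t (tyP p) (inv c)) (so p t j) ≡ true
    -- A common element is judged by its table alone: a true test has to reach its threshold there,
    -- and a failing one gets no further witness because all remaining colours are safe.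
    Q4 = ∀ p θ → Absent p ⊎ (n (tyP p) ≡ 1) ⊎ β (kind (tyP p)) θ ≡ (k θ ≤ᵇ localSum θ p)
    Q5 = ∀ p t → (Absent p ⊎ t ≡ tyP p) ⊎ (¬ (n t ≡ 1)) ⊎ lk p t ≢ zero
    Q6 = ∀ p t j → Absent p ⊎ so p t j ≡ zero ⊎ Z ≤ n t
    -- Both numbers count the linked pairs of colour `c`. Exempt are pairs within one type, which
    -- `Q2` leaves without links, and pairs of a king and a large type, which only the large side
    -- records.
    Q7 = ∀ t t' c → ((t ≡ t') ⊎ ((n t ≡ 1) × Z ≤ n t') ⊎ (Z ≤ n t × (n t' ≡ 1))) ⊎ μ (sel t t' c) ≡ μ (sel t' t (inv c))
    Q8 = ∀ t t' → (Σ (Fin C) (Sil t t')) ⊎ (n t ≤ 1) ⊎ (n t' ≤ 1)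
    Q9 = ∀ t θ → (¬ (n t ≡ 1)) ⊎ ((β (kind t) θ ≡ true) × k θ ≤ ι (self θ (kind t)) + μ (kf θ t))
                               ⊎ ((β (kind t) θ ≡ false) × ι (self θ (kind t)) + μ (kf θ t) + 1 ≤ k θ)
    record Cond : Set where
      field
        q0 : Q0
        q1 : Q1
        q2 : Q2
        q3 : Q3
        q4 : Q4
        q5 : Q5
        q6 : Q6
        q7 : Q7
        q8 : Q8
        q9 : Q9

-- From numbers of profiles to models

module Realisation (Sg : Signature) (N : ℕ) where
  open Abstract Sg
  module _ (own : Fin N → Fin P) (μ : (Fin P → Bool) → ℕ) (μ-own : ∀ f → μ f ≡ countᶠ (f ∘ own))
           (cond : Conditions.Cond μ) where
    open Conditions μ
    open Cond cond

    t : Fin N → Fin T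
    t u = tyP (own u)

    i : Fin N → Fin T → Fin (suc C)
    i u = lk (own u)

    o : Fin N → Fin T → Fin D → Fin (suc C)
    o u = so (own u)

    X# : Fin T → ℕ
    X# τ = countᶠ (λ u → t u == τ)

    n≡ : ∀ τ → n τ ≡ X# τ
    n≡ τ = μ-own (is τ)

    present : ∀ {S : Set} u → Absent (own u) ⊎ S → S
    present u (inj₂ s) = s
    present u (inj₁ z) = ⊥-elim (true≢false (==-refl (own u)) (count≡0 {p = λ v → own v == own u} (trans (sym (μ-own _)) z) u))

    kgT : Fin T → Bool
    kgT τ = X# τ ≡ᵇ 1

    kg : Fin N → Bool
    kg u = kgT (t u)

    kg-X : ∀ {τ} → kgT τ ≡ true → X# τ ≡ 1
    kg-X h = ≡ᵇ-true⁻¹ h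

    X-kg : ∀ {τ} → X# τ ≡ 1 → kgT τ ≡ true
    X-kg h = ≡ᵇ-true h

    3≤Z : 3 ≤ Z
    3≤Z = subst (3 ≤_) (sym Z≡) (m≤m*n 3 (suc D))

    Z≢1 : ∀ {x} → x ≡ 1 → ¬ (Z ≤ x)
    Z≢1 refl h = case ≤-trans 3≤Z h of λ { (s≤s ()) }

    big : ∀ u → kg u ≡ false → Z ≤ X# (t u)
    big u h with q0 (t u)
    ... | inj₁ z = ⊥-elim (true≢false (==-refl (t u)) (count≡0 {p = λ v → t v == t u} (trans (sym (n≡ (t u))) z) u))
    ... | inj₂ (inj₁ one) = ⊥-elim (true≢false (X-kg (trans (sym (n≡ (t u))) one)) h)
    ... | inj₂ (inj₂ z) = subst (Z ≤_) (n≡ (t u)) z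

    king-unique : ∀ {u v} → kg u ≡ true → t v ≡ t u → v ≡ u
    king-unique {u} {v} h e = count-unique {p = λ w → t w == t u} (≤-reflexive (kg-X h)) (≡⇒== e) (==-refl (t u))

    i-own : ∀ u → i u (t u) ≡ zero
    i-own u = present u (q2 (own u))

    i-king : ∀ u τ → τ ≢ t u → X# τ ≡ 1 → Σ (Fin C) λ c → i u τ ≡ suc c
    i-king u τ ne one with q5 (own u) τ
    ... | inj₁ a = ⊥-elim (ne (present u a))
    ... | inj₂ (inj₁ no1) = ⊥-elim (no1 (trans (n≡ τ) one))
    ... | inj₂ (inj₂ nz) with i u τ
    ... | zero  = ⊥-elim (nz refl)
    ... | suc c = c , refl

    S : Fin T → Fin T → Fin C → Fin N → Bool
    S τ τ' c u = sel τ τ' c (own u)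

    S-intro : ∀ {u τ τ' c} → t u ≡ τ → i u τ' ≡ suc c → S τ τ' c u ≡ true
    S-intro p q = ∧-true (≡⇒== p) (≡⇒== q)

    balanced : ∀ τ τ' c → τ ≢ τ' → kgT τ ≡ kgT τ' → countᶠ (S τ τ' c) ≡ countᶠ (S τ' τ (inv c))
    balanced τ τ' c ne e with q7 τ τ' c
    ... | inj₂ eq = trans (sym (μ-own _)) (trans eq (μ-own _))
    ... | inj₁ (inj₁ p) = ⊥-elim (ne p)
    ... | inj₁ (inj₂ (inj₁ (one , z))) = ⊥-elim (Z≢1 (kg-X (trans (sym e) (X-kg (trans (sym (n≡ τ)) one)))) (subst (Z ≤_) (n≡ τ') z))
    ... | inj₁ (inj₂ (inj₂ (z , one))) = ⊥-elim (Z≢1 (kg-X (trans e (X-kg (trans (sym (n≡ τ')) one)))) (subst (Z ≤_) (n≡ τ) z))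

    -- The bijection between requests: an element is matched with the element of equal rank among
    -- those of the other type that ask for the inverse colour. Comparing `kg` excludes a king with
    -- a common element, where `q7` promises no balance.
    mtc : Fin C → Fin N → Fin N → Bool
    mtc c u v = (i v (t u) == suc (inv c)) ∧ beq (kg u) (kg v) ∧
                (rank (S (t u) (t v) c) u ≡ᵇ rank (S (t v) (t u) (inv c)) v)

    mt : Fin N → Fin N → Bool
    mt u v = optb (λ c → mtc c u v) (i u (t v))

    record Matched (u v : Fin N) : Set where
      constructor matched
      field
        c   : Fin C
        iu  : i u (t v) ≡ suc c
        iv  : i v (t u) ≡ suc (inv c)
        kgs : kg u ≡ kg v
        rks : rank (S (t u) (t v) c) u ≡ rank (S (t v) (t u) (inv c)) v

    mt-elim : ∀ u v → mt u v ≡ true → Matched u v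
    mt-elim u v h with i u (t v) in e
    ... | suc c = matched c e (==⇒≡ (∧-trueˡ h)) (beq-true (∧-trueˡ (∧-trueʳ {i v (t u) == suc (inv c)} h)))
                    (≡ᵇ-true⁻¹ (∧-trueʳ {beq (kg u) (kg v)} (∧-trueʳ {i v (t u) == suc (inv c)} h)))

    mt-intro : ∀ {u v} → Matched u v → mt u v ≡ true
    mt-intro {u} {v} (matched c iu iv kgs rks) rewrite iu = ∧-true (≡⇒== iv) (∧-true (beq-refl kgs) (≡ᵇ-true rks))

    Matched-sym : ∀ {u v} → Matched u v → Matched v u
    Matched-sym {u} {v} (matched c iu iv kgs rks) = matched (inv c) iv (trans iu (cong suc (sym (inv-inv c)))) (sym kgs)
      (trans (sym rks) (cong (λ z → rank (S (t u) (t v) z) u) (sym (inv-inv c))))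

    mt-≢ : ∀ {u v} → Matched u v → t u ≢ t v
    mt-≢ {u} (matched c iu _ _ _) e = case trans (sym (i-own u)) (trans (cong (i u) e) iu) of λ ()

    link : Fin N → Fin N → Bool
    link u v = (kg v ∧ not (kg u)) ∨ mt u v

    link-elim : ∀ {u v} → link u v ≡ true → ((kg v ≡ true) × (kg u ≡ false)) ⊎ Matched u v
    link-elim {u} {v} h = [ (λ e → inj₁ (∧-trueˡ e , not-true (∧-trueʳ {kg v} e))) , (λ e → inj₂ (mt-elim u v e)) ]′ (∨-true h)

    link-king : ∀ {u v} → kg v ≡ true → kg u ≡ false → link u v ≡ true
    link-king a b = ∨-trueˡ _ (∧-true a (cong not b))

    link-mt : ∀ {u v} → Matched u v → link u v ≡ true
    link-mt {u} {v} m = ∨-trueʳ (kg v ∧ not (kg u)) (mt-intro m)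

    ph nxt : ℕ → ℕ
    ph 0 = 0
    ph 1 = 1
    ph 2 = 2
    ph (suc (suc (suc m))) = ph m
    nxt 0 = 1
    nxt 1 = 2
    nxt (suc (suc _)) = 0

    nxt≢ : ∀ m → m ≢ nxt m
    nxt≢ 0 ()
    nxt≢ 1 ()
    nxt≢ (suc (suc m)) ()

    -- With only two parts, the successor of the successor would be the part itself, and two
    -- elements could send to each other.
    nxt² : ∀ m → m ≢ nxt (nxt m)
    nxt² 0 ()
    nxt² 1 ()
    nxt² (suc (suc m)) ()

    nxt<3 : ∀ m → nxt m < 3
    nxt<3 0 = s≤s (s≤s z≤n)
    nxt<3 1 = s≤s (s≤s (s≤s z≤n))
    nxt<3 (suc (suc m)) = s≤s z≤n

    r : Fin N → ℕ
    r u = rank (λ w → t w == t u) u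

    -- One-sided colours are sent cyclically between the residues of the rank modulo three, so
    -- that no pair receives two of them.
    al : Fin N → Fin N → Bool
    al u v = (not (kg u) ∧ not (kg v)) ∧ (not (mt u v) ∧ (ph (r v) ≡ᵇ nxt (ph (r u))))

    record Allowed (u v : Fin N) : Set where
      constructor allowed
      field
        kgu : kg u ≡ false
        kgv : kg v ≡ false
        nmt : mt u v ≡ false
        phs : ph (r v) ≡ nxt (ph (r u))

    al-elim : ∀ {u v} → al u v ≡ true → Allowed u v
    al-elim {u} {v} h = allowed (not-true (∧-trueˡ (∧-trueˡ h))) (not-true (∧-trueʳ {not (kg u)} (∧-trueˡ h)))
      (not-true (∧-trueˡ h')) (≡ᵇ-true⁻¹ (∧-trueʳ {not (mt u v)} h'))
      where h' = ∧-trueʳ {not (kg u) ∧ not (kg v)} h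

    al-intro : ∀ {u v} → Allowed u v → al u v ≡ true
    al-intro (allowed a b c d) = ∧-true (∧-true (cong not a) (cong not b)) (∧-true (cong not c) (≡ᵇ-true d))

    q : Fin N → Fin T → Fin N → Bool
    q u τ v = (t v == τ) ∧ al u v

    at : ∀ {d} → (Fin d → Fin (suc C)) → ℕ → Fin (suc C)
    at {zero}  f m       = zero
    at {suc d} f zero    = f zero
    at {suc d} f (suc m) = at (f ∘ suc) m

    at-suc : ∀ {d} (f : Fin d → Fin (suc C)) m {c} → at f m ≡ suc c → Σ (Fin d) λ j → f j ≡ suc c
    at-suc {suc d} f zero    h = zero , h
    at-suc {suc d} f (suc m) h with at-suc (f ∘ suc) m h
    ... | j , e = suc j , e

    sum-at : ∀ {d} (f : Fin d → Fin (suc C)) (g : Fin C → ℕ) {m} → d ≤ m →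
             sumᶠ {m} (λ j → opt g (at f (toℕ j))) ≡ sumᶠ (λ j → opt g (f j))
    sum-at {zero}  f g {m} h = sum-0 {m} (λ _ → refl)
    sum-at {suc d} f g (s≤s h) = cong (opt g (f zero) +_) (sum-at (f ∘ suc) g h)

    -- The allowed elements of a type receive the table entries in the order of their ranks; those
    -- beyond the end of the table receive nothing.
    out : Fin N → Fin N → Fin (suc C)
    out u v = at (o u (t v)) (rank (q u (t v)) v)

    -- What `u` demands of the pair; `zero` leaves the colour to `v` or to the default.
    rel : Fin N → Fin N → Fin (suc C)
    rel u v = if link u v then i u (t v) else (if al u v then out u v else zero)

    silent : Fin T → Fin T → Fin C
    silent τ τ' with Sil? τ τ'
    ... | yes (c , _) = c
    -- Never reached between common elements, by `q8`; a pair with a king is coloured by a link.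
    ... | no _        = c₀

    -- The harmless colour is always chosen from the smaller index to the larger one, since
    -- independent choices for the two directions need not be inverse to each other.
    dflt : Fin N → Fin N → Fin C
    dflt u v = if toℕ u <ᵇ toℕ v then silent (t u) (t v) else inv (silent (t v) (t u))

    join : Fin (suc C) → Fin (suc C) → Fin C → Fin C
    join (suc c) _       d = c
    join zero    (suc c) d = inv c
    join zero    zero    d = d

    colour : Fin N → Fin N → Fin C
    colour u v = join (rel u v) (rel v u) (dflt u v)

    record Sent (u v : Fin N) (c : Fin C) : Set where
      constructor sent
      field
        al-uv : Allowed u v
        outc  : out u v ≡ suc c

    rel-elim : ∀ u v {c} → rel u v ≡ suc c →
      ((link u v ≡ true) × (i u (t v) ≡ suc c)) ⊎ ((link u v ≡ false) × Sent u v c)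
    rel-elim u v h with link u v in el
    ... | true  = inj₁ (refl , h)
    ... | false with al u v in ea
    ... | true  = inj₂ (refl , sent (al-elim ea) h)
    ... | false = case h of λ ()

    rel-link : ∀ {u v} → link u v ≡ true → rel u v ≡ i u (t v)
    rel-link h rewrite h = refl

    ¬sent-back : ∀ {u v c c'} → Sent u v c → Sent v u c' → ⊥
    ¬sent-back {u} {v} (sent a _) (sent b _) = nxt² (ph (r u)) (trans (Allowed.phs b) (cong nxt (Allowed.phs a)))

    ¬link-sent : ∀ {u v c} → link u v ≡ true → Sent v u c → ⊥
    ¬link-sent {u} {v} l (sent a _) with link-elim l
    ... | inj₁ (kv , _) = true≢false kv (Allowed.kgu a)
    ... | inj₂ m = true≢false (mt-intro (Matched-sym m)) (Allowed.nmt a)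

    -- Both sides make demands only in matched pairs: a king demands nothing of a common element, a
    -- link excludes sending, and the cyclic order excludes sending both ways.
    compat : ∀ u v {c c'} → rel u v ≡ suc c → rel v u ≡ suc c' → c' ≡ inv c
    compat u v e e' with rel-elim u v e | rel-elim v u e'
    ... | inj₂ (_ , s) | inj₂ (_ , s') = ⊥-elim (¬sent-back s s')
    ... | inj₁ (l , _) | inj₂ (_ , s') = ⊥-elim (¬link-sent l s')
    ... | inj₂ (_ , s) | inj₁ (l , _) = ⊥-elim (¬link-sent l s)
    ... | inj₁ (l , a) | inj₁ (l' , b) with link-elim l
    ... | inj₂ (matched c iu iv _ _) = FP.suc-injective (trans (sym b) (trans iv (cong (suc ∘ inv) (FP.suc-injective (trans (sym iu) a)))))
    ... | inj₁ (kv , ku) with link-elim l'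
    ... | inj₁ (ku' , _) = ⊥-elim (true≢false ku' ku)
    ... | inj₂ m = ⊥-elim (true≢false kv (trans (Matched.kgs m) ku))

    dflt-inv : ∀ {u v} → u ≢ v → dflt v u ≡ inv (dflt u v)
    dflt-inv {u} {v} ne with <-cmp (toℕ u) (toℕ v)
    ... | tri≈ _ e _ = ⊥-elim (ne (FP.toℕ-injective e))
    ... | tri< l _ g rewrite ≤ᵇ-true l | ≤ᵇ-false {suc (toℕ v)} {toℕ u} (s≤s (<⇒≤ l)) = refl
    ... | tri> _ _ l rewrite ≤ᵇ-true l | ≤ᵇ-false {suc (toℕ u)} {toℕ v} (s≤s (<⇒≤ l)) = sym (inv-inv _)

    colour-inv : ∀ {u v} → u ≢ v → colour v u ≡ inv (colour u v)
    colour-inv {u} {v} ne with rel u v in e | rel v u in e'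
    ... | zero  | zero   = dflt-inv ne
    ... | suc c | zero   = refl
    ... | zero  | suc c' = sym (inv-inv c')
    ... | suc c | suc c' = compat u v e e'

    nz : Fin (suc C) → ℕ
    nz zero    = 0
    nz (suc _) = 1

    -- No link stays inside a type; a king is linked exactly once, and `q5` guarantees an entry for
    -- it; towards any other type, equally long lists of requests contain exactly one element of the
    -- same rank.
    link-count : ∀ u τ → kg u ≡ false → countᶠ (λ v → (t v == τ) ∧ link u v) ≡ nz (i u τ)
    link-count u τ ku with τ F.≟ t u
    ... | yes refl = trans (count-0 (λ v → ¬true (none v))) (cong nz (sym (i-own u)))
      where
      none : ∀ v → (t v == t u) ∧ link u v ≡ true → ⊥
      none v h with link-elim (∧-trueʳ {t v == t u} h)
      ... | inj₁ (kv , _) = true≢false kv (trans (cong kgT (==⇒≡ (∧-trueˡ h))) ku)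
      ... | inj₂ m = mt-≢ m (sym (==⇒≡ (∧-trueˡ h)))
    ... | no ne with kgT τ in kτ
    ... | true = trans (count-cong all) (trans (kg-X kτ) (sym (cong nz (proj₂ (i-king u τ ne (kg-X kτ))))))
      where
      all : ∀ v → (t v == τ) ∧ link u v ≡ (t v == τ)
      all v = bool-ext ∧-trueˡ (λ e → ∧-true e (link-king (trans (cong kgT (==⇒≡ e)) kτ) ku))
    ... | false with i u τ in e
    ... | zero = count-0 (λ v → ¬true (none v))
      where
      none : ∀ v → (t v == τ) ∧ link u v ≡ true → ⊥
      none v h with ==⇒≡ (∧-trueˡ h) | link-elim (∧-trueʳ {t v == τ} h)
      ... | refl | inj₁ (kv , _) = true≢false kv kτ
      ... | refl | inj₂ m = case trans (sym e) (Matched.iu m) of λ ()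
    ... | suc c = begin
        countᶠ (λ v → (t v == τ) ∧ link u v) ≡⟨ count-sum (λ v → (t v == τ) ∧ link u v) ⟩
        sumᶠ (λ v → ι ((t v == τ) ∧ link u v)) ≡⟨ sum-cong char ⟩
        sumᶠ (λ v → if B v then ι (rank B v ≡ᵇ ru) else 0) ≡⟨ sum-rank B (λ j → ι (j ≡ᵇ ru)) ⟩
        sumᶠ {countᶠ B} (λ j → ι (toℕ j ≡ᵇ ru)) ≡⟨ countBelow (countᶠ B) ru ⟩
        -- `u` has rank `ru` in its own list; the opposite list is equally long, so this rank occurs
        -- there too.
        ι (ru <ᵇ countᶠ B) ≡⟨ cong ι (≤ᵇ-true (subst (ru <_) (balanced (t u) τ c (ne ∘ sym) (trans ku (sym kτ))) (rank-< (S (t u) τ c) (S-intro refl e)))) ⟩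
        1 ∎
      where
      open ≡-Reasoning
      B : Fin N → Bool
      B = S τ (t u) (inv c)
      ru : ℕ
      ru = rank (S (t u) τ c) u
      char : ∀ v → ι ((t v == τ) ∧ link u v) ≡ (if B v then ι (rank B v ≡ᵇ ru) else 0)
      char v = trans (cong ι (bool-ext to from)) (ι-∧ (B v) (rank B v ≡ᵇ ru))
        where
        to : (t v == τ) ∧ link u v ≡ true → B v ∧ (rank B v ≡ᵇ ru) ≡ true
        to h with ==⇒≡ (∧-trueˡ h) | link-elim (∧-trueʳ {t v == τ} h)
        ... | refl | inj₁ (kv , _) = ⊥-elim (true≢false kv kτ)
        ... | refl | inj₂ (matched c' iu iv _ rks) with FP.suc-injective (trans (sym e) iu)
        ... | refl = ∧-true (S-intro refl iv) (≡ᵇ-true (sym rks))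
        from : B v ∧ (rank B v ≡ᵇ ru) ≡ true → (t v == τ) ∧ link u v ≡ true
        from h with ==⇒≡ {i = t v} {τ} (∧-trueˡ (∧-trueˡ {B v} h))
        ... | refl = ∧-true (==-refl (t v)) (link-mt (matched c e (==⇒≡ (∧-trueʳ {t v == τ} (∧-trueˡ {B v} h))) (trans ku (sym kτ))
                       (sym (≡ᵇ-true⁻¹ (∧-trueʳ {B v} h)))))

    phase-count : ∀ d {m} a → 3 * d ≤ m → a < 3 → d ≤ sumᶠ {m} (λ j → ι (ph (toℕ j) ≡ᵇ a))
    phase-count zero    a h b = z≤n
    phase-count (suc d) {m} a h b with subst (_≤ m) (*-suc 3 d) h
    phase-count (suc d) {suc (suc (suc m))} a h b | s≤s (s≤s (s≤s h')) = block a b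
      where
      rest : ℕ
      rest = sumᶠ {m} (λ j → ι (ph (toℕ j) ≡ᵇ a))
      IH : d ≤ rest
      IH = phase-count d a h' b
      block : ∀ a' → a' < 3 → suc d ≤ ι (0 ≡ᵇ a') + (ι (1 ≡ᵇ a') + (ι (2 ≡ᵇ a') + rest))
      block 0 _ = s≤s IH
      block 1 _ = s≤s IH
      block 2 _ = s≤s IH
      block (suc (suc (suc _))) (s≤s (s≤s (s≤s ())))

    -- Among `3 * suc D` consecutive ranks each residue occurs `suc D` times; at most one of these
    -- elements is lost, namely the matched partner of `u`.
    allowed-count : ∀ u τ → kg u ≡ false → Z ≤ X# τ → D ≤ countᶠ (q u τ)
    allowed-count u τ ku zτ = ≤-pred (≤-trans total (≤-trans (≤-reflexive (count-split cand (mt u)))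
        (+-mono-≤ few (count-mono rest))))
      where
      ok : ℕ → Bool
      ok j = ph j ≡ᵇ nxt (ph (r u))
      cand : Fin N → Bool
      cand v = (t v == τ) ∧ ok (rank (λ w → t w == τ) v)
      total : suc D ≤ countᶠ cand
      total = ≤-trans (phase-count (suc D) (nxt (ph (r u))) (subst (_≤ X# τ) Z≡ zτ) (nxt<3 _))
        (≤-reflexive (sym (trans (count-sum cand) (trans (sum-cong (λ v → ι-∧ (t v == τ) (ok (rank (λ w → t w == τ) v)))) (sum-rank (λ w → t w == τ) (ι ∘ ok))))))
      nz≤1 : ∀ x → nz x ≤ 1
      nz≤1 zero    = z≤n
      nz≤1 (suc _) = ≤-refl
      few : countᶠ (λ v → cand v ∧ mt u v) ≤ 1
      few = ≤-trans (count-mono {q = λ v → (t v == τ) ∧ link u v}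
          (λ v h → ∧-true (∧-trueˡ (∧-trueˡ {cand v} h)) (∨-trueʳ (kg v ∧ not (kg u)) (∧-trueʳ {cand v} h))))
        (≤-trans (≤-reflexive (link-count u τ ku)) (nz≤1 (i u τ)))
      rest : ∀ v → cand v ∧ not (mt u v) ≡ true → q u τ v ≡ true
      rest v h with ==⇒≡ {i = t v} {τ} (∧-trueˡ (∧-trueˡ {cand v} h))
      ... | refl = ∧-true (==-refl (t v)) (al-intro (allowed ku (¬true (λ kv → Z≢1 (kg-X kv) zτ)) (not-true (∧-trueʳ {cand v} h))
                     (≡ᵇ-true⁻¹ (∧-trueʳ {t v == τ} (∧-trueˡ {cand v} h)))))

    silent-Sil : ∀ u v → kg u ≡ false → kg v ≡ false → Sil (t u) (t v) (silent (t u) (t v))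
    silent-Sil u v ku kv with Sil? (t u) (t v)
    ... | yes (_ , s) = s
    ... | no none with q8 (t u) (t v)
    ... | inj₁ s = ⊥-elim (none s)
    ... | inj₂ (inj₁ le) = ⊥-elim (<⇒≱ (s≤s (s≤s z≤n)) (≤-trans (≤-trans 3≤Z (big u ku)) (subst (_≤ 1) (n≡ (t u)) le)))
    ... | inj₂ (inj₂ le) = ⊥-elim (<⇒≱ (s≤s (s≤s z≤n)) (≤-trans (≤-trans 3≤Z (big v kv)) (subst (_≤ 1) (n≡ (t v)) le)))

    dflt-safe : ∀ u v → kg u ≡ false → kg v ≡ false → sf (t u) (t v) (dflt u v) ≡ true
    dflt-safe u v ku kv with toℕ u <ᵇ toℕ v
    ... | true  = proj₁ (silent-Sil u v ku kv)
    ... | false = proj₂ (silent-Sil v u kv ku)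

    sent-safe : ∀ {u v c} → Sent v u c → sf (t u) (t v) (inv c) ≡ true
    sent-safe {u} {v} {c} (sent _ e) with at-suc (o v (t u)) (rank (q v (t u)) u) e
    ... | j , e' = trans (sym (cong (optAll (λ c → sf (t u) (t v) (inv c))) e')) (present v (q3 (own v) (t u) j))

    unsent-safe : ∀ u v → kg u ≡ false → rel u v ≡ zero → sf (t u) (t v) (colour u v) ≡ true
    unsent-safe u v ku e rewrite e = go (rel v u) refl
      where
      nolink : link u v ≡ true → ⊥
      nolink l with link-elim l
      ... | inj₂ m = case trans (sym (trans (sym (rel-link l)) e)) (Matched.iu m) of λ ()
      ... | inj₁ (kv , _) with i-king u (t v) (λ te → true≢false kv (trans (cong kgT te) ku)) (kg-X kv)
      ... | c , ec = case trans (sym (trans (sym (rel-link l)) e)) ec of λ ()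
      kv : kg v ≡ false
      kv = ¬true (λ kv → nolink (link-king kv ku))
      go : ∀ x → rel v u ≡ x → sf (t u) (t v) (join zero x (dflt u v)) ≡ true
      go zero    _  = dflt-safe u v ku kv
      go (suc c) e' with rel-elim v u e'
      ... | inj₂ (_ , s) = sent-safe s
      ... | inj₁ (l , _) with link-elim l
      ... | inj₁ (ku' , _) = ⊥-elim (true≢false ku' ku)
      ... | inj₂ m = ⊥-elim (nolink (link-mt (Matched-sym m)))

    rel-self : ∀ u → rel u u ≡ zero
    rel-self u = go (rel u u) refl
      where
      go : ∀ x → rel u u ≡ x → rel u u ≡ zero
      go zero    e = e
      go (suc c) e with rel-elim u u e
      ... | inj₁ (_ , a) = trans e (trans (sym a) (i-own u))
      ... | inj₂ (_ , s) = ⊥-elim (nxt≢ (ph (r u)) (Allowed.phs (Sent.al-uv s)))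

    tstᶜ : Fin h → Fin N → Fin N → Bool
    tstᶜ θ u v = if u == v then self θ (kind (t u)) else Ψ θ (kind (t u)) (kind (t v)) (colour u v)

    restᶜ : Fin h → Fin N → Fin N → Bool
    restᶜ θ u v = not (u == v) ∧ (isZero (rel u v) ∧ Ψ θ (kind (t u)) (kind (t v)) (colour u v))
      where
      isZero : ∀ {m} → Fin (suc m) → Bool
      isZero zero    = true
      isZero (suc _) = false

    -- The demands of a common element towards one type realise every entry of that row of its table
    -- exactly once, so any weight summed over them can be read off the profile.
    fibre : ∀ (g : Fin C → ℕ) u τ → kg u ≡ false →
            sumᶠ (λ v → if t v == τ then opt g (rel u v) else 0) ≡ opt g (i u τ) + sumᶠ (λ j → opt g (o u τ j))
    fibre g u τ ku = begin
      sumᶠ (λ v → if t v == τ then opt g (rel u v) else 0) ≡⟨ sum-cong split ⟩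
      sumᶠ (λ v → linked v + sent' v) ≡⟨ sum-+ linked sent' ⟩
      sumᶠ linked + sumᶠ sent' ≡⟨ cong₂ _+_ part₁ part₂ ⟩
      opt g (i u τ) + sumᶠ (λ j → opt g (o u τ j)) ∎
      where
      open ≡-Reasoning
      K : ℕ
      K = opt g (i u τ)
      linked sent' : Fin N → ℕ
      linked v = K * ι ((t v == τ) ∧ link u v)
      sent' v = if q u τ v then opt g (at (o u τ) (rank (q u τ) v)) else 0
      split : ∀ v → (if t v == τ then opt g (rel u v) else 0) ≡ linked v + sent' v
      split v with t v == τ in e
      ... | false = sym (trans (+-identityʳ _) (*-zeroʳ K))
      ... | true with ==⇒≡ {i = t v} {τ} e
      ... | refl with link u v in el | al u v in ea
      ... | true  | true  = ⊥-elim (¬link-al el (al-elim {u} {v} ea))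
        where
        ¬link-al : link u v ≡ true → Allowed u v → ⊥
        ¬link-al l a with link-elim l
        ... | inj₁ (kv , _) = true≢false kv (Allowed.kgv a)
        ... | inj₂ m = true≢false (mt-intro m) (Allowed.nmt a)
      ... | true  | false = sym (trans (+-identityʳ _) (*-identityʳ K))
      ... | false | true  = sym (cong (_+ opt g (out u v)) (*-zeroʳ K))
      ... | false | false = sym (cong (_+ 0) (*-zeroʳ K))
      K-nz : K * nz (i u τ) ≡ K
      K-nz with i u τ
      ... | zero  = refl
      ... | suc _ = *-identityʳ _
      part₁ : sumᶠ linked ≡ K
      part₁ = trans (sum-* K (λ v → ι ((t v == τ) ∧ link u v))) (trans (cong (K *_) (trans (sym (count-sum (λ v → (t v == τ) ∧ link u v))) (link-count u τ ku))) K-nz)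
      -- By `q6`, entries to be sent exist only for large types, and these have the `D` receivers
      -- that the row may need.
      none-or-big : (∀ j → o u τ j ≡ zero) ⊎ (Z ≤ X# τ)
      none-or-big with Z ≤? X# τ
      ... | yes z = inj₂ z
      ... | no nz = inj₁ (λ j → [ id , (λ z → ⊥-elim (nz (subst (Z ≤_) (n≡ τ) z))) ]′ (present u (q6 (own u) τ j)))
      at-zero : ∀ {d} (f : Fin d → Fin (suc C)) → (∀ j → f j ≡ zero) → ∀ m → at f m ≡ zero
      at-zero {zero}  f h m       = refl
      at-zero {suc d} f h zero    = h zero
      at-zero {suc d} f h (suc m) = at-zero (f ∘ suc) (h ∘ suc) m
      part₂ : sumᶠ sent' ≡ sumᶠ (λ j → opt g (o u τ j))
      part₂ with none-or-big
      ... | inj₂ z = trans (sum-rank (q u τ) (λ m → opt g (at (o u τ) m))) (sum-at (o u τ) g (allowed-count u τ ku z))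
      ... | inj₁ h = trans (sum-0 (λ v → trans (cong (λ x → if q u τ v then opt g x else 0) (at-zero (o u τ) h _)) (if-same (q u τ v))))
                           (sym (sum-0 (λ j → cong (opt g) (h j))))
        where
        if-same : ∀ b → (if b then 0 else 0) ≡ 0
        if-same true  = refl
        if-same false = refl

    count-local : ∀ θ u → kg u ≡ false → countᶠ (tstᶜ θ u) ≡ localSum θ (own u) + countᶠ (restᶜ θ u)
    count-local θ u ku = begin
      countᶠ (tstᶜ θ u) ≡⟨ count-sum (tstᶜ θ u) ⟩
      sumᶠ (λ v → ι (tstᶜ θ u v)) ≡⟨ sum-cong split ⟩
      sumᶠ (λ v → a v + b v + ι (restᶜ θ u v)) ≡⟨ sum-+ (λ v → a v + b v) (λ v → ι (restᶜ θ u v)) ⟩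
      sumᶠ (λ v → a v + b v) + sumᶠ (λ v → ι (restᶜ θ u v)) ≡⟨ cong₂ _+_ (sum-+ a b) (sym (count-sum (restᶜ θ u))) ⟩
      sumᶠ a + sumᶠ b + countᶠ (restᶜ θ u) ≡⟨ cong (_+ countᶠ (restᶜ θ u)) (cong₂ _+_ (sum-δ u (λ _ → s₀)) sumb) ⟩
      localSum θ (own u) + countᶠ (restᶜ θ u) ∎
      where
      open ≡-Reasoning
      s₀ : ℕ
      s₀ = ι (self θ (kind (t u)))
      a b : Fin N → ℕ
      a v = if u == v then s₀ else 0
      b v = val θ (t u) (t v) (rel u v)
      split : ∀ v → ι (tstᶜ θ u v) ≡ a v + b v + ι (restᶜ θ u v)
      split v with u == v in e
      ... | true with ==⇒≡ {i = u} {v} e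
      ... | refl rewrite rel-self u = sym (trans (+-identityʳ _) (+-identityʳ _))
      split v | false with rel u v
      ... | suc c = sym (+-identityʳ _)
      ... | zero  = refl
      sumb : sumᶠ b ≡ sumᶠ (λ τ → sumᶠ (λ j → val θ (t u) τ (slot (own u) τ j)))
      sumb = trans (count-fibres t b) (sum-cong (λ τ → trans (sum-cong (at-type τ)) (fibre (λ c → ι (Ψ θ (kind (t u)) (kind τ) c)) u τ ku)))
        where
        at-type : ∀ τ v → (if t v == τ then b v else 0) ≡ (if t v == τ then val θ (t u) τ (rel u v) else 0)
        at-type τ v with t v == τ in e
        ... | false = refl
        ... | true  = cong (λ τ → val θ (t u) τ (rel u v)) (==⇒≡ {i = t v} {τ} e)

    rest-zero : ∀ θ u → kg u ≡ false → β (kind (t u)) θ ≡ false → countᶠ (restᶜ θ u) ≡ 0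
    rest-zero θ u ku b = count-0 (λ v → ¬true (none v))
      where
      none : ∀ v → restᶜ θ u v ≡ true → ⊥
      none v h with rel u v in e
      ... | suc c = case ∧-trueʳ {not (u == v)} h of λ ()
      ... | zero  = true≢false (trans (cong (λ x → Ψ θ (kind (t u)) (kind (t v)) (join x (rel v u) (dflt u v))) e) (∧-trueʳ {not (u == v)} h))
                      (sf-elim (t u) (t v) (colour u v) (unsent-safe u v ku e) θ b)

    -- A true test reaches its threshold within the table, and the surplus counted by `restᶜ` can
    -- only help. For a failing test there is no surplus, as every colour not demanded by `u` is
    -- safe.
    common-correct : ∀ θ u → kg u ≡ false → β (kind (t u)) θ ≡ (k θ ≤ᵇ countᶠ (tstᶜ θ u))
    common-correct θ u ku with present u (q4 (own u) θ)
    ... | inj₁ one = ⊥-elim (true≢false (X-kg (trans (sym (n≡ (t u))) one)) ku)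
    ... | inj₂ e with ≡-dec (β (kind (t u)) θ)
    ... | inj₁ b = trans b (sym (≤ᵇ-true {k θ} {countᶠ (tstᶜ θ u)} (≤-trans (≤ᵇ-true⁻¹ {k θ} {localSum θ (own u)} (trans (sym e) b)) (≤-trans (m≤m+n (localSum θ (own u)) (countᶠ (restᶜ θ u))) (≤-reflexive (sym (count-local θ u ku)))))))
    ... | inj₂ b = trans e (cong (k θ ≤ᵇ_) (sym (trans (count-local θ u ku) (trans (cong (localSum θ (own u) +_) (rest-zero θ u ku b)) (+-identityʳ _)))))

    -- For two kings, the entry of `v` makes one list of requests nonempty; by balance so is the
    -- other, whose only possible member is `u`. Both ranks are then zero.
    link-to-king : ∀ u v → kg u ≡ true → v ≢ u → link v u ≡ true
    link-to-king u v ku ne with ≡-dec (kg v)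
    ... | inj₂ kv = link-king ku kv
    ... | inj₁ kv = link-mt (matched c e iu (trans kv (sym ku)) (trans (n≤0⇒n≡0 (≤-pred r₁)) (sym (n≤0⇒n≡0 (≤-pred r₂)))))
      where
      tne : t v ≢ t u
      tne p = ne (king-unique ku p)
      ec : Σ (Fin C) λ c → i v (t u) ≡ suc c
      ec = i-king v (t u) (tne ∘ sym) (kg-X ku)
      c : Fin C
      c = proj₁ ec
      e : i v (t u) ≡ suc c
      e = proj₂ ec
      Sv Su : Fin N → Bool
      Sv = S (t v) (t u) c
      Su = S (t u) (t v) (inv c)
      Sv-v : Sv v ≡ true
      Sv-v = S-intro refl e
      wit : Σ (Fin N) λ w → Su w ≡ true
      wit = count-witness (subst (1 ≤_) (balanced (t v) (t u) c tne (trans kv (sym ku))) (count-≥1 {p = Sv} v Sv-v))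
      w≡u : proj₁ wit ≡ u
      w≡u = king-unique ku (==⇒≡ (∧-trueˡ (proj₂ wit)))
      Su-u : Su u ≡ true
      Su-u = subst (λ w → Su w ≡ true) w≡u (proj₂ wit)
      iu : i u (t v) ≡ suc (inv c)
      iu = ==⇒≡ (∧-trueʳ {t u == t u} Su-u)
      r₁ : rank Sv v < 1
      r₁ = ≤-trans (rank-< Sv Sv-v) (≤-trans (count-mono {q = λ w → t w == t v} (λ w → ∧-trueˡ)) (≤-reflexive (kg-X kv)))
      r₂ : rank Su u < 1
      r₂ = ≤-trans (rank-< Su Su-u) (≤-trans (count-mono {q = λ w → t w == t u} (λ w → ∧-trueˡ)) (≤-reflexive (kg-X ku)))

    king-colour : ∀ u v → kg u ≡ true → v ≢ u → Σ (Fin C) λ c → (i v (t u) ≡ suc c) × (colour u v ≡ inv c)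
    king-colour u v ku ne with i-king v (t u) (λ p → ne (king-unique ku (sym p))) (kg-X ku)
    ... | c , e = c , e , trans (colour-inv ne) (cong inv (cong (λ x → join x (rel u v) (dflt v u)) (trans (rel-link {v} {u} (link-to-king u v ku ne)) e)))

    -- Every other element demands its colour towards the king, so no colour is left open and the
    -- count is exact.
    count-king : ∀ θ u → kg u ≡ true → countᶠ (tstᶜ θ u) ≡ ι (self θ (kind (t u))) + μ (kf θ (t u))
    count-king θ u ku = trans (count-sum (tstᶜ θ u)) (trans (sum-cong split)
        (trans (sum-+ a (λ v → ι (kf θ (t u) (own v)))) (cong₂ _+_ (sum-δ u (λ _ → s₀)) (trans (sym (count-sum (λ v → kf θ (t u) (own v)))) (sym (μ-own (kf θ (t u))))))))
      where
      s₀ : ℕ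
      s₀ = ι (self θ (kind (t u)))
      a : Fin N → ℕ
      a v = if u == v then s₀ else 0
      split : ∀ v → ι (tstᶜ θ u v) ≡ a v + ι (kf θ (t u) (own v))
      split v with u == v in e
      ... | true with ==⇒≡ {i = u} {v} e
      ... | refl rewrite ==-refl (t u) = sym (+-identityʳ _)
      split v | false with king-colour u v ku (λ p → ==⇒≢ {i = u} {v} e (sym p))
      ... | c , ic , ec rewrite ec | ic | ≢⇒== {i = t v} {t u} (λ p → ==⇒≢ {i = u} {v} e (sym (king-unique ku p))) = refl

    king-correct : ∀ θ u → kg u ≡ true → β (kind (t u)) θ ≡ (k θ ≤ᵇ countᶠ (tstᶜ θ u))
    king-correct θ u ku with q9 (t u) θ
    ... | inj₁ no1 = ⊥-elim (no1 (trans (n≡ (t u)) (kg-X ku)))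
    ... | inj₂ (inj₁ (b , le)) = trans b (sym (≤ᵇ-true {k θ} {countᶠ (tstᶜ θ u)} (≤-trans le (≤-reflexive (sym (count-king θ u ku))))))
    ... | inj₂ (inj₂ (b , lt)) = trans b (sym (≤ᵇ-false {k θ} {countᶠ (tstᶜ θ u)} (≤-trans (≤-reflexive (trans (cong suc (count-king θ u ku)) (+-comm 1 (ι (self θ (kind (t u))) + μ (kf θ (t u)))))) lt)))

    model : Model N
    model = record { ty = kind ∘ t ; col = colour ; col-inv = colour-inv
                   ; cnt = λ u θ → [ king-correct θ u , common-correct θ u ]′ (≡-dec (kg u))
                   ; accepted = λ u → present u (q1 (own u)) }

-- From models to numbers of profiles

anyᶠ : ∀ {N} → (Fin N → Bool) → Bool
anyᶠ {zero}  p = false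
anyᶠ {suc N} p = p zero ∨ anyᶠ (p ∘ suc)

anyᶠ-intro : ∀ {N} (p : Fin N → Bool) i → p i ≡ true → anyᶠ p ≡ true
anyᶠ-intro p zero    h = ∨-trueˡ _ h
anyᶠ-intro p (suc i) h = ∨-trueʳ (p zero) (anyᶠ-intro (p ∘ suc) i h)

ι-any : ∀ {N} (p : Fin N → Bool) → ι (anyᶠ p) ≤ sumᶠ (λ i → ι (p i))
ι-any {zero}  p = z≤n
ι-any {suc N} p with p zero
... | true  = s≤s z≤n
... | false = ι-any (p ∘ suc)

count-any : ∀ {N M} (p : Fin M → Fin N → Bool) → countᶠ (λ v → anyᶠ (λ w → p w v)) ≤ sumᶠ (λ w → countᶠ (p w))
count-any {N} {M} p = begin
  countᶠ (λ v → anyᶠ (λ w → p w v)) ≡⟨ count-sum (λ v → anyᶠ (λ w → p w v)) ⟩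
  sumᶠ (λ v → ι (anyᶠ (λ w → p w v))) ≤⟨ sum-mono (λ v → ι-any (λ w → p w v)) ⟩
  sumᶠ (λ v → sumᶠ (λ w → ι (p w v))) ≡⟨ sum-swap {N} {M} (λ v w → ι (p w v)) ⟩
  sumᶠ (λ w → sumᶠ (λ v → ι (p w v))) ≡⟨ sum-cong (λ w → sym (count-sum (p w))) ⟩
  sumᶠ (λ w → countᶠ (p w)) ∎
  where open ≤-Reasoning

count-∨ : ∀ {N} (p q : Fin N → Bool) → countᶠ (λ v → p v ∨ q v) ≤ countᶠ p + countᶠ q
count-∨ {zero}  p q = z≤n
count-∨ {suc N} p q = ≤-trans (+-mono-≤ (ι-∨ (p zero) (q zero)) (count-∨ (p ∘ suc) (q ∘ suc)))
                              (≤-reflexive (+-interchange (ι (p zero)) _ _ _))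
  where
  ι-∨ : ∀ a b → ι (a ∨ b) ≤ ι a + ι b
  ι-∨ true  b = s≤s z≤n
  ι-∨ false b = ≤-refl

rank-cong : ∀ {N} {p q : Fin N → Bool} → (∀ i → p i ≡ q i) → ∀ v → rank p v ≡ rank q v
rank-cong h zero    = refl
rank-cong h (suc v) = cong₂ _+_ (cong ι (h zero)) (rank-cong (h ∘ suc) v)

-- Element `zero` is coloured last: if all `suc Δ` colours occurred among its neighbours, it would
-- have too many of them.
greedy : ∀ {N} Δ (E : Fin N → Fin N → Bool) → (∀ u → countᶠ (E u) ≤ Δ) →
         Σ (Fin N → Fin (suc Δ)) λ χ → ∀ {u v} → u ≢ v → E u v ≡ true → E v u ≡ true → χ u ≢ χ v
greedy {zero}  Δ E deg = (λ ()) , λ {u} → λ _ _ _ _ → case u of λ ()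
greedy {suc N} Δ E deg with greedy Δ (λ u v → E (suc u) (suc v)) (λ u → ≤-trans (m≤n+m _ (ι (E (suc u) zero))) (deg (suc u)))
... | χ , proper with FP.any? (λ c → FP.all? (λ v → ¬? ((E zero (suc v) B.≟ true) ×-dec (χ v F.≟ c))))
... | yes (c , free-c) = χ⁺ , proper⁺
  where
  χ⁺ : Fin (suc N) → Fin (suc Δ)
  χ⁺ zero    = c
  χ⁺ (suc v) = χ v
  proper⁺ : ∀ {u v} → u ≢ v → E u v ≡ true → E v u ≡ true → χ⁺ u ≢ χ⁺ v
  proper⁺ {zero}  {zero}  ne _ _ _ = ne refl
  proper⁺ {zero}  {suc v} ne e _ q = free-c v (e , sym q)
  proper⁺ {suc u} {zero}  ne _ e q = free-c u (e , q)
  proper⁺ {suc u} {suc v} ne e e' q = proper (ne ∘ cong suc) e e' q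
... | no none = ⊥-elim (<⇒≱ (≤-trans used (m≤n+m (countᶠ (λ v → E zero (suc v))) (ι (E zero zero)))) (deg zero))
  where
  hit : ∀ c → Σ (Fin N) λ v → (E zero (suc v) ≡ true) × (χ v ≡ c)
  hit c with FP.any? (λ v → (E zero (suc v) B.≟ true) ×-dec (χ v F.≟ c))
  ... | yes w = w
  ... | no nw = ⊥-elim (none (c , λ v w → nw (v , w)))
  f : Fin N → ℕ
  f v = ι (E zero (suc v))
  used : suc Δ ≤ countᶠ (λ v → E zero (suc v))
  used = begin
    suc Δ ≡⟨ sym (*-identityʳ (suc Δ)) ⟩
    suc Δ * 1 ≡⟨ sym (sum-const {suc Δ} 1) ⟩
    sumᶠ {suc Δ} (λ _ → 1) ≤⟨ sum-mono (λ c → one c (hit c)) ⟩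
    sumᶠ (λ c → sumᶠ (λ v → if χ v == c then f v else 0)) ≡⟨ sym (count-fibres χ f) ⟩
    sumᶠ f ≡⟨ sym (count-sum (λ v → E zero (suc v))) ⟩
    countᶠ (λ v → E zero (suc v)) ∎
    where
    open ≤-Reasoning
    one : ∀ c → (Σ (Fin N) λ v → (E zero (suc v) ≡ true) × (χ v ≡ c)) → 1 ≤ sumᶠ (λ v → if χ v == c then f v else 0)
    one c (v , e , p) = ≤-trans (≤-reflexive (sym (trans (cong (λ b → if b then f v else 0) (≡⇒== p)) (cong ι e))))
                          (sum-≥ (λ v → if χ v == c then f v else 0) v)

-- Refining the types of a model

module Labelling (Sg : Signature) {N : ℕ} (M : Abstract.Model Sg N) where
  open Abstract Sg
  open Model M

  -- The first k θ witnesses of every test are the elements u relies on.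
  wit : Fin h → Fin N → Fin N → Bool
  wit θ u v = tst θ u v ∧ (rank (tst θ u) v <ᵇ k θ)

  Out Mut : Fin N → Fin N → Bool
  Out u v = not (u == v) ∧ anyᶠ (λ θ → wit θ u v)
  Mut u v = Out u v ∧ Out v u

  Out-count : ∀ u → countᶠ (Out u) ≤ D
  Out-count u = ≤-trans (count-mono {q = λ v → anyᶠ (λ θ → wit θ u v)} (λ v → ∧-trueʳ {not (u == v)}))
    (≤-trans (count-any (λ θ → wit θ u)) (sum-mono (λ θ → proj₂ (count-first (tst θ u) (k θ)))))

  Mut-count : ∀ u → countᶠ (Mut u) ≤ D
  Mut-count u = ≤-trans (count-mono {q = Out u} (λ v → ∧-trueˡ)) (Out-count u)

  Mut-sym : ∀ {u v} → Mut u v ≡ true → Mut v u ≡ true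
  Mut-sym {u} {v} h = ∧-true (∧-trueʳ {Out u v} h) (∧-trueˡ h)

  Out-≢ : ∀ {u v} → Out u v ≡ true → u ≢ v
  Out-≢ {u} {v} h refl = true≢false (==-refl u) (not-true (∧-trueˡ h))

  -- Distance two is included so that the partners of a common element differ in colour among
  -- themselves as well.
  E : Fin N → Fin N → Bool
  E u v = Mut u v ∨ anyᶠ (λ w → Mut u w ∧ Mut w v)

  E-count : ∀ u → countᶠ (E u) ≤ D + D * D
  E-count u = ≤-trans (count-∨ (Mut u) (λ v → anyᶠ (λ w → Mut u w ∧ Mut w v)))
    (+-mono-≤ (Mut-count u) (≤-trans (count-any (λ w v → Mut u w ∧ Mut w v))
      (≤-trans (sum-mono row) (≤-trans (≤-reflexive (trans (sum-* D (λ w → ι (Mut u w))) (cong (D *_) (sym (count-sum (Mut u))))))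
        (*-monoʳ-≤ D (Mut-count u))))))
    where
    row : ∀ w → countᶠ (λ v → Mut u w ∧ Mut w v) ≤ D * ι (Mut u w)
    row w with Mut u w
    ... | true  = ≤-trans (Mut-count w) (≤-reflexive (sym (*-identityʳ D)))
    ... | false = ≤-trans (≤-reflexive (count-0 {N} (λ _ → refl))) z≤n

  abstract
    coloured : Σ (Fin N → Fin X) λ χ → ∀ {u v} → u ≢ v → E u v ≡ true → E v u ≡ true → χ u ≢ χ v
    coloured = subst (λ z → Σ (Fin N → Fin z) λ χ → ∀ {u v} → u ≢ v → E u v ≡ true → E v u ≡ true → χ u ≢ χ v) (sym X≡)
                 (greedy (D + D * D) E E-count)

  χ : Fin N → Fin X
  χ = proj₁ coloured

  cl : Fin N → Fin N → Bool
  cl u v = (ty v == ty u) ∧ (χ v == χ u)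

  -- A class with fewer than `Z` elements is split by rank into kings; a larger one stays whole
  -- under label 0. So no refined type has a population strictly between 1 and `Z`.
  cls lab : Fin N → ℕ
  cls u = countᶠ (cl u)
  lab u = if cls u <ᵇ Z then rank (cl u) u else 0

  cl-refl : ∀ u → cl u u ≡ true
  cl-refl u = ∧-true (==-refl (ty u)) (==-refl (χ u))

  0<Z : 0 < Z
  0<Z = subst (0 <_) (sym Z≡) (s≤s z≤n)

  lab<Z : ∀ u → lab u < Z
  lab<Z u with cls u <ᵇ Z in e
  ... | true  = <-trans (rank-< (cl u) {u} (cl-refl u)) (≤ᵇ-true⁻¹ e)
  ... | false = 0<Z

  t : Fin N → Fin T
  t u = mkType (ty u) (χ u) (fromℕ< (lab<Z u))

  kind-t : ∀ u → kind (t u) ≡ ty u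
  kind-t u = kind-mkType (ty u) (χ u) _

  cl-same : ∀ {u v} → cl u v ≡ true → ∀ w → cl v w ≡ cl u w
  cl-same {u} {v} h w = cong₂ (λ a b → (ty w == a) ∧ (χ w == b)) (==⇒≡ (∧-trueˡ h)) (==⇒≡ (∧-trueʳ {ty v == ty u} h))

  t-cl : ∀ {u v} → t v ≡ t u → (cl u v ≡ true) × (lab v ≡ lab u)
  t-cl {u} {v} e with mkType-injective e
  ... | a , b , c = ∧-true (≡⇒== a) (≡⇒== b) , trans (sym (FP.toℕ-fromℕ< (lab<Z v))) (trans (cong toℕ c) (FP.toℕ-fromℕ< (lab<Z u)))

  size# : Fin T → ℕ
  size# τ = countᶠ (λ v → t v == τ)

  populated : ∀ u → (size# (t u) ≡ 1) ⊎ (Z ≤ size# (t u))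
  populated u = [ inj₁ ∘ king , inj₂ ∘ big ]′ (≡-dec (cls u <ᵇ Z))
    where
    lab-in : ∀ {b} → (cls u <ᵇ Z) ≡ b → ∀ v → cl u v ≡ true → lab v ≡ (if b then rank (cl u) v else 0)
    lab-in {b} small v h = trans (cong (λ c → if c <ᵇ Z then rank (cl v) v else 0) (count-cong (cl-same h)))
      (trans (cong (λ c → if c then rank (cl v) v else 0) small) (cong (λ x → if b then x else 0) (rank-cong (cl-same h) v)))
    king : (cls u <ᵇ Z) ≡ true → size# (t u) ≡ 1
    king small = ≤-antisym (count-≤1 unique) (count-≥1 {p = λ v → t v == t u} u (==-refl (t u)))
      where
      unique : ∀ {v w} → (t v == t u) ≡ true → (t w == t u) ≡ true → v ≡ w
      unique {v} {w} p q with t-cl (==⇒≡ {i = t v} {t u} p) | t-cl (==⇒≡ {i = t w} {t u} q)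
      ... | a , b | c , d = rank-injective (cl u) a c (trans (sym (lab-in small v a)) (trans b (trans (sym d) (lab-in small w c))))
    big : (cls u <ᵇ Z) ≡ false → Z ≤ size# (t u)
    big small = ≤-trans (≤-pred (≤ᵇ-false⁻¹ {suc (cls u)} {Z} small)) (count-mono same)
      where
      same : ∀ v → cl u v ≡ true → (t v == t u) ≡ true
      same v h = ≡⇒== (trans (cong₂ (λ a b → mkType a b (fromℕ< (lab<Z v))) (==⇒≡ (∧-trueˡ h)) (==⇒≡ (∧-trueʳ {ty v == ty u} h)))
        (cong (mkType (ty u) (χ u)) (FP.fromℕ<-cong _ _ (trans (lab-in small v h) (sym (lab-in small u (cl-refl u)))) (lab<Z v) (lab<Z u))))

  populations : ∀ τ → (size# τ ≡ 0) ⊎ (size# τ ≡ 1) ⊎ (Z ≤ size# τ)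
  populations τ with size# τ ≟ 0
  ... | yes z = inj₁ z
  ... | no nz with count-witness {p = λ v → t v == τ} (n≢0⇒n>0 nz)
  ... | u , hu = inj₂ (subst (λ τ → (size# τ ≡ 1) ⊎ (Z ≤ size# τ)) (==⇒≡ hu) (populated u))

  χ≢ : ∀ {u v} → χ u ≢ χ v → t u ≢ t v
  χ≢ ne e = ne (proj₁ (proj₂ (mkType-injective e)))

  Mut-types : ∀ {u v} → Mut u v ≡ true → t u ≢ t v
  Mut-types {u} {v} m = χ≢ (proj₂ coloured (Out-≢ (∧-trueˡ m)) (∨-trueˡ _ m) (∨-trueˡ _ (Mut-sym m)))

  -- Two partners of `u` are joined in `E` through `u`, so equal types would contradict the
  -- colouring.
  Mut-partners : ∀ {u v w} → Mut u v ≡ true → Mut u w ≡ true → t v ≡ t w → v ≡ w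
  Mut-partners {u} {v} {w} p q e with v F.≟ w
  ... | yes eq = eq
  ... | no ne = ⊥-elim (χ≢ (proj₂ coloured ne (via p q) (via q p)) e)
    where
    via : ∀ {v w} → Mut u v ≡ true → Mut u w ≡ true → E v w ≡ true
    via {v} {w} p q = ∨-trueʳ (Mut v w) (anyᶠ-intro _ u (∧-true (Mut-sym p) q))

-- The profiles occurring in a model and their linear conditions

module Profiles (Sg : Signature) {N : ℕ} (M : Abstract.Model Sg N) where
  open Abstract Sg
  open Model M
  open Labelling Sg M

  kgT : Fin T → Bool
  kgT τ = size# τ ≡ᵇ 1

  kg : Fin N → Bool
  kg u = kgT (t u)

  kg-size : ∀ {τ} → kgT τ ≡ true → size# τ ≡ 1
  kg-size h = ≡ᵇ-true⁻¹ h

  size-kg : ∀ {τ} → size# τ ≡ 1 → kgT τ ≡ true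
  size-kg h = ≡ᵇ-true h

  king-unique : ∀ {u v} → kg u ≡ true → t v ≡ t u → v ≡ u
  king-unique {u} h e = count-unique {p = λ w → t w == t u} (≤-reflexive (kg-size h)) (≡⇒== e) (==-refl (t u))

  big : ∀ u → kg u ≡ false → Z ≤ size# (t u)
  big u h = [ (λ one → ⊥-elim (true≢false (size-kg one) h)) , id ]′ (populated u)

  -- A king records links to other kings only, since common elements record theirs towards it.
  -- Reliance on or by a king is thus covered by links, and sending concerns common elements alone.
  lnk snd : Fin N → Fin N → Bool
  lnk u v = not (u == v) ∧ (kg v ∨ (not (kg u) ∧ Mut u v))
  snd u v = (not (kg u) ∧ not (kg v)) ∧ (Out u v ∧ not (Out v u))

  lnk-≢ : ∀ {u v} → lnk u v ≡ true → u ≢ v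
  lnk-≢ {u} {v} h e = true≢false (≡⇒== e) (not-true (∧-trueˡ h))

  lnk-elim : ∀ {u v} → lnk u v ≡ true → (kg v ≡ true) ⊎ (Mut u v ≡ true)
  lnk-elim {u} {v} h = [ inj₁ , (λ e → inj₂ (∧-trueʳ {not (kg u)} e)) ]′ (∨-true {kg v} (∧-trueʳ {not (u == v)} h))

  lnk-king : ∀ {u v} → u ≢ v → kg v ≡ true → lnk u v ≡ true
  lnk-king ne k = ∧-true (cong not (≢⇒== ne)) (∨-trueˡ _ k)

  qI : Fin N → Fin T → Fin N → Bool
  qI u τ v = (t v == τ) ∧ lnk u v

  qS : Fin N → Fin T → Fin N → Bool
  qS u τ v = (t v == τ) ∧ snd u v

  qO : Fin N → Fin T → Fin D → Fin N → Bool
  qO u τ j v = qS u τ v ∧ (rank (qS u τ) v ≡ᵇ toℕ j)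

  qI-unique : ∀ u τ → countᶠ (qI u τ) ≤ 1
  qI-unique u τ = count-≤1 uniq
    where
    uniq : ∀ {v w} → qI u τ v ≡ true → qI u τ w ≡ true → v ≡ w
    uniq {v} {w} p q with ==⇒≡ {i = t v} {τ} (∧-trueˡ p) | ==⇒≡ {i = t w} {τ} (∧-trueˡ q)
    ... | ev | ew with lnk-elim {u} {v} (∧-trueʳ {t v == τ} p) | lnk-elim {u} {w} (∧-trueʳ {t w == τ} q)
    ... | inj₁ k | _ = sym (king-unique k (trans ew (sym ev)))
    ... | inj₂ _ | inj₁ k = king-unique k (trans ev (sym ew))
    ... | inj₂ m | inj₂ m' = Mut-partners m m' (trans ev (sym ew))

  qO-unique : ∀ u τ j → countᶠ (qO u τ j) ≤ 1
  qO-unique u τ j = count-≤1 (λ {v} {w} p q → rank-injective (qS u τ) (∧-trueˡ p) (∧-trueˡ q)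
    (trans (≡ᵇ-true⁻¹ (∧-trueʳ {qS u τ v} p)) (sym (≡ᵇ-true⁻¹ (∧-trueʳ {qS u τ w} q)))))

  qS-count : ∀ u τ → countᶠ (qS u τ) ≤ D
  qS-count u τ = ≤-trans (count-mono {q = Out u} (λ v h → ∧-trueˡ (∧-trueʳ {not (kg u) ∧ not (kg v)} (∧-trueʳ {t v == τ} h)))) (Out-count u)

  tab : Fin N → Fin T → Fin (suc D) → Fin (suc C)
  tab u τ zero    = pick (qI u τ) (col u)
  tab u τ (suc j) = pick (qO u τ j) (col u)

  own : Fin N → Fin P
  own u = profile (t u) (tab u)

  tyP-own : ∀ u → tyP (own u) ≡ t u
  tyP-own u = tyP-profile (t u) (tab u)

  lk-own : ∀ u τ → lk (own u) τ ≡ pick (qI u τ) (col u)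
  lk-own u τ = slot-profile (t u) (tab u) τ zero

  so-own : ∀ u τ j → so (own u) τ j ≡ pick (qO u τ j) (col u)
  so-own u τ j = slot-profile (t u) (tab u) τ (suc j)

  Ψ∘ : Fin h → Fin N → Fin N → Bool
  Ψ∘ θ u v = Ψ θ (kind (t u)) (kind (t v)) (col u v)

  tst-≢ : ∀ θ {u v} → u ≢ v → tst θ u v ≡ Ψ∘ θ u v
  tst-≢ θ {u} {v} ne = trans (cong (λ b → if b then self θ (ty u) else Ψ θ (ty u) (ty v) (col u v)) (≢⇒== ne))
    (cong₂ (λ a b → Ψ θ a b (col u v)) (sym (kind-t u)) (sym (kind-t v)))

  -- A witness of a failing test is always among the first k θ ones.
  unsent-safe : ∀ {u v} → u ≢ v → Out u v ≡ false → sf (t u) (t v) (col u v) ≡ true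
  unsent-safe {u} {v} ne no-out = allᶠ-intro safe
    where
    safe : ∀ θ → β (kind (t u)) θ ∨ not (Ψ∘ θ u v) ≡ true
    safe θ with ≡-dec (β (kind (t u)) θ)
    ... | inj₁ b = ∨-trueˡ _ b
    ... | inj₂ b = ∨-trueʳ (β (kind (t u)) θ) (cong not (¬true (λ ψ → true≢false (sent ψ) no-out)))
      where
      few : countᶠ (tst θ u) < k θ
      few = ≤ᵇ-false⁻¹ {k θ} {countᶠ (tst θ u)} (trans (sym (cnt u θ)) (trans (cong (λ a → β a θ) (sym (kind-t u))) b))
      sent : Ψ∘ θ u v ≡ true → Out u v ≡ true
      sent ψ = ∧-true (cong not (≢⇒== ne)) (anyᶠ-intro _ θ (∧-true tv (≤ᵇ-true (<-trans (rank-< (tst θ u) tv) few))))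
        where
        tv : tst θ u v ≡ true
        tv = trans (tst-≢ θ ne) ψ

  sub : Fin h → Fin N → Fin N → Bool
  sub θ u v = tst θ u v ∧ ((u == v) ∨ (lnk u v ∨ snd u v))

  -- Whatever a common element relies upon is itself, a king, a partner or an element that does not
  -- rely on it in return; the last are sent to, kings and partners are linked.
  wit-sub : ∀ θ u v → kg u ≡ false → wit θ u v ≡ true → sub θ u v ≡ true
  wit-sub θ u v ku w = ∧-true (∧-trueˡ w) (cases (≡-dec (u == v)) (≡-dec (kg v)) (≡-dec (Out v u)))
    where
    out : u ≢ v → Out u v ≡ true
    out ne = ∧-true (cong not (≢⇒== ne)) (anyᶠ-intro _ θ w)
    cases : (u == v ≡ true) ⊎ (u == v ≡ false) → (kg v ≡ true) ⊎ (kg v ≡ false) → (Out v u ≡ true) ⊎ (Out v u ≡ false) →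
            (u == v) ∨ (lnk u v ∨ snd u v) ≡ true
    cases (inj₁ e) _ _ = ∨-trueˡ _ e
    cases (inj₂ e) (inj₁ kv) _ = ∨-trueʳ (u == v) (∨-trueˡ _ (lnk-king (==⇒≢ e) kv))
    cases (inj₂ e) (inj₂ kv) (inj₁ back) = ∨-trueʳ (u == v) (∨-trueˡ _ (∧-true (cong not e)
      (∨-trueʳ (kg v) (∧-true (cong not ku) (∧-true (out (==⇒≢ e)) back)))))
    cases (inj₂ e) (inj₂ kv) (inj₂ back) = ∨-trueʳ (u == v) (∨-trueʳ (lnk u v)
      (∧-true (∧-true (cong not ku) (cong not kv)) (∧-true (out (==⇒≢ e)) (cong not back))))

  snd-≢ : ∀ {u v} → snd u v ≡ true → u ≢ v
  snd-≢ {u} {v} h = Out-≢ (∧-trueˡ (∧-trueʳ {not (kg u) ∧ not (kg v)} h))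

  ¬lnk-snd : ∀ {u v} → lnk u v ≡ true → snd u v ≡ true → ⊥
  ¬lnk-snd {u} {v} l s with lnk-elim {u} {v} l
  ... | inj₁ kv = true≢false kv (not-true (∧-trueʳ {not (kg u)} (∧-trueˡ s)))
  ... | inj₂ m = true≢false (∧-trueʳ {Out u v} m) (not-true (∧-trueʳ {Out u v} (∧-trueʳ {not (kg u) ∧ not (kg v)} s)))

  count-sub : ∀ θ u → countᶠ (sub θ u) ≡ localSum θ (own u)
  count-sub θ u = begin
    countᶠ (sub θ u) ≡⟨ count-sum (sub θ u) ⟩
    sumᶠ (λ v → ι (sub θ u v)) ≡⟨ sum-cong split ⟩
    sumᶠ (λ v → a v + (b v + c v)) ≡⟨ sum-+ a (λ v → b v + c v) ⟩
    sumᶠ a + sumᶠ (λ v → b v + c v) ≡⟨ cong₂ _+_ (sum-δ u (λ _ → s₀)) (sum-+ b c) ⟩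
    s₀ + (sumᶠ b + sumᶠ c) ≡⟨ cong (s₀ +_) (cong₂ _+_ (count-fibres t b) (count-fibres t c)) ⟩
    s₀ + (sumᶠ (λ τ → sumᶠ (bτ τ)) + sumᶠ (λ τ → sumᶠ (cτ τ)))
      ≡⟨ cong (s₀ +_) (sym (sum-+ (λ τ → sumᶠ (bτ τ)) (λ τ → sumᶠ (cτ τ)))) ⟩
    s₀ + sumᶠ (λ τ → sumᶠ (bτ τ) + sumᶠ (cτ τ)) ≡⟨ cong₂ _+_ (cong (λ a → ι (self θ a)) (trans (sym (kind-t u)) (cong kind (sym (tyP-own u))))) (sum-cong (λ τ → cong₂ _+_ (links τ) (sends τ))) ⟩
    localSum θ (own u) ∎
    where
    open ≡-Reasoning
    s₀ : ℕ
    s₀ = ι (self θ (ty u))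
    a b c : Fin N → ℕ
    a v = if u == v then s₀ else 0
    b v = if lnk u v then ι (Ψ∘ θ u v) else 0
    c v = if snd u v then ι (Ψ∘ θ u v) else 0
    bτ cτ : Fin T → Fin N → ℕ
    bτ τ v = if t v == τ then b v else 0
    cτ τ v = if t v == τ then c v else 0
    g : Fin T → Fin C → ℕ
    g τ x = ι (Ψ θ (kind (t u)) (kind τ) x)
    split : ∀ v → ι (sub θ u v) ≡ a v + (b v + c v)
    split v = go (≡-dec (u == v)) (≡-dec (lnk u v)) (≡-dec (snd u v))
      where
      val' : ∀ {x y z w} → tst θ u v ≡ w → (u == v) ≡ x → lnk u v ≡ y → snd u v ≡ z →
             ι (w ∧ (x ∨ (y ∨ z))) ≡ (if x then s₀ else 0) + ((if y then ι (Ψ∘ θ u v) else 0) + (if z then ι (Ψ∘ θ u v) else 0)) →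
             ι (sub θ u v) ≡ a v + (b v + c v)
      val' refl refl refl refl e = e
      go : ((u == v) ≡ true) ⊎ ((u == v) ≡ false) → (lnk u v ≡ true) ⊎ (lnk u v ≡ false) → (snd u v ≡ true) ⊎ (snd u v ≡ false) →
           ι (sub θ u v) ≡ a v + (b v + c v)
      go (inj₁ e) (inj₁ l) _ = ⊥-elim (lnk-≢ {u} {v} l (==⇒≡ e))
      go (inj₁ e) (inj₂ l) (inj₁ s) = ⊥-elim (snd-≢ {u} {v} s (==⇒≡ e))
      go (inj₁ e) (inj₂ l) (inj₂ s) = val' (cong (λ b → if b then self θ (ty u) else Ψ θ (ty u) (ty v) (col u v)) e) e l s
        (trans (∧-identity (self θ (ty u))) (sym (+-identityʳ _)))
      go (inj₂ e) (inj₁ l) (inj₁ s) = ⊥-elim (¬lnk-snd {u} {v} l s)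
      go (inj₂ e) (inj₁ l) (inj₂ s) = val' (tst-≢ θ (==⇒≢ e)) e l s (trans (∧-identity (Ψ∘ θ u v)) (sym (+-identityʳ _)))
      go (inj₂ e) (inj₂ l) (inj₁ s) = val' (tst-≢ θ (==⇒≢ e)) e l s (∧-identity (Ψ∘ θ u v))
      go (inj₂ e) (inj₂ l) (inj₂ s) = val' (tst-≢ θ (==⇒≢ e)) e l s (and-false (Ψ∘ θ u v))
        where
        and-false : ∀ x → ι (x ∧ false) ≡ 0
        and-false true  = refl
        and-false false = refl
    nest : ∀ τ v (q : Bool) → (if t v == τ then (if q then ι (Ψ∘ θ u v) else 0) else 0) ≡ (if (t v == τ) ∧ q then g τ (col u v) else 0)
    nest τ v q with t v == τ in e
    ... | false = refl
    ... | true  = cong (λ z → if q then ι (Ψ θ (kind (t u)) (kind z) (col u v)) else 0) (==⇒≡ {i = t v} {τ} e)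
    at-val : ∀ τ {x y} → x ≡ y → opt (g τ) y ≡ val θ (tyP (own u)) τ x
    at-val τ {x} refl = cong (λ z → val θ z τ x) (sym (tyP-own u))
    links : ∀ τ → sumᶠ (bτ τ) ≡ val θ (tyP (own u)) τ (lk (own u) τ)
    links τ = trans (sum-cong (λ v → nest τ v (lnk u v))) (trans (sym (sum-pick (qI u τ) (col u) (g τ) (qI-unique u τ))) (at-val τ (lk-own u τ)))
    sends : ∀ τ → sumᶠ (cτ τ) ≡ sumᶠ (λ j → val θ (tyP (own u)) τ (so (own u) τ j))
    sends τ = begin
      sumᶠ (cτ τ) ≡⟨ sum-cong (λ v → nest τ v (snd u v)) ⟩
      sumᶠ (λ v → if qS u τ v then g τ (col u v) else 0) ≡⟨ sum-cong (λ v → sym (place v)) ⟩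
      sumᶠ (λ v → sumᶠ (λ j → if qO u τ j v then g τ (col u v) else 0)) ≡⟨ sum-swap {N} {D} (λ v j → if qO u τ j v then g τ (col u v) else 0) ⟩
      sumᶠ (λ j → sumᶠ (λ v → if qO u τ j v then g τ (col u v) else 0)) ≡⟨ sum-cong (λ j → trans (sym (sum-pick (qO u τ j) (col u) (g τ) (qO-unique u τ j))) (at-val τ (so-own u τ j))) ⟩
      sumᶠ (λ j → val θ (tyP (own u)) τ (so (own u) τ j)) ∎
      where
      place : ∀ v → sumᶠ (λ j → if qO u τ j v then g τ (col u v) else 0) ≡ (if qS u τ v then g τ (col u v) else 0)
      place v with qS u τ v in e
      ... | false = sum-0 {D} (λ _ → refl)
      ... | true = trans (sum-single {D} (λ j → if rank (qS u τ) v ≡ᵇ toℕ j then g τ (col u v) else 0) j₀ other)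
                         (cong (λ b → if b then g τ (col u v) else 0) (≡ᵇ-true {rank (qS u τ) v} (sym j₀≡)))
        where
        j< : rank (qS u τ) v < D
        j< = ≤-trans (rank-< (qS u τ) e) (qS-count u τ)
        j₀ : Fin D
        j₀ = fromℕ< j<
        j₀≡ : toℕ j₀ ≡ rank (qS u τ) v
        j₀≡ = FP.toℕ-fromℕ< j<
        other : ∀ j → j₀ ≢ j → (if rank (qS u τ) v ≡ᵇ toℕ j then g τ (col u v) else 0) ≡ 0
        other j ne = cong (λ b → if b then g τ (col u v) else 0) (¬true (λ h → ne (FP.toℕ-injective (trans j₀≡ (≡ᵇ-true⁻¹ {rank (qS u τ) v} h)))))

  -- The witnesses recorded in the table lie between the first `k θ` witnesses and all of them, so
  -- they reach the threshold exactly when all witnesses do.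
  local-correct : ∀ θ u → kg u ≡ false → β (ty u) θ ≡ (k θ ≤ᵇ localSum θ (own u))
  local-correct θ u ku = trans (cnt u θ) (bool-ext up down)
    where
    up : (k θ ≤ᵇ countᶠ (tst θ u)) ≡ true → (k θ ≤ᵇ localSum θ (own u)) ≡ true
    up h = ≤ᵇ-true {k θ} {localSum θ (own u)} (≤-trans (proj₁ (count-first (tst θ u) (k θ)) (≤ᵇ-true⁻¹ {k θ} {countᶠ (tst θ u)} h))
      (≤-trans (count-mono (λ v → wit-sub θ u v ku)) (≤-reflexive (count-sub θ u))))
    down : (k θ ≤ᵇ localSum θ (own u)) ≡ true → (k θ ≤ᵇ countᶠ (tst θ u)) ≡ true
    down h = ≤ᵇ-true {k θ} {countᶠ (tst θ u)} (≤-trans (≤ᵇ-true⁻¹ {k θ} {localSum θ (own u)} h)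
      (≤-trans (≤-reflexive (sym (count-sub θ u))) (count-mono {p = sub θ u} {q = tst θ u} (λ v → ∧-trueˡ))))

  pick-I : ∀ u τ {c} → lk (own u) τ ≡ suc c → Σ (Fin N) λ v → (t v ≡ τ) × (lnk u v ≡ true) × (col u v ≡ c)
  pick-I u τ e with pick-suc (qI u τ) (col u) (trans (sym (lk-own u τ)) e)
  ... | v , q , ec = v , ==⇒≡ (∧-trueˡ q) , ∧-trueʳ {t v == τ} q , ec

  pick-O : ∀ u τ j {c} → so (own u) τ j ≡ suc c → Σ (Fin N) λ v → (t v ≡ τ) × (snd u v ≡ true) × (col u v ≡ c)
  pick-O u τ j e with pick-suc (qO u τ j) (col u) (trans (sym (so-own u τ j)) e)
  ... | v , q , ec = v , ==⇒≡ (∧-trueˡ (∧-trueˡ {qS u τ v} q)) , ∧-trueʳ {t v == τ} (∧-trueˡ {qS u τ v} q) , ec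

  no-self-link : ∀ u → lk (own u) (t u) ≡ zero
  no-self-link u = go (lk (own u) (t u)) refl
    where
    go : ∀ x → lk (own u) (t u) ≡ x → lk (own u) (t u) ≡ zero
    go zero    e = e
    go (suc c) e with pick-I u (t u) e
    ... | v , tv , l , _ with lnk-elim {u} {v} l
    ... | inj₁ kv = ⊥-elim (lnk-≢ {u} {v} l (king-unique kv (sym tv)))
    ... | inj₂ m = ⊥-elim (Mut-types m (sym tv))

  sent-safe : ∀ u τ j → optAll (λ c → sf τ (t u) (inv c)) (so (own u) τ j) ≡ true
  sent-safe u τ j = go (so (own u) τ j) refl
    where
    go : ∀ x → so (own u) τ j ≡ x → optAll (λ c → sf τ (t u) (inv c)) x ≡ true
    go zero    e = refl
    go (suc c) e with pick-O u τ j e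
    ... | v , refl , s , refl = trans (cong (sf (t v) (t u)) (sym (col-inv ne))) (unsent-safe (ne ∘ sym) (not-true (∧-trueʳ {Out u v} (∧-trueʳ {not (kg u) ∧ not (kg v)} s))))
      where
      ne : u ≢ v
      ne = snd-≢ {u} {v} s

  sent-big : ∀ u τ j → so (own u) τ j ≡ zero ⊎ Z ≤ size# τ
  sent-big u τ j = go (so (own u) τ j) refl
    where
    go : ∀ x → so (own u) τ j ≡ x → x ≡ zero ⊎ Z ≤ size# τ
    go zero    e = inj₁ refl
    go (suc c) e with pick-O u τ j e
    ... | v , refl , s , _ = inj₂ (big v (not-true (∧-trueʳ {not (kg u)} (∧-trueˡ s))))

  king-link : ∀ u v → kg v ≡ true → u ≢ v → lk (own u) (t v) ≡ suc (col u v)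
  king-link u v kv ne = trans (lk-own u (t v)) (pick-hit (qI u (t v)) (col u) (qI-unique u (t v)) (∧-true (==-refl (t v)) (lnk-king ne kv)))

  LinkSym : Fin T → Fin T → Set
  LinkSym τ τ' = ∀ u v → t u ≡ τ → t v ≡ τ' → lnk u v ≡ lnk v u

  link-sum : ∀ τ τ' c → countᶠ (λ u → (t u == τ) ∧ (lk (own u) τ' == suc c)) ≡
             sumᶠ (λ u → sumᶠ (λ v → ι ((t u == τ) ∧ ((t v == τ') ∧ lnk u v) ∧ (col u v == c))))
  link-sum τ τ' c = trans (count-sum (λ u → (t u == τ) ∧ (lk (own u) τ' == suc c))) (sum-cong row)
    where
    suc== : ∀ (x : Fin (suc C)) → ι (x == suc c) ≡ opt (λ c' → ι (c' == c)) x
    suc== zero     = cong ι (≢⇒== (λ ()))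
    suc== (suc c') = cong ι (bool-ext (λ e → ≡⇒== (FP.suc-injective (==⇒≡ e))) (λ e → ≡⇒== (cong suc (==⇒≡ e))))
    row : ∀ u → ι ((t u == τ) ∧ (lk (own u) τ' == suc c)) ≡ sumᶠ (λ v → ι ((t u == τ) ∧ ((t v == τ') ∧ lnk u v) ∧ (col u v == c)))
    row u with t u == τ
    ... | false = sym (sum-0 {N} (λ _ → refl))
    ... | true = trans (suc== (lk (own u) τ')) (trans (cong (opt (λ c' → ι (c' == c))) (lk-own u τ'))
        (trans (sum-pick (qI u τ') (col u) (λ c' → ι (c' == c)) (qI-unique u τ')) (sum-cong (λ v → sym (ι-∧ (qI u τ' v) (col u v == c))))))

  -- Double counting: both numbers are sums over the same linked pairs, with the colour read in
  -- opposite directions.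
  link-balance : ∀ τ τ' c → LinkSym τ τ' →
    countᶠ (λ u → (t u == τ) ∧ (lk (own u) τ' == suc c)) ≡ countᶠ (λ v → (t v == τ') ∧ (lk (own v) τ == suc (inv c)))
  link-balance τ τ' c ls = trans (link-sum τ τ' c) (trans (sum-swap {N} {N} _) (trans (sum-cong (λ v → sum-cong (λ u → cong ι (bool-ext (to u v) (from u v))))) (sym (link-sum τ' τ (inv c)))))
    where
    to : ∀ u v → (t u == τ) ∧ ((t v == τ') ∧ lnk u v) ∧ (col u v == c) ≡ true → (t v == τ') ∧ ((t u == τ) ∧ lnk v u) ∧ (col v u == inv c) ≡ true
    to u v h = ∧-true tv (∧-true (∧-true tu (trans (sym (ls u v (==⇒≡ tu) (==⇒≡ tv))) l)) (≡⇒== (trans (col-inv (lnk-≢ {u} {v} l)) (cong inv (==⇒≡ (∧-trueʳ {(t v == τ') ∧ lnk u v} h'))))))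
      where
      tu = ∧-trueˡ {t u == τ} h
      h' = ∧-trueʳ {t u == τ} h
      tv = ∧-trueˡ {t v == τ'} (∧-trueˡ {(t v == τ') ∧ lnk u v} h')
      l = ∧-trueʳ {t v == τ'} (∧-trueˡ {(t v == τ') ∧ lnk u v} h')
    from : ∀ u v → (t v == τ') ∧ ((t u == τ) ∧ lnk v u) ∧ (col v u == inv c) ≡ true → (t u == τ) ∧ ((t v == τ') ∧ lnk u v) ∧ (col u v == c) ≡ true
    from u v h = ∧-true tu (∧-true (∧-true tv (trans (ls u v (==⇒≡ tu) (==⇒≡ tv)) l))
        (≡⇒== (trans (col-inv (lnk-≢ {v} {u} l)) (trans (cong inv (==⇒≡ (∧-trueʳ {(t u == τ) ∧ lnk v u} h'))) (inv-inv c)))))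
      where
      tv = ∧-trueˡ {t v == τ'} h
      h' = ∧-trueʳ {t v == τ'} h
      tu = ∧-trueˡ {t u == τ} (∧-trueˡ {(t u == τ) ∧ lnk v u} h')
      l = ∧-trueʳ {t u == τ} (∧-trueˡ {(t u == τ) ∧ lnk v u} h')

  link-sym : ∀ {u v} → kg u ≡ kg v → lnk u v ≡ lnk v u
  link-sym {u} {v} e = cong₂ _∧_ (cong not (==-sym u v)) (trans (cong (λ b → kg v ∨ (not b ∧ Mut u v)) e)
    (trans (cong (λ m → kg v ∨ (not (kg v) ∧ m)) (BP.∧-comm (Out u v) (Out v u))) (cong (λ b → b ∨ (not (kg v) ∧ Mut v u)) (sym e))))

  link-cases : ∀ τ τ' → ((size# τ ≡ 1) × Z ≤ size# τ') ⊎ (Z ≤ size# τ × (size# τ' ≡ 1)) ⊎ LinkSym τ τ'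
  link-cases τ τ' with populations τ | populations τ'
  ... | inj₁ z | _ = inj₂ (inj₂ (λ u v p q → ⊥-elim (true≢false (≡⇒== p) (count≡0 {p = λ w → t w == τ} z u))))
  ... | inj₂ _ | inj₁ z = inj₂ (inj₂ (λ u v p q → ⊥-elim (true≢false (≡⇒== q) (count≡0 {p = λ w → t w == τ'} z v))))
  ... | inj₂ (inj₁ a) | inj₂ (inj₂ b) = inj₁ (a , b)
  ... | inj₂ (inj₂ a) | inj₂ (inj₁ b) = inj₂ (inj₁ (a , b))
  ... | inj₂ (inj₁ a) | inj₂ (inj₁ b) = inj₂ (inj₂ (λ u v p q → link-sym (trans (trans (cong kgT p) (size-kg a)) (sym (trans (cong kgT q) (size-kg b))))))
  ... | inj₂ (inj₂ a) | inj₂ (inj₂ b) = inj₂ (inj₂ (λ u v p q → link-sym (trans (trans (cong kgT p) (large a)) (sym (trans (cong kgT q) (large b))))))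
    where
    large : ∀ {x} → Z ≤ x → (x ≡ᵇ 1) ≡ false
    large {x} z = ¬true (λ e → <⇒≱ (subst (_< Z) (sym (≡ᵇ-true⁻¹ e)) (subst (1 <_) (sym Z≡) (s≤s (≤-trans (s≤s z≤n) (m≤n+m _ D))))) z)

  count-king : ∀ θ u → kg u ≡ true → countᶠ (tst θ u) ≡ ι (self θ (kind (t u))) + countᶠ (λ v → kf θ (t u) (own v))
  count-king θ u ku = trans (count-sum (tst θ u)) (trans (sum-cong split)
      (trans (sum-+ a (λ v → ι (kf θ (t u) (own v)))) (cong₂ _+_ (trans (sum-δ u (λ _ → s₀)) (cong (λ z → ι (self θ z)) (sym (kind-t u)))) (sym (count-sum (λ v → kf θ (t u) (own v)))))))
    where
    s₀ : ℕ
    s₀ = ι (self θ (ty u))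
    a : Fin N → ℕ
    a v = if u == v then s₀ else 0
    kf-val : ∀ v {b x} → is (t u) (own v) ≡ b → lk (own v) (t u) ≡ x → kf θ (t u) (own v) ≡ not b ∧ optb (λ c → Ψ θ (kind (t u)) (kind (t v)) (inv c)) x
    kf-val v refl refl = cong (λ z → not (is (t u) (own v)) ∧ optb (λ c → Ψ θ (kind (t u)) (kind z) (inv c)) (lk (own v) (t u))) (tyP-own v)
    split : ∀ v → ι (tst θ u v) ≡ a v + ι (kf θ (t u) (own v))
    split v with u F.≟ v
    ... | yes refl = trans (cong (λ b → ι (if b then self θ (ty u) else Ψ θ (ty u) (ty u) (col u u))) (==-refl u))
        (sym (trans (cong₂ _+_ (cong (λ b → if b then s₀ else 0) (==-refl u)) (cong ι (kf-val u (≡⇒== (tyP-own u)) refl))) (+-identityʳ s₀)))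
    ... | no ne = trans (cong ι (trans (tst-≢ θ ne) (trans (cong (Ψ θ (kind (t u)) (kind (t v))) (col-inv (ne ∘ sym)))
          (sym (kf-val v (≢⇒== (λ e → ne (sym (king-unique ku (trans (sym (tyP-own v)) e))))) (king-link v u ku (ne ∘ sym)))))))
        (sym (cong (λ b → (if b then s₀ else 0) + ι (kf θ (t u) (own v))) (≢⇒== ne)))

  -- Between two large types the elements relied upon cannot cover all pairs.
  silent-pair : ∀ τ τ' → Z ≤ size# τ → Z ≤ size# τ' → Σ (Fin C) (Sil τ τ')
  silent-pair τ τ' zx zy with FP.any? (λ u → FP.any? (λ v → (((t u == τ) ∧ (t v == τ')) B.≟ true) ×-dec ((((u == v) ∨ (Out u v ∨ Out v u)) B.≟ false))))
  ... | yes (u , v , tt , none) = found (==⇒≡ (∧-trueˡ tt)) (==⇒≡ (∧-trueʳ {t u == τ} tt))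
    where
    ne : u ≢ v
    ne = ==⇒≢ (∨-falseˡ none)
    noo : Out u v ∨ Out v u ≡ false
    noo = ∨-falseʳ {u == v} none
    found : t u ≡ τ → t v ≡ τ' → Σ (Fin C) (Sil τ τ')
    found refl refl = col u v , unsent-safe ne (∨-falseˡ noo) ,
      trans (cong (sf (t v) (t u)) (sym (col-inv ne))) (unsent-safe (ne ∘ sym) (∨-falseʳ {Out u v} noo))
  ... | no covered = ⊥-elim (<⇒≱ lower upper)
    where
    x y e : ℕ
    x = size# τ
    y = size# τ'
    e = suc D
    a b : Fin N → ℕ
    a u = ι (t u == τ)
    b v = ι (t v == τ')
    pointwise : ∀ u v → a u * b v ≤ a u * ι (u == v) + (a u * ι (Out u v) + b v * ι (Out v u))
    pointwise u v with t u == τ in eu | t v == τ' in ev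
    ... | false | _     = z≤n
    ... | true  | false = z≤n
    ... | true  | true with (u == v) ∨ (Out u v ∨ Out v u) in ec
    ... | false = ⊥-elim (covered (u , v , ∧-true eu ev , ec))
    ... | true  = some (u == v) (Out u v) (Out v u) ec
      where
      some : ∀ p q r → p ∨ (q ∨ r) ≡ true → 1 ≤ 1 * ι p + (1 * ι q + 1 * ι r)
      some true  _     _     _ = s≤s z≤n
      some false true  _     _ = s≤s z≤n
      some false false true  _ = s≤s z≤n
    f₁ f₂ f₃ : Fin N → Fin N → ℕ
    f₁ u v = a u * ι (u == v)
    f₂ u v = a u * ι (Out u v)
    f₃ u v = b v * ι (Out v u)
    total : x * y ≤ x + (x * D + y * D)
    total = begin
      x * y ≡⟨ cong₂ _*_ (count-sum (λ u → t u == τ)) (count-sum (λ v → t v == τ')) ⟩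
      sumᶠ a * sumᶠ b ≡⟨ trans (*-comm (sumᶠ a) (sumᶠ b)) (sym (sum-* (sumᶠ b) a)) ⟩
      sumᶠ (λ u → sumᶠ b * a u) ≡⟨ sum-cong (λ u → trans (*-comm (sumᶠ b) (a u)) (sym (sum-* (a u) b))) ⟩
      sumᶠ (λ u → sumᶠ (λ v → a u * b v)) ≤⟨ sum-mono (λ u → sum-mono (pointwise u)) ⟩
      sumᶠ (λ u → sumᶠ (λ v → f₁ u v + (f₂ u v + f₃ u v))) ≡⟨ sum-cong (λ u → trans (sum-+ (f₁ u) (λ v → f₂ u v + f₃ u v)) (cong (sumᶠ (f₁ u) +_) (sum-+ (f₂ u) (f₃ u)))) ⟩
      sumᶠ (λ u → sumᶠ (f₁ u) + (sumᶠ (f₂ u) + sumᶠ (f₃ u))) ≡⟨ trans (sum-+ (λ u → sumᶠ (f₁ u)) (λ u → sumᶠ (f₂ u) + sumᶠ (f₃ u))) (cong (sumᶠ (λ u → sumᶠ (f₁ u)) +_) (sum-+ (λ u → sumᶠ (f₂ u)) (λ u → sumᶠ (f₃ u)))) ⟩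
      sumᶠ (λ u → sumᶠ (f₁ u)) + (sumᶠ (λ u → sumᶠ (f₂ u)) + sumᶠ (λ u → sumᶠ (f₃ u)))
        ≤⟨ +-mono-≤ (≤-reflexive s₁) (+-mono-≤ s₂ (≤-trans (≤-reflexive (sum-swap {N} {N} f₃)) s₃)) ⟩
      x + (x * D + y * D) ∎
      where
      open ≤-Reasoning
      s₁ : sumᶠ (λ u → sumᶠ (f₁ u)) ≡ x
      s₁ = trans (sum-cong (λ u → dot-δ (λ _ → a u) u)) (sym (count-sum (λ u → t u == τ)))
      bounded : ∀ (w : Fin N → ℕ) → sumᶠ (λ u → sumᶠ (λ v → w u * ι (Out u v))) ≤ sumᶠ w * D
      bounded w = ≤-trans (sum-mono (λ u → ≤-trans (≤-reflexive (trans (sum-* (w u) (λ v → ι (Out u v))) (cong (w u *_) (sym (count-sum (Out u))))))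
          (*-monoʳ-≤ (w u) (Out-count u))))
        (≤-reflexive (trans (sum-cong (λ u → *-comm (w u) D)) (trans (sum-* D w) (*-comm D (sumᶠ w)))))
      s₂ : sumᶠ (λ u → sumᶠ (f₂ u)) ≤ x * D
      s₂ = ≤-trans (bounded a) (≤-reflexive (cong (_* D) (sym (count-sum (λ u → t u == τ)))))
      s₃ : sumᶠ (λ v → sumᶠ (λ u → f₃ u v)) ≤ y * D
      s₃ = ≤-trans (bounded b) (≤-reflexive (cong (_* D) (sym (count-sum (λ u → t u == τ')))))
    3e≤ : ∀ {z} → Z ≤ z → 3 * e ≤ z
    3e≤ {z} h = subst (_≤ z) Z≡ h
    -- Two copies of `x * y` are compared: one pays for `2 * (x * e)`, the other for `2 * (y * e)`.
    -- Either needs only two of the three `e` in `Z`, and the third gives strictness.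
    upper : x * y + x * y ≤ 2 * (x * e) + 2 * (y * e)
    upper = ≤-trans (+-mono-≤ le le) (≤-reflexive (trans (+-interchange (x * e) (y * e) (x * e) (y * e))
              (cong₂ _+_ (cong (x * e +_) (sym (+-identityʳ (x * e)))) (cong (y * e +_) (sym (+-identityʳ (y * e)))))))
      where
      le : x * y ≤ x * e + y * e
      le = ≤-trans total (≤-trans (≤-reflexive (trans (sym (+-assoc x (x * D) (y * D))) (cong (_+ y * D) (sym (*-suc x D))))) (+-monoʳ-≤ (x * e) (*-monoʳ-≤ y (n≤1+n D))))
    lower : 2 * (x * e) + 2 * (y * e) < x * y + x * y
    lower = +-mono-<-≤ strict weak
      where
      regroup : ∀ z → z * (3 * e) ≡ z * e + 2 * (z * e)
      regroup z = trans (cong (z *_) refl) (trans (*-distribˡ-+ z e (2 * e)) (cong (z * e +_) (trans (sym (*-assoc z 2 e)) (trans (cong (_* e) (*-comm z 2)) (*-assoc 2 z e)))))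
      x>0 : 1 ≤ x * e
      x>0 = *-mono-≤ (≤-trans (s≤s z≤n) (3e≤ zx)) (s≤s z≤n)
      strict : 2 * (x * e) < x * y
      strict = ≤-trans (+-monoˡ-≤ (2 * (x * e)) x>0) (≤-trans (≤-reflexive (sym (regroup x))) (*-monoʳ-≤ x (3e≤ zy)))
      weak : 2 * (y * e) ≤ x * y
      weak = ≤-trans (m≤n+m (2 * (y * e)) (y * e)) (≤-trans (≤-reflexive (sym (regroup y))) (≤-trans (*-monoʳ-≤ y (3e≤ zx)) (≤-reflexive (*-comm y x))))

  module _ (μ : (Fin P → Bool) → ℕ) (μ-own : ∀ f → μ f ≡ countᶠ (f ∘ own)) where
    open Conditions μ

    n≡ : ∀ τ → n τ ≡ size# τ
    n≡ τ = trans (μ-own (is τ)) (count-cong (λ u → cong (_== τ) (tyP-own u)))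

    each : ∀ {S : Fin P → Set} → (∀ u → S (own u)) → ∀ p → Absent p ⊎ S p
    each {S} s p with μ (λ q → q == p) ≟ 0
    ... | yes z = inj₁ z
    ... | no nz with count-witness {p = λ u → own u == p} (subst (1 ≤_) (μ-own (λ q → q == p)) (n≢0⇒n>0 nz))
    ... | u , e = inj₂ (subst S (==⇒≡ e) (s u))

    sel≡ : ∀ τ τ' c → μ (sel τ τ' c) ≡ countᶠ (λ u → (t u == τ) ∧ (lk (own u) τ' == suc c))
    sel≡ τ τ' c = trans (μ-own (sel τ τ' c)) (count-cong (λ u → cong (λ z → (z == τ) ∧ (lk (own u) τ' == suc c)) (tyP-own u)))

    cond : Cond
    cond = record
      { q0 = λ τ → subst (λ x → (x ≡ 0) ⊎ (x ≡ 1) ⊎ (Z ≤ x)) (sym (n≡ τ)) (populations τ)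
      ; q1 = each (λ u → trans (cong acc (trans (cong kind (tyP-own u)) (kind-t u))) (accepted u))
      ; q2 = each (λ u → trans (cong (lk (own u)) (tyP-own u)) (no-self-link u))
      ; q3 = λ p τ j → each {λ p → optAll (λ c → sf τ (tyP p) (inv c)) (so p τ j) ≡ true}
               (λ u → trans (cong (λ z → optAll (λ c → sf τ z (inv c)) (so (own u) τ j)) (tyP-own u)) (sent-safe u τ j)) p
      ; q4 = λ p θ → each {λ p → (n (tyP p) ≡ 1) ⊎ β (kind (tyP p)) θ ≡ (k θ ≤ᵇ localSum θ p)} (at-own θ) p
      ; q5 = at-king
      ; q6 = λ p τ j → each {λ p → so p τ j ≡ zero ⊎ Z ≤ n τ} (λ u → [ inj₁ , (λ z → inj₂ (subst (Z ≤_) (sym (n≡ τ)) z)) ]′ (sent-big u τ j)) p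
      ; q7 = at-pair
      ; q8 = at-silent
      ; q9 = at-king-count }
      where
      at-own : ∀ θ u → (n (tyP (own u)) ≡ 1) ⊎ β (kind (tyP (own u))) θ ≡ (k θ ≤ᵇ localSum θ (own u))
      at-own θ u with ≡-dec (kg u)
      ... | inj₁ ku = inj₁ (trans (n≡ (tyP (own u))) (trans (cong size# (tyP-own u)) (kg-size ku)))
      ... | inj₂ ku = inj₂ (trans (cong (λ z → β z θ) (trans (cong kind (tyP-own u)) (kind-t u))) (local-correct θ u ku))
      at-king : ∀ p τ → (Absent p ⊎ τ ≡ tyP p) ⊎ (¬ (n τ ≡ 1)) ⊎ lk p τ ≢ zero
      at-king p τ with each {λ p → (τ ≡ tyP p) ⊎ (¬ (n τ ≡ 1)) ⊎ lk p τ ≢ zero} go p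
        where
        go : ∀ u → (τ ≡ tyP (own u)) ⊎ (¬ (n τ ≡ 1)) ⊎ lk (own u) τ ≢ zero
        go u with size# τ ≟ 1
        ... | no n1 = inj₂ (inj₁ (λ e → n1 (trans (sym (n≡ τ)) e)))
        ... | yes one with count-witness {p = λ v → t v == τ} (≤-reflexive (sym one))
        ... | v , ev with ==⇒≡ {i = t v} {τ} ev | u F.≟ v
        ... | refl | yes refl = inj₁ (sym (tyP-own u))
        ... | refl | no ne = inj₂ (inj₂ (λ z → case trans (sym z) (king-link u v (size-kg one) ne) of λ ()))
      ... | inj₁ a = inj₁ (inj₁ a)
      ... | inj₂ (inj₁ e) = inj₁ (inj₂ e)
      ... | inj₂ (inj₂ r) = inj₂ r
      at-pair : ∀ τ τ' c → ((τ ≡ τ') ⊎ ((n τ ≡ 1) × Z ≤ n τ') ⊎ (Z ≤ n τ × (n τ' ≡ 1))) ⊎ μ (sel τ τ' c) ≡ μ (sel τ' τ (inv c))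
      at-pair τ τ' c with link-cases τ τ'
      ... | inj₁ (a , b) = inj₁ (inj₂ (inj₁ (trans (n≡ τ) a , subst (Z ≤_) (sym (n≡ τ')) b)))
      ... | inj₂ (inj₁ (a , b)) = inj₁ (inj₂ (inj₂ (subst (Z ≤_) (sym (n≡ τ)) a , trans (n≡ τ') b)))
      ... | inj₂ (inj₂ ls) = inj₂ (trans (sel≡ τ τ' c) (trans (link-balance τ τ' c ls) (sym (sel≡ τ' τ (inv c)))))
      small : ∀ {τ} → (size# τ ≡ 0) ⊎ (size# τ ≡ 1) → n τ ≤ 1
      small {τ} (inj₁ z) = ≤-trans (≤-reflexive (trans (n≡ τ) z)) z≤n
      small {τ} (inj₂ o) = ≤-reflexive (trans (n≡ τ) o)
      at-silent : ∀ τ τ' → (Σ (Fin C) (Sil τ τ')) ⊎ (n τ ≤ 1) ⊎ (n τ' ≤ 1)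
      at-silent τ τ' with populations τ | populations τ'
      ... | inj₁ z | _ = inj₂ (inj₁ (small (inj₁ z)))
      ... | inj₂ (inj₁ o) | _ = inj₂ (inj₁ (small (inj₂ o)))
      ... | inj₂ (inj₂ _) | inj₁ z = inj₂ (inj₂ (small (inj₁ z)))
      ... | inj₂ (inj₂ _) | inj₂ (inj₁ o) = inj₂ (inj₂ (small (inj₂ o)))
      ... | inj₂ (inj₂ a) | inj₂ (inj₂ b) = inj₁ (silent-pair τ τ' a b)
      at-king-count : ∀ τ θ → (¬ (n τ ≡ 1)) ⊎ ((β (kind τ) θ ≡ true) × k θ ≤ ι (self θ (kind τ)) + μ (kf θ τ))
                                             ⊎ ((β (kind τ) θ ≡ false) × ι (self θ (kind τ)) + μ (kf θ τ) + 1 ≤ k θ)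
      at-king-count τ θ with size# τ ≟ 1
      ... | no n1 = inj₁ (λ e → n1 (trans (sym (n≡ τ)) e))
      ... | yes one with count-witness {p = λ v → t v == τ} (≤-reflexive (sym one))
      ... | u , eu with ==⇒≡ {i = t u} {τ} eu
      ... | refl = inj₂ (go (≡-dec (β (kind (t u)) θ)))
        where
        βu : β (kind (t u)) θ ≡ (k θ ≤ᵇ countᶠ (tst θ u))
        βu = trans (cong (λ z → β z θ) (kind-t u)) (cnt u θ)
        total : countᶠ (tst θ u) ≡ ι (self θ (kind (t u))) + μ (kf θ (t u))
        total = trans (count-king θ u (size-kg one)) (cong (ι (self θ (kind (t u))) +_) (sym (μ-own (kf θ (t u)))))
        go : (β (kind (t u)) θ ≡ true) ⊎ (β (kind (t u)) θ ≡ false) →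
             ((β (kind (t u)) θ ≡ true) × k θ ≤ ι (self θ (kind (t u))) + μ (kf θ (t u)))
             ⊎ ((β (kind (t u)) θ ≡ false) × ι (self θ (kind (t u))) + μ (kf θ (t u)) + 1 ≤ k θ)
        go (inj₁ b) = inj₁ (b , subst (k θ ≤_) total (≤ᵇ-true⁻¹ {k θ} {countᶠ (tst θ u)} (trans (sym βu) b)))
        go (inj₂ b) = inj₂ (b , ≤-trans (≤-reflexive (trans (+-comm _ 1) (cong suc (sym total)))) (≤ᵇ-false⁻¹ {k θ} {countᶠ (tst θ u)} (trans (sym βu) b)))

-- The existential Presburger formula

-- Turns a solution into a domain: consecutive blocks, one per profile, whose lengths are the values
-- of the solution.
realise : ∀ {P} (x : Fin P → ℕ) → Σ ℕ λ N → Σ (Fin N → Fin P) λ own →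
          ∀ f → sumᶠ (λ p → if f p then x p else 0) ≡ countᶠ (f ∘ own)
realise {zero}  x = 0 , (λ ()) , λ f → refl
realise {suc P} x with realise (x ∘ suc)
... | N , own , h = x zero + N , own⁺ , λ f → sym (begin
    countᶠ (f ∘ own⁺) ≡⟨ count-sum (f ∘ own⁺) ⟩
    sumᶠ (λ u → ι (f (own⁺ u))) ≡⟨ sum-++ (x zero) (λ u → ι (f (own⁺ u))) ⟩
    sumᶠ (λ u → ι (f (own⁺ (u ↑ˡ N)))) + sumᶠ (λ u → ι (f (own⁺ (x zero ↑ʳ u))))
      ≡⟨ cong₂ _+_ (trans (sum-cong (λ u → cong (ι ∘ f ∘ [ (λ _ → zero) , suc ∘ own ]′) (FP.splitAt-↑ˡ (x zero) u N))) (sum-const {x zero} (ι (f zero))))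
                   (sum-cong (λ u → cong (ι ∘ f ∘ [ (λ _ → zero) , suc ∘ own ]′) (FP.splitAt-↑ʳ (x zero) N u))) ⟩
    x zero * ι (f zero) + sumᶠ (λ u → ι (f (suc (own u)))) ≡⟨ cong₂ _+_ (times (f zero)) (trans (sym (count-sum (f ∘ suc ∘ own))) (sym (h (f ∘ suc)))) ⟩
    (if f zero then x zero else 0) + sumᶠ (λ p → if f (suc p) then x (suc p) else 0) ∎)
  where
  open ≡-Reasoning
  own⁺ : Fin (x zero + N) → Fin (suc P)
  own⁺ u = [ (λ _ → zero) , suc ∘ own ]′ (splitAt (x zero) u)
  times : ∀ b → x zero * ι b ≡ (if b then x zero else 0)
  times true  = *-identityʳ (x zero)
  times false = *-zeroʳ (x zero)

fibre-sizes : ∀ {N P} (own : Fin N → Fin P) f →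
              sumᶠ (λ p → if f p then countᶠ (λ u → own u == p) else 0) ≡ countᶠ (f ∘ own)
fibre-sizes {N} own f = sym (trans (count-sum (f ∘ own)) (trans (count-fibres own (ι ∘ f ∘ own)) (sum-cong fibre)))
  where
  point : ∀ p u → (if own u == p then ι (f (own u)) else 0) ≡ (if f p then ι (own u == p) else 0)
  point p u with own u == p in e
  ... | true with ==⇒≡ {i = own u} {p} e
  ... | refl = refl
  point p u | false with f p
  ... | true  = refl
  ... | false = refl
  fibre : ∀ p → sumᶠ (λ u → if own u == p then ι (f (own u)) else 0) ≡ (if f p then countᶠ (λ u → own u == p) else 0)
  fibre p = trans (sum-cong (point p)) (pull (f p))
    where
    pull : ∀ b → sumᶠ (λ u → if b then ι (own u == p) else 0) ≡ (if b then countᶠ (λ u → own u == p) else 0)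
    pull true  = sym (count-sum (λ u → own u == p))
    pull false = sum-0 {N} (λ _ → refl)

-- The exponent found by the combinators of Reflected.
κ : ℕ
κ = 191

-- Only `class` distinguishes the two spectra: a single class of all types gives the size, one class
-- per 1-type gives the cardinality vector.
module Spectrum (Sg : Signature) (d : ℕ) (class : Fin (Signature.A Sg) → Fin d → Bool) where
  open Abstract Sg

  Counts : (Fin d → ℕ) → Set
  Counts v = Σ ℕ λ N → (1 ≤ N) × Σ (Model N) λ M → ∀ b → v b ≡ countᶠ (λ u → class (Model.ty M u) b)

  module Bounded (Y : ℕ) (4≤Y : 4 ≤ Y) (P≤Y : P ≤ Y) (T≤Y : T ≤ Y) (C≤Y : C ≤ Y) (D≤Y : D ≤ Y) (h≤Y : h ≤ Y) (d≤Y : d ≤ Y)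
                 (Z<Y : Z < Y) (k<Y : ∀ θ → k θ < Y) where
    open Reflected (d + P) Y 4≤Y

    e : Fin P → Fin (d + P)
    e p = d ↑ʳ p

    μ : Env → (Fin P → Bool) → ℕ
    μ ρ f = weighted e f ρ

    M : (f : Fin P → Bool) → Term 2 (λ ρ → μ ρ f)
    M f = weighted-term e f P≤Y

    K : ∀ c → c ≤ 3 → Term 1 (λ _ → c)
    K c h = constant c (≤-trans (s≤s h) 4≤Y)

    K0 : Term 1 (λ _ → 0)
    K0 = K 0 z≤n

    K1 : Term 1 (λ _ → 1)
    K1 = K 1 (s≤s z≤n)

    Kι : ∀ b → Term 1 (λ _ → ι b)
    Kι true  = K 1 (s≤s z≤n)
    Kι false = K 0 z≤n

    KZ : Term 1 (λ _ → Z)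
    KZ = constant Z Z<Y

    absent : ∀ p → Form 4 (λ ρ → Conditions.Absent (μ ρ) p)
    absent p = M (λ q → q == p) ≐ᶠ K0

    f0 : Form _ (λ ρ → Conditions.Q0 (μ ρ))
    f0 = all T≤Y (λ t → (M (is t) ≐ᶠ K0) ⊎ᶠ ((M (is t) ≐ᶠ K1) ⊎ᶠ (KZ ≼ᶠ M (is t))))

    f1 : Form _ (λ ρ → Conditions.Q1 (μ ρ))
    f1 = all P≤Y (λ p → absent p ⊎ᶠ decided (acc (kind (tyP p)) B.≟ true))

    f2 : Form _ (λ ρ → Conditions.Q2 (μ ρ))
    f2 = all P≤Y (λ p → absent p ⊎ᶠ decided (lk p (tyP p) F.≟ zero))

    f3 : Form _ (λ ρ → Conditions.Q3 (μ ρ))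
    f3 = all P≤Y (λ p → all T≤Y (λ t → all D≤Y (λ j → absent p ⊎ᶠ decided (optAll (λ c → sf t (tyP p) (inv c)) (so p t j) B.≟ true))))

    f4 : Form _ (λ ρ → Conditions.Q4 (μ ρ))
    f4 = all P≤Y (λ p → all h≤Y (λ θ → absent p ⊎ᶠ ((M (is (tyP p)) ≐ᶠ K1) ⊎ᶠ decided (β (kind (tyP p)) θ B.≟ (k θ ≤ᵇ localSum θ p)))))

    f5 : Form _ (λ ρ → Conditions.Q5 (μ ρ))
    f5 = all P≤Y (λ p → all T≤Y (λ t → (absent p ⊎ᶠ decided (t F.≟ tyP p)) ⊎ᶠ ((¬ᶠ (M (is t) ≐ᶠ K1)) ⊎ᶠ decided (¬? (lk p t F.≟ zero)))))

    f6 : Form _ (λ ρ → Conditions.Q6 (μ ρ))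
    f6 = all P≤Y (λ p → all T≤Y (λ t → all D≤Y (λ j → absent p ⊎ᶠ (decided (so p t j F.≟ zero) ⊎ᶠ (KZ ≼ᶠ M (is t))))))

    f7 : Form _ (λ ρ → Conditions.Q7 (μ ρ))
    f7 = all T≤Y (λ t → all T≤Y (λ t' → all C≤Y (λ c →
      (decided (t F.≟ t') ⊎ᶠ (((M (is t) ≐ᶠ K1) ×ᶠ (KZ ≼ᶠ M (is t'))) ⊎ᶠ ((KZ ≼ᶠ M (is t)) ×ᶠ (M (is t') ≐ᶠ K1))))
      ⊎ᶠ (M (sel t t' c) ≐ᶠ M (sel t' t (inv c))))))

    f8 : Form _ (λ ρ → Conditions.Q8 (μ ρ))
    f8 = all T≤Y (λ t → all T≤Y (λ t' → decided (Sil? t t') ⊎ᶠ ((M (is t) ≼ᶠ K1) ⊎ᶠ (M (is t') ≼ᶠ K1))))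

    f9 : Form _ (λ ρ → Conditions.Q9 (μ ρ))
    f9 = all T≤Y (λ t → all h≤Y (λ θ → (¬ᶠ (M (is t) ≐ᶠ K1)) ⊎ᶠ
      ((decided (β (kind t) θ B.≟ true) ×ᶠ (constant (k θ) (k<Y θ) ≼ᶠ (Kι (self θ (kind t)) ⊞ M (kf θ t))))
      ⊎ᶠ (decided (β (kind t) θ B.≟ false) ×ᶠ (((Kι (self θ (kind t)) ⊞ M (kf θ t)) ⊞ K1) ≼ᶠ constant (k θ) (k<Y θ))))))

    Total : Env → Set
    Total ρ = (Conditions.Cond (μ ρ)) × (∀ b → ρ (b ↑ˡ P) ≡ μ ρ (λ p → class (kind (tyP p)) b)) × (1 ≤ μ ρ (λ _ → true))

    variable-term : ∀ i → Term 0 (λ ρ → ρ i)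
    variable-term i = record { term = pvar i ; value = λ _ → refl ; tbound = ≤-refl }

    total : Form κ Total
    total = recast
      (((f0 ×ᶠ (f1 ×ᶠ (f2 ×ᶠ (f3 ×ᶠ f4)))) ×ᶠ (f5 ×ᶠ (f6 ×ᶠ (f7 ×ᶠ (f8 ×ᶠ f9))))) ×ᶠ
       ((all d≤Y (λ b → variable-term (b ↑ˡ P) ≐ᶠ M (λ p → class (kind (tyP p)) b))) ×ᶠ (K1 ≼ᶠ M (λ _ → true))))
      (λ ρ (((a0 , a1 , a2 , a3 , a4) , (a5 , a6 , a7 , a8 , a9)) , rest) →
         record { q0 = a0 ; q1 = a1 ; q2 = a2 ; q3 = a3 ; q4 = a4 ; q5 = a5 ; q6 = a6 ; q7 = a7 ; q8 = a8 ; q9 = a9 } , rest)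
      (λ ρ (c , rest) → let open Conditions.Cond c in ((q0 , q1 , q2 , q3 , q4) , (q5 , q6 , q7 , q8 , q9)) , rest)

    epa : EPA d
    epa = record { nb = P ; matrix = form total }

    epa-size : epaSize epa ≤ Y ^ suc κ
    epa-size = step κ (≤-trans (+-mono-≤ (≤-trans P≤Y (≤-trans (≤-reflexive (sym (^-identityʳ Y))) (^-monoʳ-≤ Y {1} {κ} (s≤s z≤n)))) (bound total))
                 (+-monoʳ-≤ (Y ^ κ) (m≤m+n (Y ^ κ) (Y ^ κ + (Y ^ κ + 0)))))

    μ-++ : ∀ (v : Fin d → ℕ) w f → μ (v ++ w) f ≡ sumᶠ (λ p → if f p then w p else 0)
    μ-++ v w f = sum-cong (λ p → cong (λ x → if f p then x else 0) (lookup-++ʳ v w p))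

    counts⇒epa : ∀ v → Counts v → Σ (Fin P → ℕ) λ w → ⟦ form total ⟧q (v ++ w) ≡ true
    counts⇒epa v (N , 1≤N , m , h) = w , compl total (v ++ w) (Profiles.cond Sg m (μ (v ++ w)) μ-own , classes , positive)
      where
      own : Fin N → Fin P
      own = Profiles.own Sg m
      w : Fin P → ℕ
      w p = countᶠ (λ u → own u == p)
      μ-own : ∀ f → μ (v ++ w) f ≡ countᶠ (f ∘ own)
      μ-own f = trans (μ-++ v w f) (fibre-sizes own f)
      kind-own : ∀ u → kind (tyP (own u)) ≡ Model.ty m u
      kind-own u = trans (cong kind (Profiles.tyP-own Sg m u)) (Labelling.kind-t Sg m u)
      classes : ∀ b → (v ++ w) (b ↑ˡ P) ≡ μ (v ++ w) (λ p → class (kind (tyP p)) b)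
      classes b = trans (lookup-++ˡ v w b) (trans (h b) (trans (count-cong (λ u → cong (λ a → class a b) (sym (kind-own u)))) (sym (μ-own (λ p → class (kind (tyP p)) b)))))
      positive : 1 ≤ μ (v ++ w) (λ _ → true)
      positive = subst (1 ≤_) (sym (trans (μ-own (λ _ → true)) (count-true {N}))) 1≤N

    epa⇒counts : ∀ v → (Σ (Fin P → ℕ) λ w → ⟦ form total ⟧q (v ++ w) ≡ true) → Counts v
    epa⇒counts v (w , h) with sound total (v ++ w) h | realise w
    ... | c , classes , positive | N , own , eq =
        N , subst (1 ≤_) (trans (μ-own (λ _ → true)) (count-true {N})) positive , Realisation.model Sg N own (μ (v ++ w)) μ-own c ,
        λ b → trans (sym (lookup-++ˡ v w b)) (trans (classes b) (μ-own (λ p → class (kind (tyP p)) b)))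
      where
      μ-own : ∀ f → μ (v ++ w) f ≡ countᶠ (f ∘ own)
      μ-own f = trans (μ-++ v w f) (eq f)

    epa-defines : Defines epa Counts
    epa-defines v = mk⇔ (counts⇒epa v) (epa⇒counts v)

-- C² sentences as tests on typed structures

H : ∀ {n m} → C2 n m → ℕ
H (U i v)      = 0
H (R j v w)    = 0
H (Eq v w)     = 0
H (Not φ)      = H φ
H (And φ ψ)    = H φ + H ψ
H (Or φ ψ)     = H φ + H ψ
H (ExGe k v φ) = suc (H φ)

threshold : ∀ {n m} (φ : C2 n m) → Fin (H φ) → ℕ
threshold (Not φ) θ = threshold φ θ
threshold (And φ ψ) θ = [ threshold φ , threshold ψ ]′ (splitAt (H φ) θ)
threshold (Or φ ψ) θ = [ threshold φ , threshold ψ ]′ (splitAt (H φ) θ)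
threshold (ExGe k v φ) zero = k
threshold (ExGe k v φ) (suc θ) = threshold φ θ

-- What a formula sees of an assignment: the unary and binary atoms, equality of x and y, and the
-- truth values of its counting subformulas (which depend on one variable only).
record View (n m h : ℕ) : Set where
  constructor view
  field
    un : Var → Fin n → Bool
    bin : Var → Var → Fin m → Bool
    eq : Bool
    th : Var → Fin h → Bool
open View

record _≈_ {n m h : ℕ} (V W : View n m h) : Set where
  constructor view≈
  field
    un≈ : ∀ v i → un V v i ≡ un W v i
    bin≈ : ∀ v w j → bin V v w j ≡ bin W v w j
    eq≈ : eq V ≡ eq W
    th≈ : ∀ v θ → th V v θ ≡ th W v θ
open _≈_

mapᵛ : ∀ {n m h h'} → (Fin h' → Fin h) → View n m h → View n m h'
mapᵛ f V = view (un V) (bin V) (eq V) (λ v θ → th V v (f θ))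

substᵛ : ∀ {n m h} → (Var → Var) → View n m h → View n m h
substᵛ r V = view (λ v → un V (r v)) (λ v w → bin V (r v) (r w)) (eq V) (λ v → th V (r v))

mapᵛ-cong : ∀ {n m h h'} (f : Fin h' → Fin h) {V W : View n m h} → V ≈ W → mapᵛ f V ≈ mapᵛ f W
mapᵛ-cong f e = view≈ (un≈ e) (bin≈ e) (eq≈ e) (λ v θ → th≈ e v (f θ))

substᵛ-cong : ∀ {n m h} (r : Var → Var) {V W : View n m h} → V ≈ W → substᵛ r V ≈ substᵛ r W
substᵛ-cong r e = view≈ (λ v → un≈ e (r v)) (λ v w → bin≈ e (r v) (r w)) (eq≈ e) (λ v → th≈ e (r v))

other : Var → Var
other vx = vy
other vy = vx

-- The bound variable of a counting subformula plays the role of vy, the free one that of vx.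
role : Var → Var → Var
role v w = if var≡ v w then vy else vx

-- Quantifiers disappear: a counting subformula is looked up at the variable that it leaves free, so
-- even nested tests remain conditions on single pairs.
holds : ∀ {n m} (φ : C2 n m) → View n m (H φ) → Bool
holds (U i v)      V = un V v i
holds (R j v w)    V = bin V v w j
holds (Eq v w)     V = var≡ v w ∨ eq V
holds (Not φ)      V = not (holds φ V)
holds (And φ ψ)    V = holds φ (mapᵛ (_↑ˡ H ψ) V) ∧ holds ψ (mapᵛ (H φ ↑ʳ_) V)
holds (Or φ ψ)     V = holds φ (mapᵛ (_↑ˡ H ψ) V) ∨ holds ψ (mapᵛ (H φ ↑ʳ_) V)
holds (ExGe k v φ) V = th V (other v) zero

test : ∀ {n m} (φ : C2 n m) → Fin (H φ) → View n m (H φ) → Bool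
test (Not φ) θ V = test φ θ V
test (And φ ψ) θ V = [ (λ θ → test φ θ (mapᵛ (_↑ˡ H ψ) V)) , (λ θ → test ψ θ (mapᵛ (H φ ↑ʳ_) V)) ]′ (splitAt (H φ) θ)
test (Or φ ψ) θ V = [ (λ θ → test φ θ (mapᵛ (_↑ˡ H ψ) V)) , (λ θ → test ψ θ (mapᵛ (H φ ↑ʳ_) V)) ]′ (splitAt (H φ) θ)
test (ExGe k v φ) zero V = holds φ (substᵛ (role v) (mapᵛ suc V))
test (ExGe k v φ) (suc θ) V = test φ θ (mapᵛ suc V)

holds-cong : ∀ {n m} (φ : C2 n m) {V W : View n m (H φ)} → V ≈ W → holds φ V ≡ holds φ W
holds-cong (U i v)      e = un≈ e v i
holds-cong (R j v w)    e = bin≈ e v w j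
holds-cong (Eq v w)     e = cong (var≡ v w ∨_) (eq≈ e)
holds-cong (Not φ)      e = cong not (holds-cong φ e)
holds-cong (And φ ψ)    e = cong₂ _∧_ (holds-cong φ (mapᵛ-cong _ e)) (holds-cong ψ (mapᵛ-cong _ e))
holds-cong (Or φ ψ)     e = cong₂ _∨_ (holds-cong φ (mapᵛ-cong _ e)) (holds-cong ψ (mapᵛ-cong _ e))
holds-cong (ExGe k v φ) e = th≈ e (other v) zero

test-cong : ∀ {n m} (φ : C2 n m) θ {V W : View n m (H φ)} → V ≈ W → test φ θ V ≡ test φ θ W
test-cong (Not φ) θ e = test-cong φ θ e
test-cong (And φ ψ) θ e with splitAt (H φ) θ
... | inj₁ θ₁ = test-cong φ θ₁ (mapᵛ-cong _ e)
... | inj₂ θ₂ = test-cong ψ θ₂ (mapᵛ-cong _ e)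
test-cong (Or φ ψ) θ e with splitAt (H φ) θ
... | inj₁ θ₁ = test-cong φ θ₁ (mapᵛ-cong _ e)
... | inj₂ θ₂ = test-cong ψ θ₂ (mapᵛ-cong _ e)
test-cong (ExGe k v φ) zero e = holds-cong φ (substᵛ-cong (role v) (mapᵛ-cong suc e))
test-cong (ExGe k v φ) (suc θ) e = test-cong φ θ (mapᵛ-cong suc e)

var-refl : ∀ v → var≡ v v ≡ true
var-refl vx = refl
var-refl vy = refl

eval-free : ∀ {n m N} (G : Structure n m N) (φ : C2 n m) {α α'} → (∀ v → free φ v ≡ true → α v ≡ α' v) → eval G α φ ≡ eval G α' φ
eval-free G (U i v)   h = cong (Uᴳ G i) (h v (var-refl v))
eval-free G (R j v w) h = cong₂ (Rᴳ G j) (h v (∨-trueˡ _ (var-refl v))) (h w (∨-trueʳ (var≡ v w) (var-refl w)))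
eval-free G (Eq v w)  h = cong₂ _≟ᶠ_ (h v (∨-trueˡ _ (var-refl v))) (h w (∨-trueʳ (var≡ v w) (var-refl w)))
eval-free G (Not φ)   h = cong not (eval-free G φ h)
eval-free G (And φ ψ) h = cong₂ _∧_ (eval-free G φ (λ v f → h v (∨-trueˡ _ f))) (eval-free G ψ (λ v f → h v (∨-trueʳ (free φ v) f)))
eval-free G (Or φ ψ)  h = cong₂ _∨_ (eval-free G φ (λ v f → h v (∨-trueˡ _ f))) (eval-free G ψ (λ v f → h v (∨-trueʳ (free φ v) f)))
eval-free G (ExGe k v φ) {α} {α'} h = cong (k ≤ᵇ_) (count-cong (λ e → eval-free G φ (agree e)))
  where
  agree : ∀ e w → free φ w ≡ true → update α v e w ≡ update α' v e w
  agree e w f with var≡ v w in q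
  ... | true  = refl
  ... | false = h w (∧-true (cong not q) f)

-- Evaluation through recorded truth values

module Semantics {n m N : ℕ} (G : Structure n m N) where

  Truth : C2 n m → Set
  Truth φ = Fin N → Fin (H φ) → Bool

  viewAt : ∀ {h} → (Fin N → Fin h → Bool) → (Var → Fin N) → View n m h
  viewAt τ α = view (λ v i → Uᴳ G i (α v)) (λ v w j → Rᴳ G j (α v) (α w)) (α vx ≟ᶠ α vy) (λ v → τ (α v))

  ⟨_,_⟩ : Fin N → Fin N → Var → Fin N
  ⟨ e , f ⟩ vx = e
  ⟨ e , f ⟩ vy = f

  -- The recorded values only have to be consistent with each other: each is the outcome of a test
  -- that consults the values of the subformulas below it. As tests are nested without cycles, this
  -- forces the true values.
  Good : (φ : C2 n m) → Truth φ → Set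
  Good φ τ = ∀ e θ → τ e θ ≡ (threshold φ θ ≤ᵇ countᶠ (λ f → test φ θ (viewAt τ ⟨ e , f ⟩)))

  Good-cong : ∀ φ {τ τ' : Truth φ} → (∀ e θ → τ e θ ≡ τ' e θ) → Good φ τ → Good φ τ'
  Good-cong φ h g e θ = trans (sym (h e θ)) (trans (g e θ) (cong (threshold φ θ ≤ᵇ_)
    (count-cong (λ f → test-cong φ θ (view≈ (λ _ _ → refl) (λ _ _ _ → refl) refl (λ v → h (⟨ e , f ⟩ v)))))))

  left : (φ ψ : C2 n m) → Truth (And φ ψ) → Truth φ
  left φ ψ τ e θ = τ e (θ ↑ˡ H ψ)

  right : (φ ψ : C2 n m) → Truth (And φ ψ) → Truth ψ
  right φ ψ τ e θ = τ e (H φ ↑ʳ θ)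

  ≟ᶠ-refl : (e : Fin N) → (e ≟ᶠ e) ≡ true
  ≟ᶠ-refl e = ≡ᵇ-true {toℕ e} refl

  ≟ᶠ-sym : (e f : Fin N) → (e ≟ᶠ f) ≡ (f ≟ᶠ e)
  ≟ᶠ-sym e f = bool-ext (λ h → ≡ᵇ-true {toℕ f} (sym (≡ᵇ-true⁻¹ {toℕ e} h))) (λ h → ≡ᵇ-true {toℕ e} (sym (≡ᵇ-true⁻¹ {toℕ f} h)))

  And-good : ∀ φ ψ {τ} → Good (And φ ψ) τ → Good φ (left φ ψ τ) × Good ψ (right φ ψ τ)
  And-good φ ψ {τ} g = (λ e θ → trans (g e (θ ↑ˡ H ψ)) (at e (θ ↑ˡ H ψ) (FP.splitAt-↑ˡ (H φ) θ (H ψ))))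
                     , (λ e θ → trans (g e (H φ ↑ʳ θ)) (at e (H φ ↑ʳ θ) (FP.splitAt-↑ʳ (H φ) (H ψ) θ)))
    where
    at : ∀ e θ {x} → splitAt (H φ) θ ≡ x → (threshold (And φ ψ) θ ≤ᵇ countᶠ (λ f → test (And φ ψ) θ (viewAt τ ⟨ e , f ⟩))) ≡
         ([ threshold φ , threshold ψ ]′ x ≤ᵇ countᶠ (λ f → [ (λ θ → test φ θ (viewAt (left φ ψ τ) ⟨ e , f ⟩)) , (λ θ → test ψ θ (viewAt (right φ ψ τ) ⟨ e , f ⟩)) ]′ x))
    at e θ refl = refl

  good-And : ∀ φ ψ {τ} → Good φ (left φ ψ τ) → Good ψ (right φ ψ τ) → Good (And φ ψ) τ
  good-And φ ψ {τ} g g' e θ with splitAt (H φ) θ in eq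
  ... | inj₁ θ₁ = trans (cong (τ e) (sym (FP.splitAt⁻¹-↑ˡ eq))) (g e θ₁)
  ... | inj₂ θ₂ = trans (cong (τ e) (sym (FP.splitAt⁻¹-↑ʳ eq))) (g' e θ₂)

  role-update : ∀ (α : Var → Fin N) v f w → update α v f w ≡ ⟨ α (other v) , f ⟩ (role v w)
  role-update α vx f vx = refl
  role-update α vx f vy = refl
  role-update α vy f vx = refl
  role-update α vy f vy = refl

  role-eq : ∀ v e f → (⟨ e , f ⟩ (role v vx) ≟ᶠ ⟨ e , f ⟩ (role v vy)) ≡ (e ≟ᶠ f)
  role-eq vx e f = ≟ᶠ-sym f e
  role-eq vy e f = refl

  viewAt-cong : ∀ {h} (τ : Fin N → Fin h → Bool) {α α' : Var → Fin N} → (∀ v → α v ≡ α' v) → viewAt τ α ≈ viewAt τ α'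
  viewAt-cong τ h = view≈ (λ v i → cong (Uᴳ G i) (h v)) (λ v w j → cong₂ (Rᴳ G j) (h v) (h w)) (cong₂ _≟ᶠ_ (h vx) (h vy)) (λ v θ → cong (λ e → τ e θ) (h v))

  viewAt-role : ∀ {h} (τ : Fin N → Fin h → Bool) v e f → viewAt τ (λ w → ⟨ e , f ⟩ (role v w)) ≈ substᵛ (role v) (viewAt τ ⟨ e , f ⟩)
  viewAt-role τ v e f = view≈ (λ _ _ → refl) (λ _ _ _ → refl) (role-eq v e f) (λ _ _ → refl)

  ≈-trans : ∀ {h} {V W W' : View n m h} → V ≈ W → W ≈ W' → V ≈ W'
  ≈-trans a b = view≈ (λ v i → trans (un≈ a v i) (un≈ b v i)) (λ v w j → trans (bin≈ a v w j) (bin≈ b v w j))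
    (trans (eq≈ a) (eq≈ b)) (λ v θ → trans (th≈ a v θ) (th≈ b v θ))

  -- Stated for every good `τ`, not just for `truth`, because a model supplies only the values
  -- claimed by its types.
  eval-holds : ∀ φ (τ : Truth φ) → Good φ τ → ∀ α → eval G α φ ≡ holds φ (viewAt τ α)
  eval-holds (U i v)   τ g α = refl
  eval-holds (R j v w) τ g α = refl
  eval-holds (Eq vx vx) τ g α = ≟ᶠ-refl (α vx)
  eval-holds (Eq vx vy) τ g α = refl
  eval-holds (Eq vy vx) τ g α = ≟ᶠ-sym (α vy) (α vx)
  eval-holds (Eq vy vy) τ g α = ≟ᶠ-refl (α vy)
  eval-holds (Not φ)   τ g α = cong not (eval-holds φ τ g α)
  eval-holds (And φ ψ) τ g α = cong₂ _∧_ (eval-holds φ _ (proj₁ (And-good φ ψ g)) α) (eval-holds ψ _ (proj₂ (And-good φ ψ g)) α)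
  eval-holds (Or φ ψ)  τ g α = cong₂ _∨_ (eval-holds φ _ (proj₁ (And-good φ ψ g)) α) (eval-holds ψ _ (proj₂ (And-good φ ψ g)) α)
  eval-holds (ExGe k v φ) τ g α = trans (cong (k ≤ᵇ_) (count-cong (λ f →
      trans (eval-holds φ τ⁻ (λ e θ → g e (suc θ)) (update α v f))
        (holds-cong φ (≈-trans (viewAt-cong τ⁻ (role-update α v f)) (viewAt-role τ⁻ v (α (other v)) f))))))
    (sym (g (α (other v)) zero))
    where
    τ⁻ : Truth φ
    τ⁻ e θ = τ e (suc θ)

  truth : (φ : C2 n m) → Truth φ
  truth (Not φ) e θ = truth φ e θ
  truth (And φ ψ) e θ = [ truth φ e , truth ψ e ]′ (splitAt (H φ) θ)
  truth (Or φ ψ) e θ = [ truth φ e , truth ψ e ]′ (splitAt (H φ) θ)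
  truth (ExGe k v φ) e zero = k ≤ᵇ countᶠ (λ f → eval G (λ w → ⟨ e , f ⟩ (role v w)) φ)
  truth (ExGe k v φ) e (suc θ) = truth φ e θ

  truth-And : ∀ φ ψ → Good φ (truth φ) → Good ψ (truth ψ) → Good (And φ ψ) (truth (And φ ψ))
  truth-And φ ψ g g' = good-And φ ψ
    (Good-cong φ (λ e θ → cong [ truth φ e , truth ψ e ]′ (sym (FP.splitAt-↑ˡ (H φ) θ (H ψ)))) g)
    (Good-cong ψ (λ e θ → cong [ truth φ e , truth ψ e ]′ (sym (FP.splitAt-↑ʳ (H φ) (H ψ) θ))) g')

  truth-good : ∀ φ → Good φ (truth φ)
  truth-good (Not φ) = truth-good φ
  truth-good (And φ ψ) = truth-And φ ψ (truth-good φ) (truth-good ψ)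
  truth-good (Or φ ψ) = truth-And φ ψ (truth-good φ) (truth-good ψ)
  truth-good (ExGe k v φ) e (suc θ) = truth-good φ e θ
  truth-good (ExGe k v φ) e zero = cong (k ≤ᵇ_) (count-cong (λ f →
    trans (eval-holds φ (truth φ) (truth-good φ) (λ w → ⟨ e , f ⟩ (role v w))) (holds-cong φ (viewAt-role (truth φ) v e f))))

-- Binary codes for sets of atoms and of tests

bits : ∀ {k} → Fin (2 ^ k) → Fin k → Bool
bits t i = bit (toℕ t) (toℕ i)

double : ℕ → ℕ
double zero    = zero
double (suc x) = suc (suc (double x))

bit-double : ∀ b x → bit (ι b + double x) 0 ≡ b
bit-double true  zero    = refl
bit-double false zero    = refl
bit-double true  (suc x) = bit-double true x
bit-double false (suc x) = bit-double false x

half-double : ∀ b x → ⌊ ι b + double x /2⌋ ≡ x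
half-double true  zero    = refl
half-double false zero    = refl
half-double true  (suc x) = cong suc (half-double true x)
half-double false (suc x) = cong suc (half-double false x)

double-half : ∀ t → ι (bit t 0) + double ⌊ t /2⌋ ≡ t
double-half zero          = refl
double-half (suc zero)    = refl
double-half (suc (suc t)) = trans (trans (+-suc (ι (bit t 0)) _) (cong suc (+-suc (ι (bit t 0)) _))) (cong (2 +_) (double-half t))

double≡ : ∀ x → double x ≡ 2 * x
double≡ zero    = refl
double≡ (suc x) = trans (cong (2 +_) (double≡ x)) (cong suc (sym (+-suc x (x + 0))))

double-mono : ∀ {x y} → x ≤ y → double x ≤ double y
double-mono z≤n     = z≤n
double-mono (s≤s h) = s≤s (s≤s (double-mono h))

encodeℕ : ∀ {k} → (Fin k → Bool) → ℕ
encodeℕ {zero}  f = 0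
encodeℕ {suc k} f = ι (f zero) + double (encodeℕ (f ∘ suc))

encodeℕ< : ∀ {k} (f : Fin k → Bool) → encodeℕ f < 2 ^ k
encodeℕ< {zero}  f = s≤s z≤n
encodeℕ< {suc k} f = ≤-trans (s≤s (+-monoˡ-≤ (double (encodeℕ (f ∘ suc))) (ι≤1 (f zero))))
    (≤-trans (double-mono (encodeℕ< (f ∘ suc))) (≤-reflexive (double≡ (2 ^ k))))

bit-encodeℕ : ∀ {k} (f : Fin k → Bool) i → bit (encodeℕ f) (toℕ i) ≡ f i
bit-encodeℕ f zero    = bit-double (f zero) (encodeℕ (f ∘ suc))
bit-encodeℕ f (suc i) = trans (cong (λ x → bit x (toℕ i)) (half-double (f zero) (encodeℕ (f ∘ suc)))) (bit-encodeℕ (f ∘ suc) i)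

half< : ∀ {t x} → t < double x → ⌊ t /2⌋ < x
half< {zero}        {suc x} h = s≤s z≤n
half< {suc zero}    {suc x} h = s≤s z≤n
half< {suc (suc t)} {suc x} (s≤s (s≤s h)) = s≤s (half< h)

bit-injective : ∀ k {t t'} → t < 2 ^ k → t' < 2 ^ k → (∀ (i : Fin k) → bit t (toℕ i) ≡ bit t' (toℕ i)) → t ≡ t'
bit-injective zero    (s≤s z≤n) (s≤s z≤n) h = refl
bit-injective (suc k) {t} {t'} l l' h = trans (sym (double-half t)) (trans (cong₂ (λ b x → ι b + double x) (h zero)
    (bit-injective k (half< (subst (t <_) (sym (double≡ (2 ^ k))) l)) (half< (subst (t' <_) (sym (double≡ (2 ^ k))) l')) (h ∘ suc))) (double-half t'))

encode : ∀ {k} → (Fin k → Bool) → Fin (2 ^ k)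
encode f = fromℕ< (encodeℕ< f)

bits-encode : ∀ {k} (f : Fin k → Bool) i → bits (encode f) i ≡ f i
bits-encode f i = trans (cong (λ x → bit x (toℕ i)) (FP.toℕ-fromℕ< (encodeℕ< f))) (bit-encodeℕ f i)

bits-injective : ∀ {k} {t t' : Fin (2 ^ k)} → (∀ i → bits t i ≡ bits t' i) → t ≡ t'
bits-injective {k} {t} {t'} h = FP.toℕ-injective (bit-injective k (FP.toℕ<n t) (FP.toℕ<n t') h)

hasType-bits : ∀ {n m N} (G : Structure n m N) e (t : Fin (2 ^ (n + m))) → hasType G e (toℕ t) ≡ true →
               (∀ i → Uᴳ G i e ≡ bits t (i ↑ˡ m)) × (∀ j → Rᴳ G j e e ≡ bits t (n ↑ʳ j))
hasType-bits {n} {m} G e t h =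
    (λ i → trans (beq-true (allᶠ-true (∧-trueˡ h) i)) (cong (bit (toℕ t)) (sym (FP.toℕ-↑ˡ i m))))
  , (λ j → trans (beq-true (allᶠ-true (∧-trueʳ {allᶠ (λ i → beq (Uᴳ G i e) (bit (toℕ t) (toℕ i)))} h) j)) (cong (bit (toℕ t)) (sym (FP.toℕ-↑ʳ n j))))

bits-hasType : ∀ {n m N} (G : Structure n m N) e (t : Fin (2 ^ (n + m))) →
               (∀ i → Uᴳ G i e ≡ bits t (i ↑ˡ m)) → (∀ j → Rᴳ G j e e ≡ bits t (n ↑ʳ j)) → hasType G e (toℕ t) ≡ true
bits-hasType {n} {m} G e t u r = ∧-true (allᶠ-intro (λ i → beq-refl (trans (u i) (cong (bit (toℕ t)) (FP.toℕ-↑ˡ i m)))))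
                                        (allᶠ-intro (λ j → beq-refl (trans (r j) (cong (bit (toℕ t)) (FP.toℕ-↑ʳ n j)))))

-- Structures as typed and coloured models

module Translation {n m : ℕ} (φ : C2 n m) where

  A C : ℕ
  A = 2 ^ (n + m) * 2 ^ H φ
  C = 2 ^ m * 2 ^ m

  abstract
    atoms : Fin A → Fin (2 ^ (n + m))
    atoms a = proj₁ (remQuot {2 ^ (n + m)} (2 ^ H φ) a)

    tests : Fin A → Fin (2 ^ H φ)
    tests a = proj₂ (remQuot {2 ^ (n + m)} (2 ^ H φ) a)

    mk : Fin (2 ^ (n + m)) → Fin (2 ^ H φ) → Fin A
    mk = combine

    atoms-mk : ∀ b τ → atoms (mk b τ) ≡ b
    atoms-mk b τ = cong proj₁ (FP.remQuot-combine {2 ^ (n + m)} {2 ^ H φ} b τ)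

    tests-mk : ∀ b τ → tests (mk b τ) ≡ τ
    tests-mk b τ = cong proj₂ (FP.remQuot-combine {2 ^ (n + m)} {2 ^ H φ} b τ)

    -- A colour lists the relations from the first to the second element and back.
    fw bw : Fin C → Fin (2 ^ m)
    fw c = proj₁ (remQuot {2 ^ m} (2 ^ m) c)
    bw c = proj₂ (remQuot {2 ^ m} (2 ^ m) c)

    edge : Fin (2 ^ m) → Fin (2 ^ m) → Fin C
    edge = combine

    fw-edge : ∀ a b → fw (edge a b) ≡ a
    fw-edge a b = cong proj₁ (FP.remQuot-combine {2 ^ m} {2 ^ m} a b)

    bw-edge : ∀ a b → bw (edge a b) ≡ b
    bw-edge a b = cong proj₂ (FP.remQuot-combine {2 ^ m} {2 ^ m} a b)

    edge-eta : ∀ c → edge (fw c) (bw c) ≡ c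
    edge-eta c = FP.combine-remQuot {2 ^ m} (2 ^ m) c

  flip : Fin C → Fin C
  flip c = edge (bw c) (fw c)

  un₁ : Fin A → Fin n → Bool
  un₁ a i = bits (atoms a) (i ↑ˡ m)

  loop : Fin A → Fin m → Bool
  loop a j = bits (atoms a) (n ↑ʳ j)

  th₁ : Fin A → Fin (H φ) → Bool
  th₁ a θ = bits (tests a) θ

  pairᵛ : Fin A → Fin A → Fin C → View n m (H φ)
  pairᵛ a a' c = view (λ { vx → un₁ a ; vy → un₁ a' })
    (λ { vx vx → loop a ; vx vy → bits (fw c) ; vy vx → bits (bw c) ; vy vy → loop a' }) false (λ { vx → th₁ a ; vy → th₁ a' })

  selfᵛ : Fin A → View n m (H φ)
  selfᵛ a = view (λ _ → un₁ a) (λ _ _ → loop a) true (λ _ → th₁ a)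

  signature : Signature
  signature = record
    { A = A ; C = C ; h = H φ ; c₀ = edge (encode {m} (λ _ → false)) (encode {m} (λ _ → false))
    ; inv = flip
    ; inv-inv = λ c → trans (cong₂ edge (bw-edge (bw c) (fw c)) (fw-edge (bw c) (fw c))) (edge-eta c)
    ; k = threshold φ
    ; Ψ = λ θ a a' c → test φ θ (pairᵛ a a' c)
    ; self = λ θ a → test φ θ (selfᵛ a)
    ; β = th₁
    -- A sentence has the same value under all assignments, so each element can check it with both
    -- variables placed on itself.
    ; acc = λ a → holds φ (selfᵛ a) }

  open Abstract signature using (Model)

  module _ {N : ℕ} (G : Structure n m N) (τ : Fin N → Fin (H φ) → Bool) (ty : Fin N → Fin A) (col : Fin N → Fin N → Fin C)
           (un-ok : ∀ i e → Uᴳ G i e ≡ un₁ (ty e) i) (loop-ok : ∀ j e → Rᴳ G j e e ≡ loop (ty e) j)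
           (fw-ok : ∀ j {u v} → u ≢ v → Rᴳ G j u v ≡ bits (fw (col u v)) j) (bw-ok : ∀ j {u v} → u ≢ v → Rᴳ G j v u ≡ bits (bw (col u v)) j)
           (th-ok : ∀ e θ → τ e θ ≡ th₁ (ty e) θ) where
    open Semantics G

    self-view : ∀ e → viewAt τ (λ _ → e) ≈ selfᵛ (ty e)
    self-view e = view≈ (λ _ i → un-ok i e) (λ _ _ j → loop-ok j e) (≟ᶠ-refl e) (λ _ → th-ok e)

    pair-view : ∀ {u v} → u ≢ v → viewAt τ ⟨ u , v ⟩ ≈ pairᵛ (ty u) (ty v) (col u v)
    pair-view {u} {v} ne = view≈ (λ { vx i → un-ok i u ; vy i → un-ok i v })
      (λ { vx vx j → loop-ok j u ; vx vy j → fw-ok j ne ; vy vx j → bw-ok j ne ; vy vy j → loop-ok j v })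
      (¬true (λ e → ne (FP.toℕ-injective (≡ᵇ-true⁻¹ e)))) (λ { vx → th-ok u ; vy → th-ok v })

    test-view : ∀ θ u v → test φ θ (viewAt τ ⟨ u , v ⟩) ≡ (if u == v then test φ θ (selfᵛ (ty u)) else test φ θ (pairᵛ (ty u) (ty v) (col u v)))
    test-view θ u v with u F.≟ v
    ... | no ne = trans (test-cong φ θ (pair-view ne)) (cong (λ b → if b then test φ θ (selfᵛ (ty u)) else test φ θ (pairᵛ (ty u) (ty v) (col u v))) (sym (≢⇒== ne)))
    ... | yes refl = trans (test-cong φ θ (≈-trans (viewAt-cong τ (λ { vx → refl ; vy → refl })) (self-view u)))
                       (cong (λ b → if b then test φ θ (selfᵛ (ty u)) else test φ θ (pairᵛ (ty u) (ty u) (col u u))) (sym (==-refl u)))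

    eval-acc : Good φ τ → ∀ e → eval G (λ _ → e) φ ≡ holds φ (selfᵛ (ty e))
    eval-acc g e = trans (eval-holds φ τ g (λ _ → e)) (holds-cong φ (self-view e))

  module _ (sentence : Sentence φ) where

    constant-assignment : ∀ {N} (G : Structure n m N) α e → eval G α φ ≡ eval G (λ _ → e) φ
    constant-assignment G α e = eval-free G φ (λ { vx f → ⊥-elim (true≢false f (proj₁ sentence)) ; vy f → ⊥-elim (true≢false f (proj₂ sentence)) })

    structure⇒model : ∀ {N} (G : Structure n m N) → G ⊨ φ → Σ (Model N) λ M → ∀ e t → hasType G e (toℕ t) ≡ (atoms (Model.ty M e) == t)
    structure⇒model {N} G sat = model , type-ok
      where
      open Semantics G
      basic : Fin N → Fin (2 ^ (n + m))
      basic e = encode (λ i → [ (λ i → Uᴳ G i e) , (λ j → Rᴳ G j e e) ]′ (splitAt n i))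
      ty : Fin N → Fin A
      ty e = mk (basic e) (encode (truth φ e))
      rel : Fin N → Fin N → Fin (2 ^ m)
      rel u v = encode (λ j → Rᴳ G j u v)
      col : Fin N → Fin N → Fin C
      col u v = edge (rel u v) (rel v u)
      basic-un : ∀ i e → bits (basic e) (i ↑ˡ m) ≡ Uᴳ G i e
      basic-un i e = trans (bits-encode _ (i ↑ˡ m)) (cong [ (λ i → Uᴳ G i e) , (λ j → Rᴳ G j e e) ]′ (FP.splitAt-↑ˡ n i m))
      basic-loop : ∀ j e → bits (basic e) (n ↑ʳ j) ≡ Rᴳ G j e e
      basic-loop j e = trans (bits-encode _ (n ↑ʳ j)) (cong [ (λ i → Uᴳ G i e) , (λ j → Rᴳ G j e e) ]′ (FP.splitAt-↑ʳ n m j))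
      un-ok : ∀ i e → Uᴳ G i e ≡ un₁ (ty e) i
      un-ok i e = trans (sym (basic-un i e)) (cong (λ b → bits b (i ↑ˡ m)) (sym (atoms-mk _ _)))
      loop-ok : ∀ j e → Rᴳ G j e e ≡ loop (ty e) j
      loop-ok j e = trans (sym (basic-loop j e)) (cong (λ b → bits b (n ↑ʳ j)) (sym (atoms-mk _ _)))
      fw-ok : ∀ j {u v} → u ≢ v → Rᴳ G j u v ≡ bits (fw (col u v)) j
      fw-ok j {u} {v} _ = trans (sym (bits-encode (λ j → Rᴳ G j u v) j)) (cong (λ b → bits b j) (sym (fw-edge (rel u v) (rel v u))))
      bw-ok : ∀ j {u v} → u ≢ v → Rᴳ G j v u ≡ bits (bw (col u v)) j
      bw-ok j {u} {v} _ = trans (sym (bits-encode (λ j → Rᴳ G j v u) j)) (cong (λ b → bits b j) (sym (bw-edge (rel u v) (rel v u))))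
      th-ok : ∀ e θ → truth φ e θ ≡ th₁ (ty e) θ
      th-ok e θ = trans (sym (bits-encode (truth φ e) θ)) (cong (λ b → bits b θ) (sym (tests-mk _ _)))
      model : Model N
      model = record
        { ty = ty ; col = col
        ; col-inv = λ {u} {v} _ → cong₂ edge (sym (bw-edge (rel u v) (rel v u))) (sym (fw-edge (rel u v) (rel v u)))
        ; cnt = λ u θ → trans (sym (th-ok u θ)) (trans (truth-good φ u θ) (cong (threshold φ θ ≤ᵇ_)
                  (count-cong (test-view G (truth φ) ty col un-ok loop-ok fw-ok bw-ok th-ok θ u))))
        ; accepted = λ e → trans (sym (eval-acc G (truth φ) ty col un-ok loop-ok fw-ok bw-ok th-ok (truth-good φ) e)) (sat (λ _ → e)) }
      type-ok : ∀ e t → hasType G e (toℕ t) ≡ (atoms (ty e) == t)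
      type-ok e t = bool-ext to from
        where
        to : hasType G e (toℕ t) ≡ true → (atoms (ty e) == t) ≡ true
        to h = ≡⇒== (trans (atoms-mk _ _) (bits-injective same))
          where
          ut = hasType-bits G e t h
          same : ∀ i → bits (basic e) i ≡ bits t i
          same i with splitAt n i in eq
          ... | inj₁ a = trans (cong (bits (basic e)) (sym (FP.splitAt⁻¹-↑ˡ eq))) (trans (trans (basic-un a e) (proj₁ ut a)) (cong (bits t) (FP.splitAt⁻¹-↑ˡ eq)))
          ... | inj₂ b = trans (cong (bits (basic e)) (sym (FP.splitAt⁻¹-↑ʳ eq))) (trans (trans (basic-loop b e) (proj₂ ut b)) (cong (bits t) (FP.splitAt⁻¹-↑ʳ eq)))
        from : (atoms (ty e) == t) ≡ true → hasType G e (toℕ t) ≡ true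
        from h with trans (sym (atoms-mk (basic e) (encode (truth φ e)))) (==⇒≡ h)
        ... | refl = bits-hasType G e (basic e) (λ i → sym (basic-un i e)) (λ j → sym (basic-loop j e))

    -- The types merely claim outcomes of tests; `cnt` makes the claims good, after which acceptance
    -- amounts to satisfaction of the sentence.
    model⇒structure : ∀ {N} (M : Model N) → Σ (Structure n m N) λ G → (G ⊨ φ) × (∀ e t → hasType G e (toℕ t) ≡ (atoms (Model.ty M e) == t))
    model⇒structure {N} M = G , sat , type-ok
      where
      open Model M
      G : Structure n m N
      G = record { Uᴳ = λ i e → un₁ (ty e) i ; Rᴳ = λ j u v → if u == v then loop (ty u) j else bits (fw (col u v)) j }
      loop-ok : ∀ j e → Rᴳ G j e e ≡ loop (ty e) j
      loop-ok j e = cong (λ b → if b then loop (ty e) j else bits (fw (col e e)) j) (==-refl e)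
      fw-ok : ∀ j {u v} → u ≢ v → Rᴳ G j u v ≡ bits (fw (col u v)) j
      fw-ok j {u} {v} ne = cong (λ b → if b then loop (ty u) j else bits (fw (col u v)) j) (≢⇒== ne)
      bw-ok : ∀ j {u v} → u ≢ v → Rᴳ G j v u ≡ bits (bw (col u v)) j
      bw-ok j {u} {v} ne = trans (fw-ok j (ne ∘ sym)) (cong (λ c → bits c j) (trans (cong fw (col-inv ne)) (fw-edge (bw (col u v)) (fw (col u v)))))
      τ : Fin N → Fin (H φ) → Bool
      τ e θ = th₁ (ty e) θ
      open Semantics G
      good : Good φ τ
      good e θ = trans (cnt e θ) (cong (threshold φ θ ≤ᵇ_) (count-cong (λ f → sym (test-view G τ ty col (λ _ _ → refl) loop-ok fw-ok bw-ok (λ _ _ → refl) θ e f))))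
      sat : G ⊨ φ
      sat α = trans (constant-assignment G α (α vx)) (trans (eval-acc G τ ty col (λ _ _ → refl) loop-ok fw-ok bw-ok (λ _ _ → refl) good (α vx)) (accepted (α vx)))
      type-ok : ∀ e t → hasType G e (toℕ t) ≡ (atoms (ty e) == t)
      type-ok e t = bool-ext to from
        where
        to : hasType G e (toℕ t) ≡ true → (atoms (ty e) == t) ≡ true
        to h = ≡⇒== (bits-injective same)
          where
          ut = hasType-bits G e t h
          same : ∀ i → bits (atoms (ty e)) i ≡ bits t i
          same i with splitAt n i in eq
          ... | inj₁ a = trans (cong (bits (atoms (ty e))) (sym (FP.splitAt⁻¹-↑ˡ eq))) (trans (proj₁ ut a) (cong (bits t) (FP.splitAt⁻¹-↑ˡ eq)))
          ... | inj₂ b = trans (cong (bits (atoms (ty e))) (sym (FP.splitAt⁻¹-↑ʳ eq))) (trans (trans (sym (loop-ok b e)) (proj₂ ut b)) (cong (bits t) (FP.splitAt⁻¹-↑ʳ eq)))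
        from : (atoms (ty e) == t) ≡ true → hasType G e (toℕ t) ≡ true
        from h with ==⇒≡ {i = atoms (ty e)} {t} h
        ... | refl = bits-hasType G e (atoms (ty e)) (λ i → refl) (λ j → loop-ok j e)

    module SpecCounts = Spectrum signature 1 (λ _ _ → true)
    module ΠCounts = Spectrum signature (2 ^ (n + m)) (λ a b → atoms a == b)

    spec⇔Counts : ∀ v → spec¹ φ v ⇔ SpecCounts.Counts v
    spec⇔Counts v = mk⇔
      (λ (1≤N , G , sat) → v zero , 1≤N , proj₁ (structure⇒model G sat) , λ { zero → sym (count-true {v zero}) })
      (λ (N , 1≤N , M , h) → subst (spec φ) (sym (trans (h zero) (count-true {N}))) (1≤N , proj₁ (model⇒structure M) , proj₁ (proj₂ (model⇒structure M))))

    Πspec⇔Counts : ∀ v → Πspec φ v ⇔ ΠCounts.Counts v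
    Πspec⇔Counts v = mk⇔
      (λ (N , 1≤N , G , sat , h) → let (M , ok) = structure⇒model G sat in
         N , 1≤N , M , λ t → trans (sym (h t)) (count-cong (λ e → ok e t)))
      (λ (N , 1≤N , M , h) → let (G , sat , ok) = model⇒structure M in
         N , 1≤N , G , sat , λ t → trans (count-cong (λ e → ok e t)) (sym (h t)))

-- Sizes

2^-double : ∀ a → 2 ^ a + 2 ^ a ≡ 2 ^ suc a
2^-double a = cong (2 ^ a +_) (sym (+-identityʳ (2 ^ a)))

2^-mono : ∀ {a b} → a ≤ b → 2 ^ a ≤ 2 ^ b
2^-mono = ^-monoʳ-≤ 2

2^-* : ∀ {x y} a b → x ≤ 2 ^ a → y ≤ 2 ^ b → x * y ≤ 2 ^ (a + b)
2^-* a b p q = ≤-trans (*-mono-≤ p q) (≤-reflexive (sym (^-distribˡ-+-* 2 a b)))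

2^-+ : ∀ {x y} a b → x ≤ 2 ^ a → y ≤ 2 ^ b → x + y ≤ 2 ^ suc (a + b)
2^-+ a b p q = ≤-trans (+-mono-≤ (≤-trans p (2^-mono (m≤m+n a b))) (≤-trans q (2^-mono (m≤n+m b a)))) (≤-reflexive (2^-double (a + b)))

<2^bitlen : ∀ k → suc k ≤ 2 ^ bitlen k
<2^bitlen = <-rec (λ k → suc k ≤ 2 ^ bitlen k) step
  where
  step : ∀ k → (∀ {j} → j < k → suc j ≤ 2 ^ bitlen j) → suc k ≤ 2 ^ bitlen k
  step zero rec = s≤s z≤n
  step (suc zero) rec = ≤-refl
  step (suc (suc k)) rec = begin
    suc (suc (suc k)) ≡⟨ cong (3 +_) (sym (double-half k)) ⟩
    3 + (ι (bit k 0) + double j) ≤⟨ +-monoʳ-≤ 3 (+-monoˡ-≤ (double j) (ι≤1 (bit k 0))) ⟩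
    double (suc (suc j)) ≤⟨ double-mono (rec {suc j} (s≤s (s≤s (⌊n/2⌋≤n k)))) ⟩
    double (2 ^ bitlen (suc j)) ≡⟨ double≡ (2 ^ bitlen (suc j)) ⟩
    2 ^ suc (bitlen (suc j)) ≡⟨ cong (2 ^_) (cong suc lg) ⟩
    2 ^ bitlen (suc (suc k)) ∎
    where
    open ≤-Reasoning
    j : ℕ
    j = ⌊ k /2⌋
    lg : suc ⌊log₂ suc j ⌋ ≡ ⌊log₂ suc (suc k) ⌋
    lg = trans (cong suc (⌊log₂⌊n/2⌋⌋≡⌊log₂n⌋∸1 (suc (suc k)))) (m+[n∸m]≡n {1} (⌊log₂⌋-mono-≤ {2} {suc (suc k)} (s≤s (s≤s z≤n))))

2≤size : ∀ {n m} (φ : C2 n m) → 2 ≤ size φ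
2≤size (U i v)      = ≤-refl
2≤size (R j v w)    = s≤s (s≤s z≤n)
2≤size (Eq v w)     = s≤s (s≤s z≤n)
2≤size (Not φ)      = ≤-trans (2≤size φ) (n≤1+n _)
2≤size (And φ ψ)    = ≤-trans (2≤size φ) (≤-trans (m≤m+n _ _) (n≤1+n _))
2≤size (Or φ ψ)     = ≤-trans (2≤size φ) (≤-trans (m≤m+n _ _) (n≤1+n _))
2≤size (ExGe k v φ) = s≤s (s≤s z≤n)

H≤size : ∀ {n m} (φ : C2 n m) → H φ ≤ size φ
H≤size (U i v)      = z≤n
H≤size (R j v w)    = z≤n
H≤size (Eq v w)     = z≤n
H≤size (Not φ)      = ≤-trans (H≤size φ) (n≤1+n _)
H≤size (And φ ψ)    = ≤-trans (+-mono-≤ (H≤size φ) (H≤size ψ)) (n≤1+n _)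
H≤size (Or φ ψ)     = ≤-trans (+-mono-≤ (H≤size φ) (H≤size ψ)) (n≤1+n _)
H≤size (ExGe k v φ) = s≤s (≤-trans (H≤size φ) (m≤n+m (size φ) (suc (bitlen k))))

-- Thresholds are written in binary, so their sum may be exponential in the length but no larger.
-- The symbol of a binary connective pays for the extra factor 2 in `2^-+`.
thresholds : ∀ {n m} (φ : C2 n m) → suc (sumᶠ (threshold φ)) ≤ 2 ^ size φ
thresholds-∧ : ∀ {n m} (φ ψ : C2 n m) → suc (sumᶠ (threshold (And φ ψ))) ≤ 2 ^ suc (size φ + size ψ)

thresholds (U i v)      = s≤s z≤n
thresholds (R j v w)    = s≤s z≤n
thresholds (Eq v w)     = s≤s z≤n
thresholds (Not φ)      = ≤-trans (thresholds φ) (2^-mono (n≤1+n (size φ)))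
thresholds (And φ ψ)    = thresholds-∧ φ ψ
thresholds (Or φ ψ)     = thresholds-∧ φ ψ
thresholds (ExGe k v φ) = ≤-trans (≤-trans (n≤1+n _) (≤-reflexive (cong suc (sym (+-suc k (sumᶠ (threshold φ)))))))
  (≤-trans (2^-+ (bitlen k) (size φ) (<2^bitlen k) (thresholds φ)) (2^-mono (n≤1+n (suc (bitlen k + size φ)))))

thresholds-∧ φ ψ = ≤-trans (≤-trans (s≤s (≤-reflexive split)) (≤-trans (n≤1+n _) (≤-reflexive (cong suc (sym (+-suc a b))))))
    (2^-+ (size φ) (size ψ) (thresholds φ) (thresholds ψ))
  where
  a b : ℕ
  a = sumᶠ (threshold φ)
  b = sumᶠ (threshold ψ)
  split : sumᶠ (threshold (And φ ψ)) ≡ a + b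
  split = trans (sum-++ (H φ) (threshold (And φ ψ))) (cong₂ _+_
    (sum-cong (λ i → cong [ threshold φ , threshold ψ ]′ (FP.splitAt-↑ˡ (H φ) i (H ψ))))
    (sum-cong (λ j → cong [ threshold φ , threshold ψ ]′ (FP.splitAt-↑ʳ (H φ) (H ψ) j))))

module Size {n m : ℕ} (φ : C2 n m) where
  open Abstract (Translation.signature φ)

  -- `L` bounds the logarithm of the table length `T * suc D`: `N₀` for the 1-type, `s` for the
  -- outcomes of the tests, `2 * s` each for `X` and `Z`, and `s` for `suc D`. `c₁` bounds that of
  -- the number of optional colours; its successor pays for multiplying the types with the tables.
  s N₀ c₁ L g W Y : ℕ
  s = size φ
  N₀ = n + m
  c₁ = suc (m + m)
  L = N₀ + 6 * s
  g = suc c₁ + (N₀ + 6)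
  W = 2 ^ (g * s)
  Y = 2 ^ W

  1≤s : 1 ≤ s
  1≤s = ≤-trans (s≤s z≤n) (2≤size φ)

  scale : ∀ a → a ≤ a * s
  scale a = ≤-trans (≤-reflexive (sym (*-identityʳ a))) (*-monoʳ-≤ a 1≤s)

  L≤ : suc c₁ + L ≤ g * s
  L≤ = ≤-trans (+-mono-≤ (scale (suc c₁)) (≤-trans (+-monoˡ-≤ (6 * s) (scale N₀)) (≤-reflexive (sym (*-distribʳ-+ s N₀ 6)))))
               (≤-reflexive (sym (*-distribʳ-+ s (suc c₁) (N₀ + 6))))

  W≥ : ∀ {a x} → a ≤ L → x ≤ 2 ^ a → x ≤ W
  W≥ h p = ≤-trans p (2^-mono (≤-trans h (≤-trans (m≤n+m L (suc c₁)) L≤)))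

  Y> : ∀ {x} → x ≤ W → x < Y
  Y> h = ≤-trans (s≤s h) (n<2^n W)

  multiples : ∀ j → j ≤ 6 → j * s ≤ L
  multiples j h = ≤-trans (*-monoˡ-≤ s h) (m≤n+m (6 * s) N₀)

  D<2^s : suc D ≤ 2 ^ s
  D<2^s = thresholds φ

  X≤ : X ≤ 2 ^ (s + s)
  X≤ = subst (_≤ 2 ^ (s + s)) (sym X≡) (≤-trans (s≤s (≤-trans (m≤n+m (D + D * D) D) (≤-reflexive (cong (D +_) (sym (*-suc D D)))))) (2^-* s s D<2^s D<2^s))

  Z≤ : Z ≤ 2 ^ (s + s)
  Z≤ = subst (_≤ 2 ^ (s + s)) (sym Z≡) (2^-* s s (≤-trans (n≤1+n 3) (2^-mono (2≤size φ))) D<2^s)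

  A≤ : A ≤ 2 ^ (N₀ + s)
  A≤ = 2^-* N₀ s ≤-refl (2^-mono (H≤size φ))

  TD≤ : T * suc D ≤ 2 ^ L
  TD≤ = ≤-trans (2^-* (N₀ + s + (s + s + (s + s))) s (2^-* (N₀ + s) (s + s + (s + s)) A≤ (2^-* (s + s) (s + s) X≤ Z≤)) D<2^s)
    (≤-reflexive (cong (2 ^_) (solve 2 (λ a b → a :+ b :+ (b :+ b :+ (b :+ b)) :+ b := a :+ con 6 :* b) refl N₀ s)))
    where open +-*-Solver

  T≤ : T ≤ 2 ^ L
  T≤ = ≤-trans (m≤m*n T (suc D)) TD≤

  C< : suc C ≤ 2 ^ c₁
  C< = ≤-trans (+-mono-≤ (m^n>0 2 (m + m)) (2^-* m m ≤-refl ≤-refl)) (≤-reflexive (2^-double (m + m)))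

  P≤ : P ≤ Y
  P≤ = begin
    T * suc C ^ (T * suc D) ≤⟨ *-mono-≤ (≤-trans T≤ (2^-mono (≤-trans (<⇒≤ (n<2^n L)) (2^-mono (m≤n+m L c₁))))) tables ⟩
    2 ^ (2 ^ (c₁ + L)) * 2 ^ (2 ^ (c₁ + L)) ≡⟨ sym (^-distribˡ-+-* 2 (2 ^ (c₁ + L)) (2 ^ (c₁ + L))) ⟩
    2 ^ (2 ^ (c₁ + L) + 2 ^ (c₁ + L)) ≡⟨ cong (2 ^_) (2^-double (c₁ + L)) ⟩
    2 ^ (2 ^ suc (c₁ + L)) ≤⟨ 2^-mono (2^-mono L≤) ⟩
    Y ∎
    where
    open ≤-Reasoning
    tables : suc C ^ (T * suc D) ≤ 2 ^ (2 ^ (c₁ + L))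
    tables = ≤-trans (^-monoˡ-≤ (T * suc D) C<) (≤-trans (≤-reflexive (^-*-assoc 2 c₁ (T * suc D)))
      (2^-mono (2^-* c₁ L (<⇒≤ (n<2^n c₁)) TD≤)))

  s≤L : s ≤ L
  s≤L = ≤-trans (≤-reflexive (sym (*-identityˡ s))) (multiples 1 (s≤s z≤n))

  4≤Y : 4 ≤ Y
  4≤Y = 2^-mono {2} (≤-trans (2≤size φ) (W≥ s≤L (<⇒≤ (n<2^n s))))

  D≤W : D ≤ W
  D≤W = W≥ s≤L (<⇒≤ D<2^s)

  C≤Y : C ≤ Y
  C≤Y = <⇒≤ (Y> (≤-trans (<⇒≤ C<) (2^-mono (≤-trans (≤-trans (n≤1+n c₁) (m≤m+n (suc c₁) L)) L≤))))

  Z<Y : Z < Y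
  Z<Y = Y> (W≥ (≤-trans (≤-reflexive (cong (s +_) (sym (+-identityʳ s)))) (multiples 2 (s≤s (s≤s z≤n)))) Z≤)

  k<Y : ∀ θ → k θ < Y
  k<Y θ = Y> (≤-trans (sum-≥ (threshold φ) θ) D≤W)

  h≤Y : h ≤ Y
  h≤Y = <⇒≤ (Y> (W≥ s≤L (≤-trans (H≤size φ) (<⇒≤ (n<2^n s)))))

  module Result (d : ℕ) (class : Fin A → Fin d → Bool) (d≤ : d ≤ 2 ^ N₀) where
    open Spectrum (Translation.signature φ) d class
    open Bounded Y 4≤Y P≤ (<⇒≤ (Y> (W≥ ≤-refl T≤))) C≤Y (<⇒≤ (Y> D≤W)) h≤Y (<⇒≤ (Y> (W≥ (m≤m+n N₀ (6 * s)) d≤))) Z<Y k<Y public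

    size-bound : epaSize epa ≤ 2 ^ (2 ^ ((g + 8) * s))
    size-bound = begin
      epaSize epa ≤⟨ epa-size ⟩
      (2 ^ W) ^ suc κ ≡⟨ ^-*-assoc 2 W (suc κ) ⟩
      -- `suc κ` is 192, below `2 ^ 8`; this is the summand 8 in the final constant.
      2 ^ (W * suc κ) ≤⟨ 2^-mono (*-monoʳ-≤ W (≤ᵇ⇒≤ (suc κ) (2 ^ 8) _)) ⟩
      2 ^ (W * 2 ^ 8) ≡⟨ cong (2 ^_) (sym (^-distribˡ-+-* 2 (g * s) 8)) ⟩
      2 ^ (2 ^ (g * s + 8)) ≤⟨ 2^-mono (2^-mono (≤-trans (+-monoʳ-≤ (g * s) (scale 8)) (≤-reflexive (sym (*-distribʳ-+ s g 8))))) ⟩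
      2 ^ (2 ^ ((g + 8) * s)) ∎
      where open ≤-Reasoning

    conclude : (S : (Fin d → ℕ) → Set) → (∀ v → S v ⇔ Counts v) →
               Semilinear d S × Σ (EPA d) (λ ψ → Defines ψ S × epaSize ψ ≤ 2 ^ (2 ^ ((g + 8) * s)))
    conclude S e = semilinear-EPA epa S defines , epa , defines , size-bound
      where
      defines : Defines epa S
      defines v = mk⇔ (Equivalence.to (epa-defines v) ∘ Equivalence.to (e v)) (Equivalence.from (e v) ∘ Equivalence.from (epa-defines v))

theorem26 : (n m : ℕ) → Σ ℕ λ c → (φ : C2 n m) → Sentence φ →
    Semilinear 1 (spec¹ φ) × Semilinear (2 ^ (n + m)) (Πspec φ) ×
    Σ (EPA 1) (λ ψ → Defines ψ (spec¹ φ) × epaSize ψ ≤ 2 ^ (2 ^ (c * size φ))) ×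
    Σ (EPA (2 ^ (n + m))) (λ ψ → Defines ψ (Πspec φ) × epaSize ψ ≤ 2 ^ (2 ^ (c * size φ)))
theorem26 n m = suc (suc (m + m)) + (n + m + 6) + 8 , λ φ sentence →
  let (semi , epa) = Size.Result.conclude φ 1 (λ _ _ → true) (m^n>0 2 (n + m)) (spec¹ φ) (Translation.spec⇔Counts φ sentence)
      (Πsemi , Πepa) = Size.Result.conclude φ (2 ^ (n + m)) (λ a b → Translation.atoms φ a == b) ≤-refl (Πspec φ) (Translation.Πspec⇔Counts φ sentence)
  in semi , Πsemi , epa , Πepa
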